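{- Let $V_1,\ldots,V_m$ be finite, pairwise disjoint sets, regarded as $0$-dimensional simplicial complexes, and let $V_1*\cdots*V_m$ denote their join. Let $\Delta_{m-1}$ be the simplex on the vertex set $[m]=\{1,\ldots,m\}$ and let $\pi: V_1*\cdots*V_m\to\Delta_{m-1}$ be the simplicial map given by $\pi(v)=i$ for $v\in V_i$. Let $X\subset V_1*\cdots*V_m$ be a subcomplex, let $Y=\pi(X)$, and let $r=r(X,\pi)=\max\{|\pi^{ -1}(\pi(x))|: x\in|X|\}$. Then $$L(Y)\le r\,L(X)+r-1.$$
   Context: The join $V_1*\cdots*V_m$ is the simplicial complex on the vertex set $V_1\cup\cdots\cup V_m$ whose simplices are the subsets containing at most one vertex from each $V_i$. The map $\pi$ is extended linearly to geometric realizations, and in $r(X,\pi)$ the preimage $\pi^{ -1}(\pi(x))$ is taken inside $|X|$; $Y=\pi(X)=\{\pi(\sigma):\sigma\in X\}$ is a subcomplex of $\Delta_{m-1}$. For a simplicial complex $K$ on vertex set $W$ and $S\subset W$, the induced subcomplex is $K[S]=\{\sigma\in K:\sigma\subset S\}$. The rational Leray number $L(K)$ is the minimal integer $d$ such that $\tilde{\mathrm H}_i(Z;\mathbb Q)=0$ for every induced subcomplex $Z$ of $K$ and every $i\ge d$. -}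

module Defs where

open import Algebra.Bundles.Raw using (RawMonoid)
import Algebra.Definitions.RawMonoid as RawMonoidDefs
open import Data.Bool.Base using (if_then_else_)
import Data.Bool.Properties as Bool
open import Data.Fin.Base using (Fin)
import Data.Fin.Base as Fin
import Data.Fin.Properties as Fin
open import Data.Fin.Subset
  using (Subset; _∈_; _∉_; _⊆_; _∩_; _∪_; ⁅_⁆; ⊥; ∣_∣; Empty)
open import Data.Fin.Subset.Properties
  using ( _∈?_; _⊆?_; ∉⊥; ⊥⊆; ⊆-antisym; ⊆-trans; x∈p∩q⁺; x∈p∩q⁻; p∩q⊆p
        ; p⊆q⇒∣p∣≤∣q∣; ∣p∩q∣≤∣p∣; ∣⊥∣≡0; anySubset?)
open import Data.Integer.Base using (ℤ; +_)
import Data.Integer.Base as ℤ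
open import Data.Nat.Base as ℕ using (ℕ; zero; suc)
import Data.Nat.Properties as ℕ
open import Data.Product.Base using (∃; _×_; _,_; proj₁; proj₂)
open import Data.Rational.Base as ℚ using (ℚ; 0ℚ; 1ℚ; ½) renaming (∣_∣ to abs)
import Data.Rational.Properties as ℚ
open import Data.Rational.Solver using (module +-*-Solver)
open import Data.Vec.Base using (tabulate)
import Data.Vec.Properties as Vec
open import Function.Base using (_∘_)
open import Function.Bundles using (Equivalence; Inverse)
open import Level using (0ℓ)
open import Relation.Binary.Bundles using (Setoid)
open import Relation.Binary.PropositionalEquality
  using (_≡_; _≢_; refl; sym; trans; cong; subst; setoid)
open import Relation.Nullary.Decidable
  using (⌊_⌋; _×-dec_; toWitness; fromWitness)
open import Relation.Unary using (Pred; Decidable)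

------------------------------------------------------------------------
-- Least and greatest elements

IsLeast : Pred ℤ 0ℓ → ℤ → Set
IsLeast P d = P d × (∀ d′ → P d′ → d ℤ.≤ d′)

IsGreatest : Pred ℕ 0ℓ → ℕ → Set
IsGreatest P k = P k × (∀ k′ → P k′ → k′ ℕ.≤ k)

------------------------------------------------------------------------
-- Finite subsets

filterFin : ∀ {n} {P : Pred (Fin n) 0ℓ} → Decidable P → Subset n
filterFin P? = tabulate (λ x → ⌊ P? x ⌋)

∈-filterFin⁺ : ∀ {n} {P : Pred (Fin n) 0ℓ} (P? : Decidable P) {x} →
               P x → x ∈ filterFin P?
∈-filterFin⁺ P? {x} px = Vec.lookup⇒[]= x _
  (trans (Vec.lookup∘tabulate _ x)
         (Equivalence.to Bool.T-≡ (fromWitness {a? = P? x} px)))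

∈-filterFin⁻ : ∀ {n} {P : Pred (Fin n) 0ℓ} (P? : Decidable P) {x} →
               x ∈ filterFin P? → P x
∈-filterFin⁻ P? {x} x∈ = toWitness {a? = P? x}
  (Equivalence.from Bool.T-≡
    (trans (sym (Vec.lookup∘tabulate _ x)) (Vec.[]=⇒lookup x∈)))

module _ {n m : ℕ} (f : Fin n → Fin m) where

  private
    hit? : (σ : Subset n) → Decidable (λ j → ∃ λ v → v ∈ σ × f v ≡ j)
    hit? σ j = Fin.any? (λ v → (v ∈? σ) ×-dec (f v Fin.≟ j))

  image : Subset n → Subset m
  image σ = filterFin (hit? σ)

  ∈-image⁺ : ∀ {σ v} → v ∈ σ → f v ∈ image σ
  ∈-image⁺ {σ} v∈σ = ∈-filterFin⁺ (hit? σ) (_ , v∈σ , refl)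

  ∈-image⁻ : ∀ {σ j} → j ∈ image σ → ∃ λ v → v ∈ σ × f v ≡ j
  ∈-image⁻ {σ} = ∈-filterFin⁻ (hit? σ)

  private
    preimage : Subset m → Subset n
    preimage τ = filterFin (λ v → f v ∈? τ)

  image-∩-preimage : ∀ {σ τ} → τ ⊆ image σ → image (σ ∩ preimage τ) ≡ τ
  image-∩-preimage {σ} {τ} τ⊆ = ⊆-antisym to from
    where
    to : image (σ ∩ preimage τ) ⊆ τ
    to j∈ with ∈-image⁻ j∈
    ... | v , v∈ , refl =
      ∈-filterFin⁻ (λ v → f v ∈? τ) (proj₂ (x∈p∩q⁻ σ (preimage τ) v∈))
    from : τ ⊆ image (σ ∩ preimage τ)
    from j∈τ with ∈-image⁻ (τ⊆ j∈τ)
    ... | v , v∈σ , refl =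
      ∈-image⁺ (x∈p∩q⁺ (v∈σ , ∈-filterFin⁺ (λ v → f v ∈? τ) j∈τ))

------------------------------------------------------------------------
-- Simplicial complexes on the vertex set Fin n

-- The empty simplex always belongs to a complex, but a vertex v : Fin n
-- need not: ⁅ v ⁆ may fail to be a simplex.
record Complex (n : ℕ) : Set₁ where
  field
    Simplex  : Pred (Subset n) 0ℓ
    simplex? : Decidable Simplex
    empty    : Simplex ⊥
    down     : ∀ {σ τ} → τ ⊆ σ → Simplex σ → Simplex τ

open Complex public

_⊑_ : ∀ {n} → Complex n → Complex n → Set
K ⊑ L = ∀ {σ} → Simplex K σ → Simplex L σ

_[_] : ∀ {n} → Complex n → Subset n → Complex n
K [ S ] = record
  { Simplex  = λ σ → Simplex K σ × σ ⊆ S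
  ; simplex? = λ σ → simplex? K σ ×-dec (σ ⊆? S)
  ; empty    = empty K , ⊥⊆
  ; down     = λ τ⊆σ (σ∈K , σ⊆S) → down K τ⊆σ σ∈K , ⊆-trans τ⊆σ σ⊆S
  }

imageComplex : ∀ {n m} → (Fin n → Fin m) → Complex n → Complex m
imageComplex {n} {m} f K = record
  { Simplex  = λ τ → ∃ λ σ → Simplex K σ × image f σ ≡ τ
  ; simplex? = λ τ → anySubset? (λ σ → simplex? K σ ×-dec
                                        Vec.≡-dec Bool._≟_ (image f σ) τ)
  ; empty    = image∈ (empty K) ⊥⊆
  ; down     = λ { τ⊆ (σ , σ∈K , refl) → image∈ σ∈K τ⊆ }
  }
  where
  image∈ : ∀ {σ τ} → Simplex K σ → τ ⊆ image f σ →
           ∃ λ σ′ → Simplex K σ′ × image f σ′ ≡ τ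
  image∈ {σ} σ∈K τ⊆ =
    _ , down K (p∩q⊆p σ _) σ∈K , image-∩-preimage f τ⊆

-- Finite, pairwise disjoint sets V₁, …, Vₘ, whose union is enumerated as
-- Fin n.  Some of the sets may be empty.
record DisjointSets (n m : ℕ) : Set where
  field
    V        : Fin m → Subset n
    disjoint : ∀ {i j} → i ≢ j → Empty (V i ∩ V j)
    covers   : ∀ v → ∃ λ i → v ∈ V i

  -- By disjointness, π v is the only i such that v ∈ V i.
  π : Fin n → Fin m
  π v = proj₁ (covers v)

  join : Complex n
  join = record
    { Simplex  = λ σ → ∀ i → ∣ σ ∩ V i ∣ ℕ.≤ 1
    ; simplex? = λ σ → Fin.all? (λ i → ∣ σ ∩ V i ∣ ℕ.≤? 1)
    ; empty    = λ i → ℕ.≤-trans (∣p∩q∣≤∣p∣ ⊥ (V i))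
                                 (ℕ.≤-trans (ℕ.≤-reflexive (∣⊥∣≡0 n)) ℕ.z≤n)
    ; down     = λ {σ} {τ} τ⊆σ σ∈ i → ℕ.≤-trans
        (p⊆q⇒∣p∣≤∣q∣ (λ x∈ → let x∈τ , x∈V = x∈p∩q⁻ τ (V i) x∈
                              in x∈p∩q⁺ (τ⊆σ x∈τ , x∈V)))
        (σ∈ i)
    }

------------------------------------------------------------------------
-- Reduced rational homology

open RawMonoidDefs ℚ.+-0-rawMonoid using () renaming (sum to sumℚ)

dim : ∀ {n} → Subset n → ℤ
dim σ = + ∣ σ ∣ ℤ.- + 1

-- A chain ∑ c(σ) σ is given by its coefficients; simplices are oriented by
-- the order on Fin n.
Chains : ℕ → Set
Chains n = Subset n → ℚ

IsChain : ∀ {n} → Complex n → ℤ → Chains n → Set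
IsChain K i c = ∀ σ → c σ ≢ 0ℚ → Simplex K σ × dim σ ≡ i

sign : ℕ → ℚ
sign zero    = 1ℚ
sign (suc k) = ℚ.- sign k

position : ∀ {n} → Fin n → Subset n → ℕ
position v τ = ∣ τ ∩ filterFin (Fin._<? v) ∣

-- From ∂[v₀,…,vᵢ] = ∑ⱼ (-1)ʲ [v₀,…,v̂ⱼ,…,vᵢ]: the coefficient of τ in ∂c
-- collects the terms with σ = τ ∪ {v}, v ∉ τ, in which v is omitted from
-- position #{w ∈ τ : w < v}.  In degree 0 this is the augmentation.
∂ : ∀ {n} → Chains n → Chains n
∂ c τ = sumℚ λ v →
  if ⌊ v ∈? τ ⌋ then 0ℚ else sign (position v τ) ℚ.* c (τ ∪ ⁅ v ⁆)

-- H̃ᵢ(K; ℚ) = 0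
H̃-Vanishes : ∀ {n} → ℤ → Complex n → Set
H̃-Vanishes i K = ∀ c → IsChain K i c → (∀ τ → ∂ c τ ≡ 0ℚ) →
  ∃ λ b → IsChain K (ℤ.suc i) b × (∀ σ → ∂ b σ ≡ c σ)

-- L(K) = d
IsLerayNumber : ∀ {n} → Complex n → ℤ → Set
IsLerayNumber K = IsLeast λ d → ∀ S i → d ℤ.≤ i → H̃-Vanishes i (K [ S ])

------------------------------------------------------------------------
-- Real numbers, as Cauchy sequences of rationals up to null sequences

Eventually : Pred ℕ 0ℓ → Set
Eventually P = ∃ λ N → ∀ k → N ℕ.≤ k → P k

record ℝ : Set where
  field
    seq    : ℕ → ℚ
    cauchy : ∀ ε → 0ℚ ℚ.< ε → ∃ λ N → ∀ k l → N ℕ.≤ k → N ℕ.≤ l →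
             abs (seq k ℚ.- seq l) ℚ.< ε

open ℝ public

infix 4 _≈ℝ_ _≤ℝ_
infixl 6 _+ℝ_

_≈ℝ_ _≤ℝ_ : ℝ → ℝ → Set
x ≈ℝ y = ∀ ε → 0ℚ ℚ.< ε → Eventually λ k → abs (seq x k ℚ.- seq y k) ℚ.< ε
x ≤ℝ y = ∀ ε → 0ℚ ℚ.< ε → Eventually λ k → seq x k ℚ.< seq y k ℚ.+ ε

fromℚ : ℚ → ℝ
fromℚ q = record
  { seq    = λ _ → q
  ; cauchy = λ ε 0<ε → 0 , λ _ _ _ _ →
      subst (λ p → abs p ℚ.< ε) (sym (ℚ.+-inverseʳ q)) 0<ε
  }

0ℝ 1ℝ : ℝ
0ℝ = fromℚ 0ℚ
1ℝ = fromℚ 1ℚ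

private
  half-pos : ∀ {ε} → 0ℚ ℚ.< ε → 0ℚ ℚ.< ½ ℚ.* ε
  half-pos {ε} 0<ε = subst (ℚ._< ½ ℚ.* ε) (ℚ.*-zeroʳ ½) (ℚ.*-monoʳ-<-pos ½ 0<ε)

  halves : ∀ ε → ½ ℚ.* ε ℚ.+ ½ ℚ.* ε ≡ ε
  halves ε = trans (sym (ℚ.*-distribʳ-+ ε ½ ½)) (ℚ.*-identityˡ ε)

  abs-+-< : ∀ {p q r ε} → p ℚ.+ q ≡ r →
            abs p ℚ.< ½ ℚ.* ε → abs q ℚ.< ½ ℚ.* ε → abs r ℚ.< ε
  abs-+-< {p} {q} {ε = ε} refl p< q< = ℚ.≤-<-trans (ℚ.∣p+q∣≤∣p∣+∣q∣ p q)
    (subst (abs p ℚ.+ abs q ℚ.<_) (halves ε) (ℚ.+-mono-< p< q<))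

  interchange : ∀ a b c d →
                (a ℚ.- c) ℚ.+ (b ℚ.- d) ≡ (a ℚ.+ b) ℚ.- (c ℚ.+ d)
  interchange = solve 4 (λ a b c d →
    (a :- c) :+ (b :- d) := (a :+ b) :- (c :+ d)) refl
    where open +-*-Solver

  telescope : ∀ a b c → (a ℚ.- b) ℚ.+ (b ℚ.- c) ≡ a ℚ.- c
  telescope = solve 3 (λ a b c → (a :- b) :+ (b :- c) := a :- c) refl
    where open +-*-Solver

  abs-swap : ∀ a b → abs (a ℚ.- b) ≡ abs (b ℚ.- a)
  abs-swap a b = trans (sym (ℚ.∣-p∣≡∣p∣ (a ℚ.- b))) (cong abs
    (solve 2 (λ a b → :- (a :- b) := b :- a) refl a b))
    where open +-*-Solver

_+ℝ_ : ℝ → ℝ → ℝ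
x +ℝ y = record
  { seq    = λ k → seq x k ℚ.+ seq y k
  ; cauchy = λ ε 0<ε →
      let M , x< = cauchy x (½ ℚ.* ε) (half-pos 0<ε)
          N , y< = cauchy y (½ ℚ.* ε) (half-pos 0<ε)
      in M ℕ.⊔ N , λ k l ≤k ≤l →
           abs-+-< (interchange (seq x k) (seq y k) (seq x l) (seq y l))
             (x< k l (ℕ.m⊔n≤o⇒m≤o M N ≤k) (ℕ.m⊔n≤o⇒m≤o M N ≤l))
             (y< k l (ℕ.m⊔n≤o⇒n≤o M N ≤k) (ℕ.m⊔n≤o⇒n≤o M N ≤l))
  }

≈-refl : ∀ {x} → x ≈ℝ x
≈-refl {x} ε 0<ε = 0 , λ k _ →
  subst (λ p → abs p ℚ.< ε) (sym (ℚ.+-inverseʳ (seq x k))) 0<ε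

≈-sym : ∀ {x y} → x ≈ℝ y → y ≈ℝ x
≈-sym {x} {y} x≈y ε 0<ε = let N , x< = x≈y ε 0<ε in
  N , λ k ≤k → subst (ℚ._< ε) (abs-swap (seq x k) (seq y k)) (x< k ≤k)

≈-trans : ∀ {x y z} → x ≈ℝ y → y ≈ℝ z → x ≈ℝ z
≈-trans {x} {y} {z} x≈y y≈z ε 0<ε =
  let M , x< = x≈y (½ ℚ.* ε) (half-pos 0<ε)
      N , y< = y≈z (½ ℚ.* ε) (half-pos 0<ε)
  in M ℕ.⊔ N , λ k ≤k →
       abs-+-< (telescope (seq x k) (seq y k) (seq z k))
         (x< k (ℕ.m⊔n≤o⇒m≤o M N ≤k)) (y< k (ℕ.m⊔n≤o⇒n≤o M N ≤k))

ℝ-rawMonoid : RawMonoid 0ℓ 0ℓ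
ℝ-rawMonoid = record { Carrier = ℝ ; _≈_ = _≈ℝ_ ; _∙_ = _+ℝ_ ; ε = 0ℝ }

open RawMonoidDefs ℝ-rawMonoid using () renaming (sum to sumℝ)

------------------------------------------------------------------------
-- Geometric realization

-- A point of |K|, in barycentric coordinates.  The simplex containing the
-- point need not be its exact support, and points are compared by their
-- coordinates only.
record ∣_∣ᴳ {n} (K : Complex n) : Set where
  field
    coord     : Fin n → ℝ
    coord≥0   : ∀ v → 0ℝ ≤ℝ coord v
    coord-sum : sumℝ coord ≈ℝ 1ℝ
    carrier   : ∃ λ σ → Simplex K σ × (∀ v → v ∉ σ → coord v ≈ℝ 0ℝ)

open ∣_∣ᴳ public

-- The barycentric coordinates of the image of a point under the linear
-- extension of a vertex map f.
push : ∀ {n m} {K : Complex n} → (Fin n → Fin m) → ∣ K ∣ᴳ → Fin m → ℝ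
push f x j = sumℝ λ v → if ⌊ f v Fin.≟ j ⌋ then coord x v else 0ℝ

-- f⁻¹(f(x)) inside |K|
Fibre : ∀ {n m} {K : Complex n} → (Fin n → Fin m) → ∣ K ∣ᴳ → Setoid 0ℓ 0ℓ
Fibre {K = K} f x = record
  { Carrier       = ∃ λ (y : ∣ K ∣ᴳ) → ∀ j → push f y j ≈ℝ push f x j
  ; _≈_           = λ (y , _) (z , _) → ∀ v → coord y v ≈ℝ coord z v
  ; isEquivalence = record
    { refl  = λ {(y , _)} v → ≈-refl {coord y v}
    ; sym   = λ {(y , _)} {(z , _)} y≈z v →
                ≈-sym {coord y v} {coord z v} (y≈z v)
    ; trans = λ {(x , _)} {(y , _)} {(z , _)} x≈y y≈z v →
                ≈-trans {coord x v} {coord y v} {coord z v} (x≈y v) (y≈z v)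
    }
  }

HasCardinality : Setoid 0ℓ 0ℓ → ℕ → Set
HasCardinality S k = Inverse (setoid (Fin k)) S

-- r(K,f) = k.  There is no such k when |K| is empty.
IsMaxFibreSize : ∀ {n m} → Complex n → (Fin n → Fin m) → ℕ → Set
IsMaxFibreSize K f =
  IsGreatest λ k → ∃ λ (x : ∣ K ∣ᴳ) → HasCardinality (Fibre f x) k

{-# OPTIONS --safe #-}
module Submission where

-- The simplices of X over a set τ of colours, for varying τ, form a cube: forgetting a colour
-- restricts simplices.  A cube is d-Leray if the total complex of its restriction to any set of
-- colours is exact in dimensions ≥ d.  By Künneth the external product of a d₁-Leray and a
-- d₂-Leray cube is (d₁ + d₂)-Leray, and this survives the identification of two colours: the
-- map that forgets both factors through the maps forgetting one, each of which is injective
-- on homology in the critical dimension.  So the k-fold fibrewise power of X is kL(X)-Leray.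
--
-- For τ ∈ Y the alternating chains on k-tuples of simplices over τ, k = 0, 1, …, form an exact
-- complex, which ends at k = r since at most r simplices lie over τ: the points of |X| over the
-- barycentre of τ are their barycentres.  This resolves the chains on Y by those on the
-- fibrewise powers, and shifting dimensions along the resolution turns exactness of the k-th
-- power in dimensions ≥ kL(X) for k ≤ r into exactness of Y in dimensions ≥ rL(X) + r − 1.

-- In a join a simplex has at most one vertex of each colour, so a simplex over τ has exactly |τ|
-- vertices. The simplices over τ therefore span a vector space without a differential of its own,
-- and the chains of X on the colours in S are the total complex of these spaces, up to orientation
-- signs.
--
-- The constant: the zigzag starts with 1-tuples over sets of q colours, and passing from k-tuples
-- to (k + 1)-tuples costs one colour. On k-tuples q - k + 1 colours remain, and exactness of the
-- k-th power there asks for q - k + 1 > kL(X). The case k = r is the strictest: q ≥ rL(X) + r, that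
-- is, dimension q - 1 ≥ rL(X) + r - 1.
--
-- Fillings in the powers cannot be made alternating, since Künneth speaks about all tuples.
-- Alternation is needed for lifting along the resolution, so it is maintained for the lifted chains
-- and never asked of the fillings.
--
-- Künneth fills all columns of a product at once, so the fillings in one factor must depend
-- linearly on the cycles; a generalised inverse of the boundary matrix provides this over a field.
-- Characteristic 0 enters where the resolution averages over entries and over simplices.

open import Defs hiding (∂; push)
import Defs
open import Algebra.Bundles using (CommutativeRing)
import Algebra.Definitions.RawMonoid as RawMonoidDefs
import Algebra.Properties.CommutativeMonoid.Sum as CommutativeMonoidSum
open import Algebra.Structures using (IsCommutativeRing)
open import Data.Bool.Base using (Bool; true; false; if_then_else_; _∧_; not; _∨_)
import Data.Bool.Properties as Bool
open import Data.Empty using (⊥-elim; ⊥)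
open import Data.Fin.Base as Fin using (Fin; zero; suc)
import Data.Fin.Properties as Fin
open import Data.Fin.Subset using (∣_∣; Subset; _∈_; _∉_; _⊆_; _∩_; _∪_; ⁅_⁆)
open import Data.Fin.Subset.Properties
  using (⊆-antisym; ∪-identityʳ; _∈?_; x∈p⇒∣p-x∣<∣p∣; x∈p∧x≢y⇒x∈p-y; x∈p∩q⁺; x∈p∩q⁻; ∉⊥
        ; ∣⊥∣≡0)
open import Data.Integer.Base as ℤ using (ℤ; -[1+_]; +≤+; -≤-)
import Data.Integer.Properties as ℤ
open import Data.Nat.Base as ℕ using (ℕ; zero; suc; _≡ᵇ_; _<ᵇ_)
import Data.Nat.Properties as ℕ
open import Data.Product.Base using (∃; _×_; _,_; proj₁; proj₂; ∃₂)
open import Data.Rational.Base as ℚ using (ℚ; 0ℚ; 1ℚ; ½)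
import Data.Rational.Properties as ℚ
open import Data.Sum.Base using (_⊎_; inj₁; inj₂)
open import Data.Unit.Base using (tt; ⊤)
open import Data.Vec.Base using (Vec; []; _∷_; _[_]≔_; lookup; tabulate)
open import Data.Vec.Functional using (Vector)
import Data.Vec.Properties as Vec
open import Function.Base using (_∘_; id)
open import Function.Bundles using (Inverse; _⇔_; Equivalence; mk⇔)
open import Level using (0ℓ)
open import Relation.Binary.PropositionalEquality hiding ([_])
open import Relation.Nullary.Decidable
  using (dec⇒maybe; Dec; yes; no; does; isYes≗does; ⌊_⌋; _×-dec_; decidable-stable)
open import Relation.Nullary.Negation using (¬_)
open import Tactic.RingSolver using (solve-∀)
open import Tactic.RingSolver.Core.AlmostCommutativeRing
  using (AlmostCommutativeRing; fromCommutativeRing)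

-- The field operations are opaque, as conversion checking would otherwise
-- unfold them down to integer arithmetic.

infixl 6 _+_
infixl 7 _*_
infix  8 -_

opaque
  _+_ _*_ : ℚ → ℚ → ℚ
  _+_ = ℚ._+_
  _*_ = ℚ._*_

  -_ : ℚ → ℚ
  -_ = ℚ.-_

  isCommutativeRing : IsCommutativeRing _≡_ _+_ _*_ -_ 0ℚ 1ℚ
  isCommutativeRing = ℚ.+-*-isCommutativeRing

ℚ-commutativeRing : CommutativeRing 0ℓ 0ℓ
ℚ-commutativeRing = record { isCommutativeRing = isCommutativeRing }

open CommutativeRing ℚ-commutativeRing
  using (+-comm; +-assoc; +-identityˡ; +-identityʳ; *-comm; *-assoc; *-identityˡ; *-identityʳ
        ; zeroˡ; zeroʳ; distribˡ; distribʳ; -‿inverseˡ; -‿inverseʳ)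

ℚ-ring : AlmostCommutativeRing 0ℓ 0ℓ
ℚ-ring = fromCommutativeRing ℚ-commutativeRing (λ x → dec⇒maybe (0ℚ ℚ.≟ x))

opaque
  unfolding _+_ _*_ -_

  neg-scale : ∀ a → - a ≡ (- 1ℚ) * a
  neg-scale = solve-∀ ℚ-ring

  neg-+ : ∀ a b → - (a + b) ≡ - a + - b
  neg-+ = solve-∀ ℚ-ring

  neg-*ʳ : ∀ a b → - (a * b) ≡ a * - b
  neg-*ʳ = solve-∀ ℚ-ring

  neg-neg : ∀ a → - - a ≡ a
  neg-neg = solve-∀ ℚ-ring

  neg-0 : - 0ℚ ≡ 0ℚ
  neg-0 = refl

  +-interchange : ∀ a b c d → (a + b) + (c + d) ≡ (a + c) + (b + d)
  +-interchange = solve-∀ ℚ-ring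

-- Linear maps between spaces of rational functions

Chain : Set → Set
Chain I = I → ℚ

infixl 6 _⊕_
infixr 7 _⊙_

_⊕_ : ∀ {I} → Chain I → Chain I → Chain I
(x ⊕ y) i = x i + y i

_⊙_ : ∀ {I} → ℚ → Chain I → Chain I
(q ⊙ x) i = q * x i

𝟘 : ∀ {I} → Chain I
𝟘 _ = 0ℚ

record Linear {I J : Set} (f : Chain I → Chain J) : Set where
  field
    ext   : ∀ {x y} → x ≗ y → f x ≗ f y
    add   : ∀ x y → f (x ⊕ y) ≗ f x ⊕ f y
    scale : ∀ q x → f (q ⊙ x) ≗ q ⊙ f x

  null : ∀ {x} → x ≗ 𝟘 → f x ≗ 𝟘
  null {x} x≗0 j = trans (ext (λ i → trans (x≗0 i) (sym (zeroˡ (x i)))) j)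
                  (trans (scale 0ℚ x j) (zeroˡ (f x j)))

  neg : ∀ x → f (λ i → - x i) ≗ λ j → - f x j
  neg x j = trans (ext (λ i → neg-scale (x i)) j)
           (trans (scale (- 1ℚ) x j) (sym (neg-scale (f x j))))

open Linear

id-linear : ∀ {I : Set} → Linear {I} id
id-linear = record { ext = λ e → e ; add = λ _ _ _ → refl ; scale = λ _ _ _ → refl }

∘-linear : ∀ {I J K} {g : Chain J → Chain K} {f : Chain I → Chain J} →
           Linear g → Linear f → Linear (g ∘ f)
∘-linear {g = g} {f} lg lf = record
  { ext   = λ e → ext lg (ext lf e)
  ; add   = λ x y k → trans (ext lg (add lf x y) k) (add lg (f x) (f y) k)
  ; scale = λ q x k → trans (ext lg (scale lf q x) k) (scale lg q (f x) k)
  }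

-- Cubes of complexes

-- All complexes of a cube share one index set of cells, and colour sets enter only through
-- supports. Thus `∂` and `ρ j` are plain maps on a single space, and no chain space depends on a
-- colour set.
record Ops (I : Set) (N : ℕ) : Set where
  field
    deg : I → ℕ
    ∂   : Chain I → Chain I
    -- ρ j forgets the colour j.
    ρ   : Fin N → Chain I → Chain I

open Ops

-- G τ selects the cells with colour set τ.
Colouring : ℕ → Set → Set
Colouring N I = Vec Bool N → I → Bool

Supp : ∀ {I : Set} → (I → Bool) → Chain I → Set
Supp G c = ∀ i → G i ≡ false → c i ≡ 0ℚ

Hom : ∀ {I : Set} → (I → ℕ) → (ℕ → Bool) → Chain I → Set
Hom d p c = ∀ i → p (d i) ≡ false → c i ≡ 0ℚ

-- A simplex with q vertices has degree q, not q - 1.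
Exact : ∀ {I} → Ops I 0 → (I → Bool) → ℕ → Set
Exact O G q = ∀ c → Supp G c → Hom (deg O) (_≡ᵇ q) c → ∂ O c ≗ 𝟘 →
  ∃ λ b → Supp G b × Hom (deg O) (_≡ᵇ suc q) b × ∂ O b ≗ c

slice : ∀ {I} → Bool → Chain (Bool × I) → Chain I
slice b c i = c (b , i)

pair : ∀ {I} → Chain I → Chain I → Chain (Bool × I)
pair x y (false , i) = x i
pair x y (true  , i) = y i

diag : ∀ {I J} → (Chain I → Chain J) → Chain (Bool × I) → Chain (Bool × J)
diag f c (b , i) = f (slice b c) i

forget : ∀ {I N} → Ops I N → Ops I 0
forget O = record { deg = deg O ; ∂ = ∂ O ; ρ = λ () }

tailOps : ∀ {I N} → Ops I (suc N) → Ops I N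
tailOps O = record { deg = deg O ; ∂ = ∂ O ; ρ = ρ O ∘ suc }

coneDeg : ∀ {I : Set} → (I → ℕ) → Bool × I → ℕ
coneDeg d (false , i) = d i
coneDeg d (true  , i) = suc (d i)

coneDiff : ∀ {I} → (∂ f : Chain I → Chain I) → Chain (Bool × I) → Chain (Bool × I)
coneDiff ∂ f c (false , i) = ∂ (slice false c) i + f (slice true c) i
coneDiff ∂ f c (true  , i) = - ∂ (slice true c) i

cone : ∀ {I N} → (Chain I → Chain I) → Ops I N → Ops (Bool × I) N
cone f O = record
  { deg = coneDeg (deg O) ; ∂ = coneDiff (∂ O) f ; ρ = λ j → diag (ρ O j) }

select : ∀ {I : Set} → (I → Bool) → (I → Bool) → Bool × I → Bool
select G₀ G₁ (false , i) = G₀ i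
select G₀ G₁ (true  , i) = G₁ i

coneG : ∀ {I N} → Colouring N I → Colouring N I → Colouring N (Bool × I)
coneG G₀ G₁ τ = select (G₀ τ) (G₁ τ)

-- Unrolled, every colour is either discarded (first component) or coned over (second component), so
-- there is one exactness condition for each set of colours. Degrees count vertices: `d < q` means
-- dimension at least d.
Leray : ℕ → ∀ N {I} → Ops I N → Colouring N I → Set
Leray d zero    O G = ∀ q → d ℕ.< q → Exact O (G []) q
Leray d (suc N) O G =
  Leray d N (tailOps O) (G ∘ (false ∷_)) ×
  Leray d N (cone (ρ O zero) (tailOps O)) (coneG (G ∘ (false ∷_)) (G ∘ (true ∷_)))

-- `weight` expresses that `f` preserves degrees: it commutes with multiplication by every function
-- of the degree. Indicator functions turn this into homogeneity, and `sgn` into the sign rules for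
-- products.
record Compatible {I N} (O : Ops I N) (f : Chain I → Chain I) : Set where
  field
    linear : Linear f
    weight : ∀ (w : ℕ → ℚ) c → f (λ i → w (deg O i) * c i) ≗ λ i → w (deg O i) * f c i
    comm-∂ : ∀ c → f (∂ O c) ≗ ∂ O (f c)
    comm-ρ : ∀ j c → f (ρ O j c) ≗ ρ O j (f c)

record Lawful {I N} (O : Ops I N) : Set where
  field
    ∂-linear : Linear (∂ O)
    -- ∂ lowers the degree by one.
    ∂-weight : ∀ (w : ℕ → ℚ) c →
               ∂ O (λ i → w (deg O i) * c i) ≗ λ i → w (suc (deg O i)) * ∂ O c i
    ∂∂       : ∀ c → ∂ O (∂ O c) ≗ 𝟘
    ρ-compat : ∀ j → Compatible O (ρ O j)

open Compatible
open Lawful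

indicator : (ℕ → Bool) → ℕ → ℚ
indicator p d = if p d then 1ℚ else 0ℚ

hom-indicator : ∀ {I : Set} {d : I → ℕ} {p} {c : Chain I} → Hom d p c →
                c ≗ λ i → indicator p (d i) * c i
hom-indicator {d = d} {p} {c} h i with p (d i) in eq
... | true  = sym (*-identityˡ (c i))
... | false = trans (h i eq) (sym (zeroˡ (c i)))

indicator-hom : ∀ {p} d {a} → p d ≡ false → indicator p d * a ≡ 0ℚ
indicator-hom {p} d {a} eq rewrite eq = zeroˡ a

compatible-hom : ∀ {I N} {O : Ops I N} {f} → Compatible O f → ∀ p {c} →
                 Hom (deg O) p c → Hom (deg O) p (f c)
compatible-hom {O = O} cf p {c} h i eq =
  trans (ext (linear cf) (hom-indicator {d = deg O} {p} h) i)
 (trans (weight cf (indicator p) c i) (indicator-hom {p} (deg O i) eq))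

∂-hom : ∀ {I N} {O : Ops I N} → Lawful O → ∀ p {c} →
        Hom (deg O) p c → Hom (deg O) (p ∘ suc) (∂ O c)
∂-hom {O = O} lo p {c} h i eq =
  trans (ext (∂-linear lo) (hom-indicator {d = deg O} {p} h) i)
 (trans (∂-weight lo (indicator p) c i) (indicator-hom {p} (suc (deg O i)) eq))

diag-linear : ∀ {I J} {f : Chain I → Chain J} → Linear f → Linear (diag f)
diag-linear lf = record
  { ext   = λ { e (b , j) → ext lf (λ i → e (b , i)) j }
  ; add   = λ { x y (b , j) → add lf (slice b x) (slice b y) j }
  ; scale = λ { q x (b , j) → scale lf q (slice b x) j }
  }

tail-compatible : ∀ {I N} {O : Ops I (suc N)} {f} → Compatible O f → Compatible (tailOps O) f
tail-compatible cf = record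
  { linear = linear cf ; weight = weight cf ; comm-∂ = comm-∂ cf ; comm-ρ = λ j → comm-ρ cf (suc j) }

tail-lawful : ∀ {I N} {O : Ops I (suc N)} → Lawful O → Lawful (tailOps O)
tail-lawful lo = record
  { ∂-linear = ∂-linear lo ; ∂-weight = ∂-weight lo ; ∂∂ = ∂∂ lo
  ; ρ-compat = λ j → tail-compatible (ρ-compat lo (suc j)) }

cone-compatible : ∀ {I N} {O : Ops I N} {f g} → Compatible O g →
                  (∀ c → g (f c) ≗ f (g c)) → Compatible (cone f O) (diag g)
cone-compatible {O = O} {f} {g} cg gf = record
  { linear = diag-linear (linear cg)
  ; weight = λ { w c (false , i) → weight cg w (slice false c) i
               ; w c (true , i) → weight cg (w ∘ suc) (slice true c) i }
  ; comm-∂ = λ { c (false , i) → trans (add (linear cg) _ _ i)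
                                       (cong₂ _+_ (comm-∂ cg _ i) (gf _ i))
               ; c (true , i) → trans (neg (linear cg) _ i) (cong -_ (comm-∂ cg _ i)) }
  ; comm-ρ = λ { j c (b , i) → comm-ρ cg j (slice b c) i }
  }

cone-lawful : ∀ {I N} {O : Ops I N} {f} → Lawful O → Compatible O f → Lawful (cone f O)
cone-lawful {O = O} {f} lo cf = record
  { ∂-linear = record
    { ext = λ { e (false , i) → cong₂ _+_ (ext (∂-linear lo) (λ k → e (false , k)) i)
                                          (ext (linear cf) (λ k → e (true , k)) i)
              ; e (true , i) → cong -_ (ext (∂-linear lo) (λ k → e (true , k)) i) }
    ; add = λ { x y (false , i) →
                  trans (cong₂ _+_ (add (∂-linear lo) _ _ i) (add (linear cf) _ _ i)) (+-interchange _ _ _ _)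
              ; x y (true , i) →
                  trans (cong -_ (add (∂-linear lo) _ _ i)) (neg-+ _ _) }
    ; scale = λ { q x (false , i) →
                    trans (cong₂ _+_ (scale (∂-linear lo) _ _ i) (scale (linear cf) _ _ i))
                          (sym (distribˡ q _ _))
                ; q x (true , i) →
                    trans (cong -_ (scale (∂-linear lo) _ _ i)) (neg-*ʳ q _) }
    }
  ; ∂-weight = λ { w c (false , i) →
                     trans (cong₂ _+_ (∂-weight lo w _ i) (weight cf (w ∘ suc) _ i))
                           (sym (distribˡ (w _) _ _))
                 ; w c (true , i) →
                     trans (cong -_ (∂-weight lo (w ∘ suc) _ i)) (neg-*ʳ (w _) _) }
  ; ∂∂ = λ { c (false , i) →
               trans (cong₂ _+_ (trans (add (∂-linear lo) _ _ i)
                                       (cong₂ _+_ (∂∂ lo _ i) (sym (comm-∂ cf _ i))))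
                                (neg (linear cf) _ i))
                     (trans (cong (_+ (- f (∂ O (slice true c)) i)) (+-identityˡ _)) (-‿inverseʳ _))
           ; c (true , i) → trans (cong -_ (trans (neg (∂-linear lo) _ i) (cong -_ (∂∂ lo _ i))))
                                  (neg-neg 0ℚ) }
  ; ρ-compat = λ j → cone-compatible (ρ-compat lo j) (λ c i → sym (comm-ρ cf j c i))
  }
-- Transfer of exactness along a retraction up to supports

record Transfer {N} {I J : Set} (O : Ops I N) (G : Colouring N I)
                (O′ : Ops J N) (G′ : Colouring N J) : Set where
  field
    φ        : Chain I → Chain J
    ψ        : Chain J → Chain I
    φ-linear : Linear φ
    ψ-linear : Linear ψ
    φ-∂      : ∀ τ c → Supp (G τ) c → φ (∂ O c) ≗ ∂ O′ (φ c)
    ψ-∂      : ∀ τ c → Supp (G′ τ) c → ψ (∂ O′ c) ≗ ∂ O (ψ c)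
    φ-ρ      : ∀ j c → φ (ρ O j c) ≗ ρ O′ j (φ c)
    ψ-ρ      : ∀ j c → ψ (ρ O′ j c) ≗ ρ O j (ψ c)
    φ-supp   : ∀ τ c → Supp (G τ) c → Supp (G′ τ) (φ c)
    ψ-supp   : ∀ τ c → Supp (G′ τ) c → Supp (G τ) (ψ c)
    φ-hom    : ∀ p c → Hom (deg O) p c → Hom (deg O′) p (φ c)
    ψ-hom    : ∀ p c → Hom (deg O′) p c → Hom (deg O) p (ψ c)
    φψ       : ∀ τ c → Supp (G′ τ) c → φ (ψ c) ≗ c

module _ {I J : Set} where
  open Transfer

  -- Both colourings live on the same cells, so one pair of maps has to serve both summands of the
  -- cone; the two equations say so.
  cone-transfer : ∀ {N} {O : Ops I N} {G₀ G₁} {O′ : Ops J N} {G₀′ G₁′} {f f′} →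
    (t₀ : Transfer O G₀ O′ G₀′) (t₁ : Transfer O G₁ O′ G₁′) → φ t₁ ≡ φ t₀ → ψ t₁ ≡ ψ t₀ →
    (∀ c → φ t₀ (f c) ≗ f′ (φ t₀ c)) → (∀ c → ψ t₀ (f′ c) ≗ f (ψ t₀ c)) →
    Transfer (cone f O) (coneG G₀ G₁) (cone f′ O′) (coneG G₀′ G₁′)
  cone-transfer t₀ t₁ refl refl φf ψf = record
    { φ = diag (φ t₀) ; ψ = diag (ψ t₀)
    ; φ-linear = diag-linear (φ-linear t₀) ; ψ-linear = diag-linear (ψ-linear t₀)
    ; φ-∂ = λ { τ c s (false , i) → trans (add (φ-linear t₀) _ _ i)
                  (cong₂ _+_ (φ-∂ t₀ τ _ (λ k → s (false , k)) i) (φf _ i))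
              ; τ c s (true , i) → trans (neg (φ-linear t₀) _ i)
                  (cong -_ (φ-∂ t₁ τ _ (λ k → s (true , k)) i)) }
    ; ψ-∂ = λ { τ c s (false , i) → trans (add (ψ-linear t₀) _ _ i)
                  (cong₂ _+_ (ψ-∂ t₀ τ _ (λ k → s (false , k)) i) (ψf _ i))
              ; τ c s (true , i) → trans (neg (ψ-linear t₀) _ i)
                  (cong -_ (ψ-∂ t₁ τ _ (λ k → s (true , k)) i)) }
    ; φ-ρ = λ { j c (b , i) → φ-ρ t₀ j _ i } ; ψ-ρ = λ { j c (b , i) → ψ-ρ t₀ j _ i }
    ; φ-supp = λ { τ c s (false , i) → φ-supp t₀ τ _ (λ k → s (false , k)) i
                 ; τ c s (true , i) → φ-supp t₁ τ _ (λ k → s (true , k)) i }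
    ; ψ-supp = λ { τ c s (false , i) → ψ-supp t₀ τ _ (λ k → s (false , k)) i
                 ; τ c s (true , i) → ψ-supp t₁ τ _ (λ k → s (true , k)) i }
    ; φ-hom = λ { p c h (false , i) → φ-hom t₀ p _ (λ k → h (false , k)) i
                ; p c h (true , i) → φ-hom t₀ (p ∘ suc) _ (λ k → h (true , k)) i }
    ; ψ-hom = λ { p c h (false , i) → ψ-hom t₀ p _ (λ k → h (false , k)) i
                ; p c h (true , i) → ψ-hom t₀ (p ∘ suc) _ (λ k → h (true , k)) i }
    ; φψ = λ { τ c s (false , i) → φψ t₀ τ _ (λ k → s (false , k)) i
             ; τ c s (true , i) → φψ t₁ τ _ (λ k → s (true , k)) i }
    }

  with-∷ : ∀ {N} {O : Ops I (suc N)} {G} {O′ : Ops J (suc N)} {G′} b → Transfer O G O′ G′ →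
           Transfer (tailOps O) (G ∘ (b ∷_)) (tailOps O′) (G′ ∘ (b ∷_))
  with-∷ b t = record
    { φ = φ t ; ψ = ψ t ; φ-linear = φ-linear t ; ψ-linear = ψ-linear t
    ; φ-∂ = λ τ → φ-∂ t (b ∷ τ) ; ψ-∂ = λ τ → ψ-∂ t (b ∷ τ)
    ; φ-ρ = λ j → φ-ρ t (suc j) ; ψ-ρ = λ j → ψ-ρ t (suc j)
    ; φ-supp = λ τ → φ-supp t (b ∷ τ) ; ψ-supp = λ τ → ψ-supp t (b ∷ τ)
    ; φ-hom = φ-hom t ; ψ-hom = ψ-hom t ; φψ = λ τ → φψ t (b ∷ τ)
    }

-- A cycle is pulled back along `ψ`, filled there, and the filling is pushed forward along `φ`; `φψ`
-- returns the original cycle.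
exact-transfer : ∀ {I J} {O : Ops I 0} {G} {O′ : Ops J 0} {G′} → Transfer O G O′ G′ →
                 ∀ {q} → Exact O (G []) q → Exact O′ (G′ []) q
exact-transfer {O = O} {O′ = O′} t ex c sc hc cyc =
  let b , sb , hb , ∂b = ex (ψ c) (ψ-supp [] c sc) (ψ-hom (_≡ᵇ _) c hc)
        (λ i → trans (sym (ψ-∂ [] c sc i)) (null ψ-linear cyc i))
  in φ b , φ-supp [] b sb , φ-hom (_≡ᵇ _) b hb ,
     λ i → trans (sym (φ-∂ [] b sb i)) (trans (ext φ-linear ∂b i) (φψ [] c sc i))
  where open Transfer t

leray-transfer : ∀ {d} N {I J} {O : Ops I N} {G} {O′ : Ops J N} {G′} → Transfer O G O′ G′ →
                 Leray d N O G → Leray d N O′ G′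
leray-transfer zero    t l q d<q = exact-transfer t (l q d<q)
leray-transfer (suc N) t (l₀ , l₁) =
  leray-transfer N (with-∷ false t) l₀ ,
  leray-transfer N (cone-transfer (with-∷ false t) (with-∷ true t) refl refl
                     (φ-ρ zero) (ψ-ρ zero)) l₁
  where open Transfer t

-- Collapsing two colours into one

Maps : ∀ {N} {I J : Set} → (Chain I → Chain J) → Colouring N I → Colouring N J → Set
Maps f G G′ = ∀ τ c → Supp (G τ) c → Supp (G′ τ) (f c)

opaque
  unfolding _+_ _*_ -_

  regroup-difference : ∀ u w v w′ → (u + - v) + w + (- w′) ≡ (u + w) + - (v + w′)
  regroup-difference = solve-∀ ℚ-ring

  regroup-correction : ∀ u b y → (u + - b) + y ≡ u + (- b + y)
  regroup-correction = solve-∀ ℚ-ring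

difference-of-fillings : ∀ u w v w′ x → u + w ≡ x → v + w′ ≡ x →
                         (u + - v) + w + (- w′) ≡ 0ℚ
difference-of-fillings u w v w′ x p q =
  trans (regroup-difference u w v w′)
        (trans (cong₂ (λ a b → a + - b) p q) (-‿inverseʳ x))

corrected-filling : ∀ u b y w x → u + w ≡ x → - b + y ≡ w → (u + - b) + y ≡ x
corrected-filling u b y _ _ refl refl = regroup-correction u b y

neg-zero : ∀ {a} → a ≡ 0ℚ → - a ≡ 0ℚ
neg-zero refl = neg-0

add-zero : ∀ {a b} → a ≡ 0ℚ → b ≡ 0ℚ → a + b ≡ 0ℚ
add-zero refl refl = +-identityˡ 0ℚ

module _ {I : Set} (O : Ops I 0) (f g : Chain I → Chain I)
         (G₀₀ G₁₀ G₀₁ G₁₁ : Colouring 0 I)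
         (lo : Lawful O) (cf : Compatible O f) (cg : Compatible O g)
         (fg≗gf : ∀ c → f (g c) ≗ g (f c))
         (f₁₁ : Maps f G₁₁ G₀₁) (f₁₀ : Maps f G₁₀ G₀₀) (g₁₁ : Maps g G₁₁ G₁₀)
         where

  private
    B I₂ : Set
    B = Bool
    I₂ = B × (B × I)

    quad : Chain I → Chain I → Chain I → Chain I → Chain I₂
    quad x₀₀ x₁₀ x₀₁ x₁₁ = pair (pair x₀₀ x₁₀) (pair x₀₁ x₁₁)

  -- A cycle (x , y) of the cone of `f ∘ g` yields the cycles (x , g y) and (x , f y) of the two
  -- single cones. Their fillings, glued along y, form a cycle of the whole square one degree
  -- higher. A filling of that cycle fills y in its last corner and corrects the filling of x.
  collapse-exact : ∀ q →
    Exact (cone f O) (coneG G₀₀ G₁₀ []) q →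
    Exact (cone g O) (coneG G₀₀ G₀₁ []) q →
    Exact (cone (diag g) (cone f O)) (coneG (coneG G₀₀ G₁₀) (coneG G₀₁ G₁₁) []) (suc q) →
    Exact (cone (f ∘ g) O) (coneG G₀₀ G₁₁ []) q
  collapse-exact q exf exg exfg c sc hc cyc =
    -- The (false , true) component of the filling of `total` reads g B₁₁ - ∂ B₁₀ = `slice true b₁`.
    -- Applying f trades the term f (`slice true b₁`) in the boundary of `b₁` for f (g B₁₁) - ∂ (f
    -- B₁₀).
    pair (λ i → slice false b₁ i + - f B₁₀ i) B₁₁ , supp , hom , boundary
    where
    x y : Chain I
    x = slice false c
    y = slice true c
    sx : Supp (G₀₀ []) x
    sx i = sc (false , i)
    sy : Supp (G₁₁ []) y
    sy i = sc (true , i)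
    ∂y≗0 : ∂ O y ≗ 𝟘
    ∂y≗0 i = trans (sym (neg-neg _)) (neg-zero (cyc (true , i)))

    fill-f : ∃ λ b → Supp (coneG G₀₀ G₁₀ []) b × Hom (deg (cone f O)) (_≡ᵇ suc q) b ×
                     ∂ (cone f O) b ≗ pair x (g y)
    fill-f = exf (pair x (g y))
      (λ { (false , i) → sx i ; (true , i) → g₁₁ [] y sy i })
      (λ { (false , i) → hc (false , i)
         ; (true , i) → compatible-hom cg (λ d → suc d ≡ᵇ q) (λ k → hc (true , k)) i })
      (λ { (false , i) → cyc (false , i)
         ; (true , i) → neg-zero (trans (sym (comm-∂ cg y i)) (null (linear cg) ∂y≗0 i)) })
    fill-g : ∃ λ b → Supp (coneG G₀₀ G₀₁ []) b × Hom (deg (cone g O)) (_≡ᵇ suc q) b ×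
                     ∂ (cone g O) b ≗ pair x (f y)
    fill-g = exg (pair x (f y))
      (λ { (false , i) → sx i ; (true , i) → f₁₁ [] y sy i })
      (λ { (false , i) → hc (false , i)
         ; (true , i) → compatible-hom cf (λ d → suc d ≡ᵇ q) (λ k → hc (true , k)) i })
      (λ { (false , i) → trans (cong (∂ O x i +_) (sym (fg≗gf y i))) (cyc (false , i))
         ; (true , i) → neg-zero (trans (sym (comm-∂ cf y i)) (null (linear cf) ∂y≗0 i)) })
    b₁ b₂ : Chain (B × I)
    b₁ = proj₁ fill-f
    b₂ = proj₁ fill-g
    s₁ = proj₁ (proj₂ fill-f)
    s₂ = proj₁ (proj₂ fill-g)
    h₁ = proj₁ (proj₂ (proj₂ fill-f))
    h₂ = proj₁ (proj₂ (proj₂ fill-g))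
    ∂b₁ = proj₂ (proj₂ (proj₂ fill-f))
    ∂b₂ = proj₂ (proj₂ (proj₂ fill-g))

    -- Both fillings have x as their boundary in the corner (false , false), so x cancels in the
    -- difference; the signs of the other corners are those that make the result a cycle.
    total : Chain I₂
    total = quad (λ i → slice false b₁ i + - slice false b₂ i) (slice true b₁)
                 (λ i → - slice true b₂ i) (λ i → - y i)
    fill : ∃ λ b → Supp (coneG (coneG G₀₀ G₁₀) (coneG G₀₁ G₁₁) []) b ×
                   Hom (deg (cone (diag g) (cone f O))) (_≡ᵇ suc (suc q)) b ×
                   ∂ (cone (diag g) (cone f O)) b ≗ total
    fill = exfg total
      (λ { (false , false , i) e → add-zero (s₁ (false , i) e) (neg-zero (s₂ (false , i) e))
         ; (false , true , i) → s₁ (true , i)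
         ; (true , false , i) e → neg-zero (s₂ (true , i) e)
         ; (true , true , i) e → neg-zero (sy i e) })
      (λ { (false , false , i) e → add-zero (h₁ (false , i) e) (neg-zero (h₂ (false , i) e))
         ; (false , true , i) → h₁ (true , i)
         ; (true , false , i) e → neg-zero (h₂ (true , i) e)
         ; (true , true , i) e → neg-zero (hc (true , i) e) })
      (λ { (false , false , i) →
             trans (cong₂ (λ a e → a + f (slice true b₁) i + e)
                          (trans (add (∂-linear lo) _ _ i) (cong (∂ O (slice false b₁) i +_) (neg (∂-linear lo) _ i)))
                          (neg (linear cg) (slice true b₂) i))
                   (difference-of-fillings _ _ _ _ _ (∂b₁ (false , i)) (∂b₂ (false , i)))
         ; (false , true , i) →
             trans (cong₂ _+_ (∂b₁ (true , i)) (neg (linear cg) y i)) (-‿inverseʳ _)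
         ; (true , false , i) →
             neg-zero (trans (cong₂ _+_ (trans (neg (∂-linear lo) _ i) (∂b₂ (true , i))) (neg (linear cf) y i))
                             (-‿inverseʳ _))
         ; (true , true , i) →
             neg-zero (neg-zero (trans (neg (∂-linear lo) y i) (neg-zero (∂y≗0 i)))) })
    b = proj₁ fill
    sb = proj₁ (proj₂ fill)
    hb = proj₁ (proj₂ (proj₂ fill))
    ∂b = proj₂ (proj₂ (proj₂ fill))
    B₁₀ B₁₁ : Chain I
    B₁₀ i = b (false , true , i)
    B₁₁ i = b (true , true , i)

    supp : Supp (coneG G₀₀ G₁₁ []) (pair (λ i → slice false b₁ i + - f B₁₀ i) B₁₁)
    supp (false , i) e =
      add-zero (s₁ (false , i) e) (neg-zero (f₁₀ [] B₁₀ (λ k → sb (false , true , k)) i e))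
    supp (true , i) = sb (true , true , i)
    hom : Hom (deg (cone (f ∘ g) O)) (_≡ᵇ suc q) (pair (λ i → slice false b₁ i + - f B₁₀ i) B₁₁)
    hom (false , i) e =
      add-zero (h₁ (false , i) e)
               (neg-zero (compatible-hom cf (_≡ᵇ suc q) (λ k → hb (false , true , k)) i e))
    hom (true , i) = hb (true , true , i)
    boundary : ∂ (cone (f ∘ g) O) (pair (λ i → slice false b₁ i + - f B₁₀ i) B₁₁) ≗ c
    boundary (false , i) =
      trans (cong (_+ f (g B₁₁) i)
              (trans (add (∂-linear lo) _ _ i)
                     (cong (∂ O (slice false b₁) i +_) (neg (∂-linear lo) (f B₁₀) i))))
            (corrected-filling _ _ _ _ _ (∂b₁ (false , i))
              (trans (cong (λ a → - a + f (g B₁₁) i) (sym (comm-∂ cf B₁₀ i)))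
              (trans (cong (_+ f (g B₁₁) i) (sym (neg (linear cf) (∂ O B₁₀) i)))
              (trans (sym (add (linear cf) _ _ i))
                     (ext (linear cf) (λ k → ∂b (false , true , k)) i)))))
    boundary (true , i) =
      trans (cong -_ (trans (sym (neg-neg _)) (∂b (true , true , i)))) (neg-neg _)

-- The order in which two cones are taken is immaterial up to a sign.

swap-chain : ∀ {I} → Chain (Bool × (Bool × I)) → Chain (Bool × (Bool × I))
swap-chain c (true  , true  , i) = - c (true , true , i)
swap-chain c (true  , false , i) = c (false , true , i)
swap-chain c (false , true  , i) = c (true , false , i)
swap-chain c (false , false , i) = c (false , false , i)

swap-chain-linear : ∀ {I} → Linear (swap-chain {I})
swap-chain-linear = record
  { ext = λ { e (true , true , i) → cong -_ (e _) ; e (true , false , i) → e _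
            ; e (false , true , i) → e _ ; e (false , false , i) → e _ }
  ; add = λ { x y (true , true , i) → neg-+ _ _ ; x y (true , false , i) → refl
            ; x y (false , true , i) → refl ; x y (false , false , i) → refl }
  ; scale = λ { q x (true , true , i) → neg-*ʳ _ _ ; q x (true , false , i) → refl
              ; q x (false , true , i) → refl ; q x (false , false , i) → refl }
  }

opaque
  unfolding _+_ _*_ -_

  +-swap : ∀ a b c → (a + b) + c ≡ (a + c) + b
  +-swap = solve-∀ ℚ-ring

  neg-swap : ∀ a b → - a + b ≡ - (a + - b)
  neg-swap = solve-∀ ℚ-ring

swap-commutes : ∀ {I N} (O : Ops I N) {f g} → Linear (∂ O) → Linear f → Linear g → ∀ c →
  swap-chain (∂ (cone (diag g) (cone f O)) c) ≗ ∂ (cone (diag f) (cone g O)) (swap-chain c)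
swap-commutes O lo lf lg c (false , false , i) = +-swap _ _ _
swap-commutes O lo lf lg c (false , true  , i) =
  trans (neg-+ _ _) (cong₂ _+_ refl (sym (neg lf (λ k → c (true , true , k)) i)))
swap-commutes O lo lf lg c (true  , false , i) =
  trans (neg-swap _ _) (cong (λ a → - (∂ O _ i + a)) (sym (neg lg _ i)))
swap-commutes O lo lf lg c (true  , true  , i) = cong (λ a → - - a) (sym (neg lo (λ k → c (true , true , k)) i))

swap-supp : ∀ {I : Set} {N} {G₀₀ G₁₀ G₀₁ G₁₁ : Colouring N I} τ c →
  Supp (coneG (coneG G₀₀ G₁₀) (coneG G₀₁ G₁₁) τ) c →
  Supp (coneG (coneG G₀₀ G₀₁) (coneG G₁₀ G₁₁) τ) (swap-chain c)
swap-supp τ c s (false , false , i) e = s _ e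
swap-supp τ c s (false , true  , i) e = s _ e
swap-supp τ c s (true  , false , i) e = s _ e
swap-supp τ c s (true  , true  , i) e = neg-zero (s _ e)

swap-hom : ∀ {I N} (O : Ops I N) {f g} p c →
  Hom (deg (cone (diag g) (cone f O))) p c → Hom (deg (cone (diag f) (cone g O))) p (swap-chain c)
swap-hom O p c h (false , false , i) e = h _ e
swap-hom O p c h (false , true  , i) e = h _ e
swap-hom O p c h (true  , false , i) e = h _ e
swap-hom O p c h (true  , true  , i) e = neg-zero (h _ e)

swap-ρ : ∀ {I} {r : Chain I → Chain I} → Linear r → ∀ c →
         swap-chain (diag (diag r) c) ≗ diag (diag r) (swap-chain c)
swap-ρ lr c (false , false , i) = refl
swap-ρ lr c (false , true  , i) = refl
swap-ρ lr c (true  , false , i) = refl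
swap-ρ lr c (true  , true  , i) = sym (neg lr _ i)

swap-swap : ∀ {I} (c : Chain (Bool × (Bool × I))) → swap-chain (swap-chain c) ≗ c
swap-swap c (false , false , i) = refl
swap-swap c (false , true  , i) = refl
swap-swap c (true  , false , i) = refl
swap-swap c (true  , true  , i) = neg-neg _

swap-transfer : ∀ {I N} (O : Ops I N) {f g} {G₀₀ G₁₀ G₀₁ G₁₁ : Colouring N I} →
  Lawful O → Linear f → Linear g →
  Transfer (cone (diag g) (cone f O)) (coneG (coneG G₀₀ G₁₀) (coneG G₀₁ G₁₁))
           (cone (diag f) (cone g O)) (coneG (coneG G₀₀ G₀₁) (coneG G₁₀ G₁₁))
swap-transfer O {f} {g} {G₀₀ = G₀₀} {G₁₀} {G₀₁} {G₁₁} lo lf lg = record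
  { φ = swap-chain ; ψ = swap-chain
  ; φ-linear = swap-chain-linear ; ψ-linear = swap-chain-linear
  ; φ-∂ = λ _ c _ → swap-commutes O (∂-linear lo) lf lg c
  ; ψ-∂ = λ _ c _ → swap-commutes O (∂-linear lo) lg lf c
  ; φ-ρ = λ j → swap-ρ (linear (ρ-compat lo j)) ; ψ-ρ = λ j → swap-ρ (linear (ρ-compat lo j))
  ; φ-supp = swap-supp {G₀₀ = G₀₀} {G₁₀} {G₀₁} {G₁₁} ; ψ-supp = swap-supp {G₀₀ = G₀₀} {G₀₁} {G₁₀} {G₁₁}
  ; φ-hom = swap-hom O {f} {g} ; ψ-hom = swap-hom O {g} {f}
  ; φψ = λ _ c _ → swap-swap c
  }

Maps-∷ : ∀ {N} {I J : Set} {f : Chain I → Chain J} {G : Colouring (suc N) I} {G′} b →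
         Maps f G G′ → Maps f (G ∘ (b ∷_)) (G′ ∘ (b ∷_))
Maps-∷ b m τ = m (b ∷ τ)

Maps-cone : ∀ {N} {I J : Set} {f : Chain I → Chain J} {G₀ G₁ : Colouring N I} {G₀′ G₁′} →
            Maps f G₀ G₀′ → Maps f G₁ G₁′ → Maps (diag f) (coneG G₀ G₁) (coneG G₀′ G₁′)
Maps-cone m₀ m₁ τ c s (false , i) = m₀ τ _ (λ k → s (false , k)) i
Maps-cone m₀ m₁ τ c s (true  , i) = m₁ τ _ (λ k → s (true , k)) i

-- Induction on the remaining colours. Discarding the head colour gives the first component; for the
-- second, the cone over the head colour is moved inside the cones of f and g, which leaves the same
-- situation over `cone s O′`.
collapse : ∀ {d} N {I} (O : Ops I N) (f g : Chain I → Chain I)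
  (G₀₀ G₁₀ G₀₁ G₁₁ : Colouring N I) → Lawful O → Compatible O f → Compatible O g →
  (∀ c → f (g c) ≗ g (f c)) → Maps f G₁₁ G₀₁ → Maps f G₁₀ G₀₀ → Maps g G₁₁ G₁₀ →
  Leray d N (cone f O) (coneG G₀₀ G₁₀) →
  Leray d N (cone g O) (coneG G₀₀ G₀₁) →
  Leray d N (cone (diag g) (cone f O)) (coneG (coneG G₀₀ G₁₀) (coneG G₀₁ G₁₁)) →
  Leray d N (cone (f ∘ g) O) (coneG G₀₀ G₁₁)
collapse zero O f g G₀₀ G₁₀ G₀₁ G₁₁ lo cf cg fg f₁₁ f₁₀ g₁₁ lf lg lfg q d<q =
  collapse-exact O f g G₀₀ G₁₀ G₀₁ G₁₁ lo cf cg fg f₁₁ f₁₀ g₁₁ q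
    (lf q d<q) (lg q d<q) (lfg (suc q) (ℕ.m<n⇒m<1+n d<q))
collapse {d} (suc N) O f g G₀₀ G₁₀ G₀₁ G₁₁ lo cf cg fg f₁₁ f₁₀ g₁₁ lf lg lfg =
  collapse N O′ f g _ _ _ _ lo′ cf′ cg′ fg (Maps-∷ false f₁₁) (Maps-∷ false f₁₀) (Maps-∷ false g₁₁)
    (proj₁ lf) (proj₁ lg) (proj₁ lfg) ,
  leray-transfer N (swap-transfer O′ lo′ (linear cs) (∘-linear (linear cf) (linear cg)))
    (collapse N (cone s O′) (diag f) (diag g) _ _ _ _ (cone-lawful lo′ cs)
      (cone-compatible cf′ (comm-ρ cf zero)) (cone-compatible cg′ (comm-ρ cg zero))
      (λ { c (b , i) → fg (slice b c) i })
      (Maps-cone (Maps-∷ false f₁₁) (Maps-∷ true f₁₁)) (Maps-cone (Maps-∷ false f₁₀) (Maps-∷ true f₁₀))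
      (Maps-cone (Maps-∷ false g₁₁) (Maps-∷ true g₁₁))
      (leray-transfer N (swap-transfer O′ lo′ (linear cf) (linear cs)) (proj₂ lf))
      (leray-transfer N (swap-transfer O′ lo′ (linear cg) (linear cs)) (proj₂ lg))
      -- The cone over the head colour first passes the outer cone of g, then the cone of f inside
      -- it.
      (leray-transfer N
        (cone-transfer (swap-transfer O′ lo′ (linear cf) (linear cs))
                       (swap-transfer O′ lo′ (linear cf) (linear cs)) refl refl
                       (swap-ρ (linear cg)) (swap-ρ (linear cg)))
        (leray-transfer N
          (swap-transfer (cone f O′) (cone-lawful lo′ cf′) (diag-linear (linear cg)) (diag-linear (linear cs)))
          (proj₂ lfg))))
  where
  O′ = tailOps O
  lo′ = tail-lawful lo
  s = ρ O zero
  cs = tail-compatible (ρ-compat lo zero)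
  cf′ = tail-compatible cf
  cg′ = tail-compatible cg

-- Linear algebra over finite index sets

opaque
  unfolding _+_ _*_ -_

  reciprocal : ∀ q → q ≢ 0ℚ → ∃ λ r → r * q ≡ 1ℚ
  reciprocal q q≢0 = ℚ.1/_ q {{ℚ.≢-nonZero q≢0}} , ℚ.*-inverseˡ q {{ℚ.≢-nonZero q≢0}}

  rotate-* : ∀ u r x a → ((x * u) * r) * a ≡ (r * u) * (x * a)
  rotate-* = solve-∀ ℚ-ring

  residual-cancel : ∀ p q s → (p + q) + - (p + s) ≡ q + - s
  residual-cancel = solve-∀ ℚ-ring

  regroup-projection : ∀ p s z → (p + - s) + z ≡ p + (z + - s)
  regroup-projection = solve-∀ ℚ-ring

  add-back : ∀ p y → p + (y + - p) ≡ y
  add-back = solve-∀ ℚ-ring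

infixl 6 _⊖_

_⊖_ : ∀ {I} → Chain I → Chain I → Chain I
(x ⊖ y) i = x i + - y i

module _ {I J : Set} {f : Chain I → Chain J} (lf : Linear f) where

  sub : ∀ x y → f (x ⊖ y) ≗ f x ⊖ f y
  sub x y j = trans (add lf x _ j) (cong (f x j +_) (neg lf y j))

  ⊖-linear : ∀ {g : Chain I → Chain J} → Linear g → Linear (λ x → f x ⊖ g x)
  ⊖-linear lg = record
    { ext   = λ e j → cong₂ (λ a b → a + - b) (ext lf e j) (ext lg e j)
    ; add   = λ x y j → trans (cong₂ (λ a b → a + - b) (add lf x y j) (add lg x y j))
                              (trans (cong (_ +_) (neg-+ _ _)) (+-interchange _ _ _ _))
    ; scale = λ q x j → trans (cong₂ (λ a b → a + - b) (scale lf q x j) (scale lg q x j))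
                              (trans (cong (_ +_) (neg-*ʳ q _)) (sym (distribˡ q _ _)))
    }

reindex-linear : ∀ {I J : Set} (θ : J → I) → Linear {I} {J} (_∘ θ)
reindex-linear θ = record
  { ext = λ e j → e (θ j) ; add = λ _ _ _ → refl ; scale = λ _ _ _ → refl }

pair-left-linear : ∀ {I} → Linear {I} (λ x → pair x 𝟘)
pair-left-linear = record
  { ext = λ { e (false , i) → e i ; e (true , i) → refl }
  ; add = λ { x y (false , i) → refl ; x y (true , i) → sym (+-identityˡ 0ℚ) }
  ; scale = λ { q x (false , i) → refl ; q x (true , i) → sym (zeroʳ q) }
  }

pair-right-linear : ∀ {I} → Linear {I} (pair 𝟘)
pair-right-linear = record
  { ext = λ { e (true , i) → e i ; e (false , i) → refl }
  ; add = λ { x y (true , i) → refl ; x y (false , i) → sym (+-identityˡ 0ℚ) }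
  ; scale = λ { q x (true , i) → refl ; q x (false , i) → sym (zeroʳ q) }
  }

-- The index sets that need finiteness are built from bit vectors and factors `Bool`, so their sizes
-- are powers of two. Doubling as the induction step splits a linear map into two blocks of columns.
data Finite : Set → Set₁ where
  single : ∀ {I} (x : I) → (∀ y → x ≡ y) → Finite I
  double : ∀ {I J} → Finite I → (ι : Bool × I → J) (κ : J → Bool × I) →
           (∀ j → ι (κ j) ≡ j) → (∀ i → κ (ι i) ≡ i) → Finite J

finite-× : ∀ {I} → Finite I → Finite (Bool × I)
finite-× fin = double fin id id (λ _ → refl) (λ _ → refl)

finite-Vec : ∀ n → Finite (Vec Bool n)
finite-Vec zero    = single [] λ { [] → refl }
finite-Vec (suc n) = double (finite-Vec n) (λ (b , v) → b ∷ v) (λ { (b ∷ v) → b , v })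
                            (λ { (b ∷ v) → refl }) (λ _ → refl)

search : ∀ {I} → Finite I → (c : Chain I) → c ≗ 𝟘 ⊎ ∃ λ i → c i ≢ 0ℚ
search (single x x≡) c with c x ℚ.≟ 0ℚ
... | yes cx≡0 = inj₁ λ y → trans (cong c (sym (x≡ y))) cx≡0
... | no  cx≢0 = inj₂ (x , cx≢0)
search (double fin ι κ ικ κι) c
  with search fin (slice false (c ∘ ι)) | search fin (slice true (c ∘ ι))
... | inj₂ (i , p) | _            = inj₂ (ι (false , i) , p)
... | inj₁ z       | inj₂ (i , p) = inj₂ (ι (true , i) , p)
... | inj₁ z₀      | inj₁ z₁      = inj₁ λ j → trans (cong c (sym (ικ j))) (zeros (κ j))
  where
  zeros : c ∘ ι ≗ 𝟘
  zeros (false , i) = z₀ i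
  zeros (true  , i) = z₁ i

linear-single : ∀ {I J} {f : Chain I → Chain J} → Linear f → (x : I) → (∀ y → x ≡ y) →
                ∀ c → f c ≗ c x ⊙ f (λ _ → 1ℚ)
linear-single lf x x≡ c j =
  trans (ext lf (λ y → trans (cong c (sym (x≡ y))) (sym (*-identityʳ (c x)))) j)
        (scale lf (c x) _ j)

module _ {I J K : Set} (ι : Bool × I → J) (κ : J → Bool × I)
         (ικ : ∀ j → ι (κ j) ≡ j) (κι : ∀ i → κ (ι i) ≡ i)
         {f : Chain J → Chain K} (lf : Linear f) where

  left-part right-part : Chain I → Chain K
  left-part  x = f (pair x 𝟘 ∘ κ)
  right-part x = f (pair 𝟘 x ∘ κ)

  left-part-linear : Linear left-part
  left-part-linear = ∘-linear lf (∘-linear (reindex-linear κ) pair-left-linear)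

  right-part-linear : Linear right-part
  right-part-linear = ∘-linear lf (∘-linear (reindex-linear κ) pair-right-linear)

  linear-pair : ∀ x y → f (pair x y ∘ κ) ≗ left-part x ⊕ right-part y
  linear-pair x y k =
    trans (ext lf (λ j → split (κ j)) k) (add lf (pair x 𝟘 ∘ κ) (pair 𝟘 y ∘ κ) k)
    where
    split : ∀ i → pair x y i ≡ pair x 𝟘 i + pair 𝟘 y i
    split (false , i) = sym (+-identityʳ _)
    split (true  , i) = sym (+-identityˡ _)

  linear-double : ∀ c → f c ≗ left-part (slice false (c ∘ ι)) ⊕ right-part (slice true (c ∘ ι))
  linear-double c k = trans (ext lf (λ j → trans (cong c (sym (ικ j))) (eta (κ j))) k)
                            (linear-pair _ _ k)
    where
    eta : c ∘ ι ≗ pair (slice false (c ∘ ι)) (slice true (c ∘ ι))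
    eta (false , i) = refl
    eta (true  , i) = refl

-- On a finite index set a linear map is a matrix, so maps acting on different variables commute, as
-- f ⊗ 1 and 1 ⊗ g do.
linear-comm : ∀ {I J K L} → Finite I → {f : Chain I → Chain K} {g : Chain J → Chain L} →
              Linear f → Linear g → ∀ (c : I → Chain J) k l →
              f (λ i → g (c i) l) k ≡ g (λ j → f (λ i → c i j) k) l
linear-comm (single x x≡) {f} {g} lf lg c k l =
  trans (linear-single lf x x≡ _ k)
 (trans (*-comm _ _)
 (trans (sym (scale lg _ (c x) l))
        (ext lg (λ j → trans (*-comm _ _) (sym (linear-single lf x x≡ _ k))) l)))
linear-comm (double fin ι κ ικ κι) {f} {g} lf lg c k l =
  trans (linear-double ι κ ικ κι lf _ k)
 (trans (cong₂ _+_
          (linear-comm fin (left-part-linear ι κ ικ κι lf) lg (λ i → c (ι (false , i))) k l)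
          (linear-comm fin (right-part-linear ι κ ικ κι lf) lg (λ i → c (ι (true , i))) k l))
 (trans (sym (add lg _ _ l))
        (ext lg (λ j → sym (linear-double ι κ ικ κι lf (λ i → c i j) k)) l)))

-- Block elimination on columns: write A = [A₁ A₂], take h₁ for A₁ and h₂ for B = (1 - A₁h₁)A₂,
-- solve for the second block with h₂ and substitute back. No bases or complements have to be
-- chosen.
generalised-inverse : ∀ {I J} → Finite I → Finite J → {A : Chain I → Chain J} → Linear A →
  ∃ λ (h : Chain J → Chain I) → Linear h × (∀ x → A (h (A x)) ≗ A x)
generalised-inverse (single x x≡) finJ {A} lA with search finJ (A (λ _ → 1ℚ))
... | inj₁ A1≗0 = (λ _ → 𝟘) ,
  record { ext = λ _ _ → refl ; add = λ _ _ _ → sym (+-identityˡ 0ℚ)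
         ; scale = λ q _ _ → sym (zeroʳ q) } ,
  λ c j → trans (null lA (λ _ → refl) j)
                (sym (trans (linear-single lA x x≡ c j) (trans (cong (c x *_) (A1≗0 j)) (zeroʳ _))))
... | inj₂ (j₀ , a≢0) with r , ra≡1 ← reciprocal _ a≢0 = (λ y _ → y j₀ * r) ,
  record { ext = λ e _ → cong (_* r) (e j₀) ; add = λ x y _ → distribʳ r _ _
         ; scale = λ q y _ → *-assoc q _ r } ,
  λ c j → trans (linear-single lA x x≡ _ j)
         (trans (cong (λ a → (a * r) * A (λ _ → 1ℚ) j) (linear-single lA x x≡ c j₀))
         (trans (rotate-* _ r (c x) _)
         (trans (cong (_* _) ra≡1)
         (trans (*-identityˡ _) (sym (linear-single lA x x≡ c j))))))
generalised-inverse (double {I} {I′} fin ι κ ικ κι) finJ {A} lA =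
  h , h-linear , AhA
  where
  A₁ = left-part ι κ ικ κι lA
  A₂ = right-part ι κ ικ κι lA
  lA₁ = left-part-linear ι κ ικ κι lA
  lA₂ = right-part-linear ι κ ικ κι lA
  h₁ = proj₁ (generalised-inverse fin finJ lA₁)
  lh₁ = proj₁ (proj₂ (generalised-inverse fin finJ lA₁))
  A₁h₁A₁ = proj₂ (proj₂ (generalised-inverse fin finJ lA₁))
  residual : Chain _ → Chain _
  residual y = y ⊖ A₁ (h₁ y)
  residual-linear = ⊖-linear id-linear (∘-linear lA₁ lh₁)
  lB : Linear (residual ∘ A₂)
  lB = ∘-linear residual-linear lA₂
  h₂ = proj₁ (generalised-inverse fin finJ lB)
  lh₂ = proj₁ (proj₂ (generalised-inverse fin finJ lB))
  Bh₂B = proj₂ (proj₂ (generalised-inverse fin finJ lB))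
  z : Chain _ → Chain I
  z y = h₂ (residual y)
  lz : Linear z
  lz = ∘-linear lh₂ residual-linear
  h : Chain _ → Chain I′
  h y = pair (h₁ (y ⊖ A₂ (z y))) (z y) ∘ κ
  l₁ : Linear (λ y → h₁ (y ⊖ A₂ (z y)))
  l₁ = ∘-linear lh₁ (⊖-linear id-linear (∘-linear lA₂ lz))
  pair-linear : Linear (λ y → pair (h₁ (y ⊖ A₂ (z y))) (z y))
  pair-linear = record
    { ext = λ { e (false , i) → ext l₁ e i ; e (true , i) → ext lz e i }
    ; add = λ { x y (false , i) → add l₁ x y i ; x y (true , i) → add lz x y i }
    ; scale = λ { q x (false , i) → scale l₁ q x i ; q x (true , i) → scale lz q x i }
    }
  h-linear = ∘-linear (reindex-linear κ) pair-linear
  AhA : ∀ c → A (h (A c)) ≗ A c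
  AhA c j =
    trans (linear-pair ι κ ικ κι lA _ _ j)
   (trans (cong (_+ A₂ (z y) j) (trans (ext lA₁ (sub lh₁ y (A₂ (z y))) j) (sub lA₁ _ _ j)))
   (trans (regroup-projection _ _ _)
   (trans (cong (A₁ (h₁ y) j +_)
            (trans (ext (∘-linear residual-linear (∘-linear lA₂ lh₂)) residual≗ j)
            (trans (Bh₂B _ j) (sym (residual≗ j)))))
          (add-back _ _))))
    where
    y = A c
    x₁ = slice false (c ∘ ι)
    x₂ = slice true (c ∘ ι)
    -- 1 - A₁h₁ kills the image of A₁, so only the second block survives and the defining property
    -- of h₂ applies.
    residual≗ : residual y ≗ residual (A₂ x₂)
    residual≗ k =
      trans (cong₂ (λ a b → a + - b) (linear-double ι κ ικ κι lA c k)
              (trans (ext (∘-linear lA₁ lh₁) (linear-double ι κ ικ κι lA c) k)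
              (trans (add (∘-linear lA₁ lh₁) (A₁ x₁) (A₂ x₂) k)
                     (cong (_+ A₁ (h₁ (A₂ x₂)) k) (A₁h₁A₁ x₁ k)))))
            (residual-cancel _ _ _)

≡ᵇ-refl : ∀ n → (n ≡ᵇ n) ≡ true
≡ᵇ-refl zero    = refl
≡ᵇ-refl (suc n) = ≡ᵇ-refl n

≡ᵇ-sound : ∀ m n → (m ≡ᵇ n) ≡ true → m ≡ n
≡ᵇ-sound zero    zero    _ = refl
≡ᵇ-sound (suc m) (suc n) e = cong suc (≡ᵇ-sound m n e)

true≢false : ∀ {A : Set} {b} → b ≡ true → b ≡ false → A
true≢false refl ()

-- A homotopy contracting the degrees above d

opaque
  unfolding _+_ _*_ -_

  scale-swap : ∀ p q a → p * (q * a) ≡ q * (p * a)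
  scale-swap = solve-∀ ℚ-ring

  homotopy-regroup : ∀ a p r → (a + - 0ℚ) + (p + - r) ≡ (a + - r) + p
  homotopy-regroup = solve-∀ ℚ-ring

  subtract-add : ∀ y p → (y + - p) + p ≡ y
  subtract-add = solve-∀ ℚ-ring

mask : ∀ {I : Set} → (I → ℚ) → Chain I → Chain I
mask w c i = w i * c i

mask-linear : ∀ {I : Set} (w : I → ℚ) → Linear (mask w)
mask-linear w = record
  { ext = λ e i → cong (w i *_) (e i) ; add = λ x y i → distribˡ (w i) _ _
  ; scale = λ q x i → scale-swap (w i) q (x i) }

-- Exactness fills one cycle at a time, whereas a linear `κ` can be applied to all columns of a
-- product simultaneously. `κ-weight` says that `κ` raises the degree by one.
record Contraction {I} (O : Ops I 0) (G : I → Bool) (d : ℕ) : Set where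
  field
    κ        : Chain I → Chain I
    κ-linear : Linear κ
    κ-weight : ∀ (w : ℕ → ℚ) c →
               κ (λ i → w (suc (deg O i)) * c i) ≗ λ i → w (deg O i) * κ c i
    κ-supp   : ∀ {c} → Supp G c → Supp G (κ c)
    homotopy : ∀ x → Supp G x → ∀ i → d ℕ.< deg O i → ∂ O (κ x) i + κ (∂ O x) i ≡ x i

module _ {I} (fin : Finite I) (O : Ops I 0) (G : I → Bool) (d : ℕ) (lo : Lawful O)
         (∂-supp : ∀ c → Supp G c → Supp G (∂ O c)) (ex : ∀ q → d ℕ.< q → Exact O G q) where

  private
    inG : I → ℚ
    inG i = if G i then 1ℚ else 0ℚ

    component : ℕ → Chain I → Chain I
    component q = mask (indicator (_≡ᵇ q) ∘ deg O)

    P : ℕ → Chain I → Chain I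
    P q = component q ∘ mask inG

    P-linear : ∀ q → Linear (P q)
    P-linear q = ∘-linear (mask-linear _) (mask-linear inG)

    inG-id : ∀ {x} → Supp G x → mask inG x ≗ x
    inG-id {x} sx i with G i in eq
    ... | true  = *-identityˡ _
    ... | false = trans (zeroˡ _) (sym (sx i eq))

    P-supp : ∀ q x → Supp G (P q x)
    P-supp q x i e with G i
    ... | false = trans (cong (_ *_) (zeroˡ _)) (zeroʳ _)

    P-hom : ∀ q x → Hom (deg O) (_≡ᵇ q) (P q x)
    P-hom q x i e = indicator-hom {_≡ᵇ q} (deg O i) e

    P-id : ∀ q {x} → Supp G x → Hom (deg O) (_≡ᵇ q) x → P q x ≗ x
    P-id q {x} sx hx i =
      trans (cong (indicator (_≡ᵇ q) (deg O i) *_) (inG-id sx i))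
            (sym (hom-indicator {d = deg O} {_≡ᵇ q} hx i))

    A-linear : ∀ q → Linear (∂ O ∘ P q)
    A-linear q = ∘-linear (∂-linear lo) (P-linear q)

    h : ℕ → Chain I → Chain I
    h q = proj₁ (generalised-inverse fin fin (A-linear q))

    h-linear : ∀ q → Linear (h q)
    h-linear q = proj₁ (proj₂ (generalised-inverse fin fin (A-linear q)))

    H : ℕ → Chain I → Chain I
    H q = P (suc q) ∘ h (suc q)

    H-linear : ∀ q → Linear (H q)
    H-linear q = ∘-linear (P-linear (suc q)) (h-linear (suc q))

    H-supp : ∀ q x → Supp G (H q x)
    H-supp q x = P-supp (suc q) (h (suc q) x)

    H-hom : ∀ q x → Hom (deg O) (_≡ᵇ suc q) (H q x)
    H-hom q x = P-hom (suc q) (h (suc q) x)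

    ∂H∂ : ∀ q y → Supp G y → Hom (deg O) (_≡ᵇ suc q) y → ∂ O (H q (∂ O y)) ≗ ∂ O y
    ∂H∂ q y sy hy i =
      trans (ext (∘-linear (∂-linear lo) (H-linear q)) (ext (∂-linear lo) (λ k → sym (P-id (suc q) sy hy k))) i)
     (trans (proj₂ (proj₂ (generalised-inverse fin fin (A-linear (suc q)))) y i)
            (ext (∂-linear lo) (P-id (suc q) sy hy) i))

    -- `H` inverts ∂ only on boundaries. With the correction term, ∂K + K∂ becomes ∂H(y - H∂y) +
    -- H∂y; here y - H∂y is a cycle, hence a boundary by exactness, and ∂H fixes it.
    K : ℕ → Chain I → Chain I
    K q x = H q x ⊖ ∂ O (H (suc q) (H q x))

    K-linear : ∀ q → Linear (K q)
    K-linear q = ⊖-linear (H-linear q)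
      (∘-linear (∂-linear lo) (∘-linear (H-linear (suc q)) (H-linear q)))

    K-supp : ∀ q x → Supp G (K q x)
    K-supp q x i e = add-zero (H-supp q x i e) (neg-zero (∂-supp _ (H-supp (suc q) (H q x)) i e))

    K-hom : ∀ q x → Hom (deg O) (_≡ᵇ suc q) (K q x)
    K-hom q x i e = add-zero (H-hom q x i e)
      (neg-zero (∂-hom lo (_≡ᵇ suc (suc q)) (H-hom (suc q) (H q x)) i e))

    K-homotopy : ∀ q y → d ℕ.< suc q → Supp G y → Hom (deg O) (_≡ᵇ suc q) y →
                 ∂ O (K (suc q) y) ⊕ K q (∂ O y) ≗ y
    K-homotopy q y d<q sy hy i =
      trans (cong (_+ K q (∂ O y) i)
               (trans (sub (∂-linear lo) _ _ i) (cong (λ a → ∂ O (H (suc q) y) i + - a) (∂∂ lo _ i))))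
     (trans (homotopy-regroup _ _ _)
     (trans (cong (_+ H q (∂ O y) i)
               (trans (sym (trans (ext (∂-linear lo) (sub (H-linear (suc q)) y (H q (∂ O y))) i)
                                  (sub (∂-linear lo) _ _ i)))
               (trans (ext (∘-linear (∂-linear lo) (H-linear (suc q))) (λ k → sym (∂v k)) i)
               (trans (∂H∂ (suc q) v sv hv i) (∂v i)))))
            (subtract-add _ _)))
      where
      u : Chain I
      u = y ⊖ H q (∂ O y)
      filling = ex (suc q) d<q u
        (λ k e → add-zero (sy k e) (neg-zero (H-supp q (∂ O y) k e)))
        (λ k e → add-zero (hy k e) (neg-zero (H-hom q (∂ O y) k e)))
        (λ k → trans (sub (∂-linear lo) y _ k)
                     (trans (cong (λ a → ∂ O y k + - a) (∂H∂ q y sy hy k)) (-‿inverseʳ _)))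
      v = proj₁ filling
      sv = proj₁ (proj₂ filling)
      hv = proj₁ (proj₂ (proj₂ filling))
      ∂v = proj₂ (proj₂ (proj₂ filling))

    κ-at : ℕ → Chain I → Chain I
    -- `κ` raises degrees, so nothing can arrive in degree 0.
    κ-at zero    x = 𝟘
    κ-at (suc q) x = K q (P q x)

    κ-at-linear : ∀ q → Linear (κ-at q)
    κ-at-linear zero = record
      { ext = λ _ _ → refl ; add = λ _ _ _ → sym (+-identityˡ 0ℚ) ; scale = λ q _ _ → sym (zeroʳ q) }
    κ-at-linear (suc q) = ∘-linear (K-linear q) (P-linear q)

    κ-total : Chain I → Chain I
    κ-total x i = κ-at (deg O i) x i

    κ-total-linear : Linear κ-total
    κ-total-linear = record
      { ext = λ e i → ext (κ-at-linear (deg O i)) e i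
      ; add = λ x y i → add (κ-at-linear (deg O i)) x y i
      ; scale = λ q x i → scale (κ-at-linear (deg O i)) q x i }

    κ-at-supp : ∀ q x → Supp G (κ-at q x)
    κ-at-supp zero    x i e = refl
    κ-at-supp (suc q) x i e = K-supp q _ i e

    P-weight : ∀ q (w : ℕ → ℚ) x → P q (λ i → w (suc (deg O i)) * x i) ≗ w (suc q) ⊙ P q x
    P-weight q w x i with deg O i ≡ᵇ q in eq
    ... | false = trans (zeroˡ _) (sym (trans (cong (w (suc q) *_) (zeroˡ _)) (zeroʳ _)))
    ... | true rewrite ≡ᵇ-sound (deg O i) q eq =
      trans (cong (1ℚ *_) (scale-swap (inG i) (w (suc q)) (x i))) (scale-swap 1ℚ (w (suc q)) _)

    κ-at-weight : ∀ q (w : ℕ → ℚ) x → κ-at q (λ i → w (suc (deg O i)) * x i) ≗ w q ⊙ κ-at q x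
    κ-at-weight zero    w x i = sym (zeroʳ _)
    κ-at-weight (suc q) w x i =
      trans (ext (K-linear q) (P-weight q w x) i) (scale (K-linear q) (w (suc q)) _ i)

    κ-component : ∀ q x → component (suc q) (κ-total x) ≗ K q (P q x)
    κ-component q x i = by-degree (deg O i ≡ᵇ suc q) refl
      where
      by-degree : ∀ b → (deg O i ≡ᵇ suc q) ≡ b →
                  (if b then 1ℚ else 0ℚ) * κ-total x i ≡ K q (P q x) i
      by-degree false eq = trans (zeroˡ _) (sym (K-hom q (P q x) i eq))
      by-degree true  eq = trans (*-identityˡ _) (cong (λ n → κ-at n x i) (≡ᵇ-sound (deg O i) (suc q) eq))

    P-∂ : ∀ q x → Supp G x → P q (∂ O x) ≗ ∂ O (P (suc q) x)
    P-∂ q x sx i =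
      trans (cong (indicator (_≡ᵇ q) (deg O i) *_)
              (trans (inG-id (∂-supp x sx) i) (ext (∂-linear lo) (λ k → sym (inG-id sx k)) i)))
            (sym (∂-weight lo (indicator (_≡ᵇ suc q)) _ i))

    κ-homotopy : ∀ x → Supp G x → ∀ i q → deg O i ≡ suc q → d ℕ.< suc q →
                 ∂ O (κ-total x) i + κ-total (∂ O x) i ≡ x i
    κ-homotopy x sx i q eq d<q =
      trans (cong₂ _+_
              (trans (sym (trans (cong (λ b → (if b then 1ℚ else 0ℚ) * ∂ O (κ-total x) i) at-q) (*-identityˡ _)))
              (trans (sym (∂-weight lo (indicator (_≡ᵇ suc (suc q))) (κ-total x) i))
                     (ext (∂-linear lo) (κ-component (suc q) x) i)))
              (trans (cong (λ n → κ-at n (∂ O x) i) eq) (ext (K-linear q) (P-∂ q x sx) i)))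
     (trans (K-homotopy q (P (suc q) x) d<q (P-supp (suc q) x) (P-hom (suc q) x) i)
     (trans (cong₂ (λ b a → (if b then 1ℚ else 0ℚ) * a) at-q (inG-id sx i)) (*-identityˡ _)))
      where
      at-q : (deg O i ≡ᵇ suc q) ≡ true
      at-q = trans (cong (_≡ᵇ suc q) eq) (≡ᵇ-refl q)

  contraction : Contraction O G d
  contraction = record
    { κ = κ-total ; κ-linear = κ-total-linear
    ; κ-weight = λ w c i → κ-at-weight (deg O i) w c i
    ; κ-supp = λ {c} _ i e → κ-at-supp (deg O i) c i e
    ; homotopy = λ x sx i d<i → helper x sx i (deg O i) refl d<i
    }
    where
    helper : ∀ x → Supp G x → ∀ i n → deg O i ≡ n → d ℕ.< n → ∂ O (κ-total x) i + κ-total (∂ O x) i ≡ x i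
    helper x sx i (suc q) eq d<n = κ-homotopy x sx i q eq d<n

-- Fibrewise products of cubes

sgn : ℕ → ℚ
sgn zero    = 1ℚ
sgn (suc n) = - sgn n

opaque
  unfolding _+_ _*_ -_

  neg-*-neg : ∀ a b → - a * - b ≡ a * b
  neg-*-neg = solve-∀ ℚ-ring

  neg-*ˡ : ∀ a b → - a * b ≡ - (a * b)
  neg-*ˡ = solve-∀ ℚ-ring

  remainder : ∀ c b → c ≡ b + (c + - b)
  remainder = solve-∀ ℚ-ring

  cancel-boundary : ∀ u v → (u + v) + - v ≡ u
  cancel-boundary = solve-∀ ℚ-ring

sgn-square : ∀ n → sgn n * sgn n ≡ 1ℚ
sgn-square zero    = *-identityˡ 1ℚ
sgn-square (suc n) = trans (neg-*-neg (sgn n) (sgn n)) (sgn-square n)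

left : ∀ {I J K} → (Chain I → Chain K) → Chain (I × J) → Chain (K × J)
left f c (k , j) = f (λ i → c (i , j)) k

right : ∀ {I J K} → (Chain J → Chain K) → Chain (I × J) → Chain (I × K)
right g c (i , k) = g (λ j → c (i , j)) k

left-linear : ∀ {I J K} {f : Chain I → Chain K} → Linear f → Linear (left {J = J} f)
left-linear lf = record
  { ext = λ { e (k , j) → ext lf (λ i → e (i , j)) k }
  ; add = λ { x y (k , j) → add lf _ _ k } ; scale = λ { q x (k , j) → scale lf q _ k } }

right-linear : ∀ {I J K} {g : Chain J → Chain K} → Linear g → Linear (right {I = I} g)
right-linear lg = record
  { ext = λ { e (i , k) → ext lg (λ j → e (i , j)) k }
  ; add = λ { x y (i , k) → add lg _ _ k } ; scale = λ { q x (i , k) → scale lg q _ k } }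

left-right : ∀ {I J K L} → Finite I → {f : Chain I → Chain K} {g : Chain J → Chain L} →
             Linear f → Linear g → ∀ c → left f (right g c) ≗ right g (left f c)
left-right fin lf lg c (k , l) = linear-comm fin lf lg (λ i j → c (i , j)) k l

prodDeg : ∀ {I J : Set} → (I → ℕ) → (J → ℕ) → I × J → ℕ
prodDeg d e (i , j) = d i ℕ.+ e j

signed : ∀ {I J : Set} → (I → ℕ) → Chain (I × J) → Chain (I × J)
signed d c (i , j) = sgn (d i) * c (i , j)

prodDiff : ∀ {I J} → (I → ℕ) → (Chain I → Chain I) → (Chain J → Chain J) →
           Chain (I × J) → Chain (I × J)
prodDiff d ∂₁ ∂₂ c = left ∂₁ c ⊕ signed d (right ∂₂ c)

infixr 7 _⊗_ _⊗ᴳ_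

-- The external product would carry a separate copy of the colours for each factor. Here `ρ j`
-- forgets j in both factors, and `_⊗ᴳ_` puts the same colour set on both: this is its diagonal, the
-- fibrewise product.
_⊗_ : ∀ {I J N} → Ops I N → Ops J N → Ops (I × J) N
O ⊗ P = record
  { deg = prodDeg (deg O) (deg P)
  ; ∂   = prodDiff (deg O) (∂ O) (∂ P)
  ; ρ   = λ j → left (ρ O j) ∘ right (ρ P j)
  }

both : ∀ {I J : Set} → (I → Bool) → (J → Bool) → I × J → Bool
both G H (i , j) = G i ∧ H j

_⊗ᴳ_ : ∀ {I J N} → Colouring N I → Colouring N J → Colouring N (I × J)
(G ⊗ᴳ H) τ = both (G τ) (H τ)

signed-linear : ∀ {I J : Set} (d : I → ℕ) → Linear (signed {I} {J} d)
signed-linear d = mask-linear (λ (i , _) → sgn (d i))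

⊕-linear : ∀ {I J} {f g : Chain I → Chain J} → Linear f → Linear g → Linear (λ x → f x ⊕ g x)
⊕-linear lf lg = record
  { ext   = λ e j → cong₂ _+_ (ext lf e j) (ext lg e j)
  ; add   = λ x y j → trans (cong₂ _+_ (add lf x y j) (add lg x y j)) (+-interchange _ _ _ _)
  ; scale = λ q x j → trans (cong₂ _+_ (scale lf q x j) (scale lg q x j)) (sym (distribˡ q _ _))
  }

module _ {I J : Set} {N} (fin : Finite I) {O : Ops I N} {P : Ops J N}
         (lo : Lawful O) (lp : Lawful P) where

  ⊗-∂-linear : Linear (∂ (O ⊗ P))
  ⊗-∂-linear = ⊕-linear (left-linear (∂-linear lo))
    (∘-linear (signed-linear (deg O)) (right-linear (∂-linear lp)))

  left-compatible : ∀ {f} → Compatible O f → Compatible (O ⊗ P) (left f)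
  left-compatible {f} cf = record
    { linear = left-linear (linear cf)
    ; weight = λ { w c (i , j) → weight cf (λ d → w (d ℕ.+ deg P j)) _ i }
    ; comm-∂ = λ { c (i , j) →
        trans (add (linear cf) _ _ i)
              (cong₂ _+_ (comm-∂ cf _ i)
                (trans (weight cf sgn _ i)
                       (cong (sgn (deg O i) *_) (left-right fin (linear cf) (∂-linear lp) c (i , j))))) }
    ; comm-ρ = λ { k c (i , j) →
        trans (comm-ρ cf k _ i)
              (ext (linear (ρ-compat lo k))
                (λ i′ → left-right fin (linear cf) (linear (ρ-compat lp k)) c (i′ , j)) i) }
    }

  right-compatible : ∀ {g} → Compatible P g → Compatible (O ⊗ P) (right g)
  right-compatible {g} cg = record
    { linear = right-linear (linear cg)
    ; weight = λ { w c (i , j) → weight cg (λ d → w (deg O i ℕ.+ d)) _ j }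
    ; comm-∂ = λ { c (i , j) →
        trans (add (linear cg) _ _ j)
              (cong₂ _+_ (sym (left-right fin (∂-linear lo) (linear cg) c (i , j)))
                (trans (scale (linear cg) (sgn (deg O i)) _ j)
                       (cong (sgn (deg O i) *_) (comm-∂ cg _ j)))) }
    ; comm-ρ = λ { k c (i , j) →
        trans (sym (left-right fin (linear (ρ-compat lo k)) (linear cg) (right (ρ P k) c) (i , j)))
              (ext (linear (ρ-compat lo k)) (λ i′ → comm-ρ cg k _ j) i) }
    }

  ∘-compatible : ∀ {K} {Q : Ops K N} {f g} → Compatible Q f → Compatible Q g → Compatible Q (f ∘ g)
  ∘-compatible {f = f} {g} cf cg = record
    { linear = ∘-linear (linear cf) (linear cg)
    ; weight = λ w c i → trans (ext (linear cf) (weight cg w c) i) (weight cf w (g c) i)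
    ; comm-∂ = λ c i → trans (ext (linear cf) (comm-∂ cg c) i) (comm-∂ cf (g c) i)
    ; comm-ρ = λ j c i → trans (ext (linear cf) (comm-ρ cg j c) i) (comm-ρ cf j (g c) i)
    }

  ⊗-lawful : Lawful (O ⊗ P)
  ⊗-lawful = record
    { ∂-linear = ⊗-∂-linear
    ; ∂-weight = λ { w c (i , j) →
        trans (cong₂ _+_
                (∂-weight lo (λ d → w (d ℕ.+ deg P j)) _ i)
                (trans (cong (sgn (deg O i) *_)
                         (trans (∂-weight lp (λ d → w (deg O i ℕ.+ d)) _ j)
                                (cong (λ n → w n * ∂ P (λ j′ → c (i , j′)) j) (ℕ.+-suc (deg O i) (deg P j)))))
                       (scale-swap _ _ _)))
              (sym (distribˡ _ _ _)) }
    ; ∂∂ = λ { c (i , j) →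
        trans (cong₂ _+_
                (trans (add (∂-linear lo) _ _ i)
                       (cong₂ _+_ (∂∂ lo _ i) refl))
                (cong (sgn (deg O i) *_)
                  (trans (add (∂-linear lp) _ _ j)
                         (cong₂ _+_ refl (trans (scale (∂-linear lp) _ _ j)
                                                (cong (sgn (deg O i) *_) (∂∂ lp _ j)))))))
              (cross c i j) }
    ; ρ-compat = λ k → ∘-compatible (left-compatible (ρ-compat lo k)) (right-compatible (ρ-compat lp k))
    }
    where
    sgn-∂ : ∀ x → ∂ O (λ i → sgn (deg O i) * x i) ≗ λ i → - (sgn (deg O i) * ∂ O x i)
    sgn-∂ x i = trans (∂-weight lo sgn x i) (neg-*ˡ _ _)
    cross : ∀ c i j →
      (0ℚ + ∂ O (λ i′ → sgn (deg O i′) * right (∂ P) c (i′ , j)) i) +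
      sgn (deg O i) * (right (∂ P) (left (∂ O) c) (i , j) + sgn (deg O i) * 0ℚ) ≡ 0ℚ
    cross c i j =
      trans (cong₂ (λ a b → (0ℚ + a) + sgn (deg O i) * (b + sgn (deg O i) * 0ℚ))
              (sgn-∂ _ i) (sym (left-right fin (∂-linear lo) (∂-linear lp) c (i , j))))
            (vanish (sgn (deg O i)) _)
      where
      vanish : ∀ s u → (0ℚ + - (s * u)) + s * (u + s * 0ℚ) ≡ 0ℚ
      vanish s u = trans (cong₂ (λ a b → (0ℚ + - (s * u)) + s * (u + b)) (refl {x = s}) (zeroʳ s))
                  (trans (cong₂ (λ a b → a + s * b) (+-identityˡ _) (+-identityʳ u)) (-‿inverseˡ _))

record Respectful {I N} (O : Ops I N) (G : Colouring N I) : Set where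
  field
    ∂-supp : ∀ τ c → Supp (G τ) c → Supp (G τ) (∂ O c)
    ρ-supp : ∀ j τ c → Supp (G τ) c → Supp (G (τ [ j ]≔ false)) (ρ O j c)

open Respectful

tail-respectful : ∀ {I N} {O : Ops I (suc N)} {G} b → Respectful O G →
                  Respectful (tailOps O) (G ∘ (b ∷_))
tail-respectful b r = record
  { ∂-supp = λ τ → ∂-supp r (b ∷ τ) ; ρ-supp = λ j τ → ρ-supp r (suc j) (b ∷ τ) }

cone-respectful : ∀ {I N} {O : Ops I (suc N)} {G} → Respectful O G →
  Respectful (cone (ρ O zero) (tailOps O)) (coneG (G ∘ (false ∷_)) (G ∘ (true ∷_)))
cone-respectful r = record
  { ∂-supp = λ { τ c s (false , i) e →
                   add-zero (∂-supp r (false ∷ τ) _ (λ k → s (false , k)) i e)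
                            (ρ-supp r zero (true ∷ τ) _ (λ k → s (true , k)) i e)
               ; τ c s (true , i) e → neg-zero (∂-supp r (true ∷ τ) _ (λ k → s (true , k)) i e) }
  ; ρ-supp = λ { j τ c s (false , i) → ρ-supp r (suc j) (false ∷ τ) _ (λ k → s (false , k)) i
               ; j τ c s (true , i) → ρ-supp r (suc j) (true ∷ τ) _ (λ k → s (true , k)) i }
  }

left-supp : ∀ {I J K : Set} {f : Chain I → Chain K} {G : I → Bool} {G′} (H : J → Bool) → Linear f →
            (∀ c → Supp G c → Supp G′ (f c)) → ∀ c → Supp (both G H) c → Supp (both G′ H) (left f c)
left-supp {G = G} {G′} H lf m c s (k , j) e with H j in eq
... | false = null lf (λ i → s (i , j) (trans (cong (G i ∧_) eq) (Bool.∧-zeroʳ (G i)))) k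
... | true  = m _ (λ i Gi → s (i , j) (cong (_∧ H j) Gi)) k (trans (sym (Bool.∧-identityʳ (G′ k))) e)

right-supp : ∀ {I J K : Set} {g : Chain J → Chain K} (G : I → Bool) {H : J → Bool} {H′} → Linear g →
             (∀ c → Supp H c → Supp H′ (g c)) → ∀ c → Supp (both G H) c → Supp (both G H′) (right g c)
right-supp G lg m c s (i , k) e with G i in eq
... | false = null lg (λ j → s (i , j) (cong (_∧ _) eq)) k
... | true  = m _ (λ j Hj → s (i , j) (trans (cong (_∧ _) eq) Hj)) k e

-- Künneth

module _ {I J : Set} {O : Ops I 0} {P : Ops J 0} {G : I → Bool} {H : J → Bool} {d₁ d₂ : ℕ}
         (fin : Finite I) (lo : Lawful O) (lp : Lawful P)
         (O-supp : ∀ c → Supp G c → Supp G (∂ O c)) (P-supp : ∀ c → Supp H c → Supp H (∂ P c))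
         (con : Contraction O G d₁) (exP : ∀ q → d₂ ℕ.< q → Exact P H q) where

  open Contraction con

  private
    D : Chain (I × J) → Chain (I × J)
    D = ∂ (O ⊗ P)
    lD : Lawful (O ⊗ P)
    lD = ⊗-lawful fin lo lp

    D-supp : ∀ c → Supp (both G H) c → Supp (both G H) (D c)
    D-supp c s (i , j) e =
      add-zero (left-supp {G = G} H (∂-linear lo) O-supp c s (i , j) e)
               (trans (cong (sgn (deg O i) *_) (right-supp G {H} (∂-linear lp) P-supp c s (i , j) e)) (zeroʳ _))

    Filled : ℕ → Chain (I × J) → Set
    Filled q c = ∃ λ b → Supp (both G H) b × Hom (deg (O ⊗ P)) (_≡ᵇ suc q) b × D b ≗ c

    Low : ℕ → Chain (I × J) → Set
    Low t c = ∀ j → Hom (deg O) (_<ᵇ t) (λ i → c (i , j))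

    filled-remainder : ∀ {q} {b c} → Supp (both G H) b → Hom (deg (O ⊗ P)) (_≡ᵇ suc q) b →
                       Filled q (c ⊖ D b) → Filled q c
    filled-remainder {b = b} {c} sb hb (b′ , sb′ , hb′ , Db′) =
      b ⊕ b′ , (λ i e → add-zero (sb i e) (sb′ i e)) , (λ i e → add-zero (hb i e) (hb′ i e)) ,
      λ i → trans (add (∂-linear lD) b b′ i) (trans (cong (D b i +_) (Db′ i)) (sym (remainder (c i) (D b i))))

    +-≡ᵇ : ∀ t m n → (t ℕ.+ m ≡ᵇ t ℕ.+ n) ≡ (m ≡ᵇ n)
    +-≡ᵇ zero    m n = refl
    +-≡ᵇ (suc t) m n = +-≡ᵇ t m n

    <ᵇ-irrefl : ∀ n → (n <ᵇ n) ≡ false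
    <ᵇ-irrefl zero    = refl
    <ᵇ-irrefl (suc n) = <ᵇ-irrefl n

    above : ∀ m n → (m <ᵇ n) ≡ false → m ≢ n → (m <ᵇ suc n) ≡ false
    above zero    zero    _ m≢n = ⊥-elim (m≢n refl)
    above (suc m) zero    _ _   = refl
    above (suc m) (suc n) e m≢n = above m n e (m≢n ∘ cong suc)

    unsign : ∀ n {a} → sgn n * a ≡ 0ℚ → a ≡ 0ℚ
    unsign n {a} e =
      trans (sym (trans (cong (_* a) (sgn-square n)) (*-identityˡ a)))
     (trans (*-assoc (sgn n) (sgn n) a) (trans (cong (sgn n *_) e) (zeroʳ _)))

    -- Low t c bounds the O-degrees in c by t; they are removed from the top, by exactness of P.
    fill : ∀ q t → d₁ ℕ.+ d₂ ℕ.< q → t ℕ.≤ suc d₁ → ∀ c → Supp (both G H) c →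
           Hom (deg (O ⊗ P)) (_≡ᵇ q) c → D c ≗ 𝟘 → Low t c → Filled q c
    fill q zero    d<q t≤ c s h cyc low =
      𝟘 , (λ _ _ → refl) , (λ _ _ → refl) ,
      λ { (i , j) → trans (null (∂-linear lD) (λ _ → refl) (i , j)) (sym (low j i refl)) }
    fill q (suc t) d<q t≤ c s h cyc low =
      filled-remainder {b = b} {c} b-supp b-hom
        (fill q t d<q (ℕ.<⇒≤ t≤) (c ⊖ D b)
          (λ i e → add-zero (s i e) (neg-zero (D-supp b b-supp i e)))
          (λ i e → add-zero (h i e) (neg-zero (∂-hom lD (_≡ᵇ suc q) b-hom i e)))
          (λ i → trans (sub (∂-linear lD) c (D b) i)
                       (add-zero (cyc i) (neg-zero (∂∂ lD b i))))
          remainder-low)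
      where
      -- Over cells of `O` of degree t ≤ d₁ the degree left for `P` is q - t, which exceeds d₂.
      q′ = q ℕ.∸ t
      t+q′ : t ℕ.+ q′ ≡ q
      t+q′ = ℕ.m+[n∸m]≡n (ℕ.<⇒≤ (ℕ.≤-<-trans (ℕ.≤-trans (ℕ.≤-pred t≤) (ℕ.m≤m+n d₁ d₂)) d<q))
      d₂<q′ : d₂ ℕ.< q′
      d₂<q′ = ℕ.+-cancelˡ-< t d₂ q′ (subst (t ℕ.+ d₂ ℕ.<_) (sym t+q′)
                (ℕ.≤-<-trans (ℕ.+-monoˡ-≤ d₂ (ℕ.≤-pred t≤)) d<q))
      O-low : ∀ {c} → Low (suc t) c → ∀ i j → (deg O i <ᵇ t) ≡ false → left (∂ O) c (i , j) ≡ 0ℚ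
      O-low low i j e = ∂-hom lo (_<ᵇ suc t) (low j) i e

      Choice : I → Set
      Choice i = ∃ λ b → Supp H b × Hom (deg P) (_≡ᵇ suc q′) b ×
        (deg O i ≡ t → G i ≡ true → ∂ P b ≗ λ j → c (i , j)) ×
        (deg O i ≢ t ⊎ G i ≡ false → b ≗ 𝟘)
      choose : ∀ i → Choice i
      choose i with deg O i ℕ.≟ t | G i in eq
      ... | no i≢t | _ = 𝟘 , (λ _ _ → refl) , (λ _ _ → refl) , (λ i≡t → ⊥-elim (i≢t i≡t)) , λ _ _ → refl
      ... | yes i≡t | false = 𝟘 , (λ _ _ → refl) , (λ _ _ → refl) , (λ _ ()) , λ _ _ → refl
      ... | yes i≡t | true
        with b , sb , hb , ∂b ← exP q′ d₂<q′ (λ j → c (i , j))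
               (λ j e → s (i , j) (trans (cong (_∧ H j) eq) e))
               (λ j e → h (i , j) (trans (cong₂ (λ m n → m ℕ.+ deg P j ≡ᵇ n) i≡t (sym t+q′)) (trans (+-≡ᵇ t _ _) e)))
               -- Nothing lies above `O`-degree t, so `∂ O` contributes nothing to `D c` in this
               -- degree, and `D c` being zero makes each column a cycle of `P`.
               (λ j → unsign (deg O i) (trans (sym (+-identityˡ _))
                 (trans (cong (_+ _) (sym (O-low low i j (trans (cong (_<ᵇ t) i≡t) (<ᵇ-irrefl t))))) (cyc (i , j)))))
        = b , sb , hb , (λ _ _ → ∂b) , λ { (inj₁ i≢t) → ⊥-elim (i≢t i≡t) ; (inj₂ ()) }

      β : I → Chain J
      β i = proj₁ (choose i)
      β-supp = λ i → proj₁ (proj₂ (choose i))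
      β-hom = λ i → proj₁ (proj₂ (proj₂ (choose i)))
      ∂β = λ i → proj₁ (proj₂ (proj₂ (proj₂ (choose i))))
      β-zero = λ i → proj₂ (proj₂ (proj₂ (proj₂ (choose i))))
      b : Chain (I × J)
      b (i , j) = sgn (deg O i) * β i j
      times-zero : ∀ {a z} → z ≡ 0ℚ → a * z ≡ 0ℚ
      times-zero {a} e = trans (cong (a *_) e) (zeroʳ a)
      b-supp : Supp (both G H) b
      b-supp (i , j) e = times-zero (case-G (G i) refl)
        where
        case-G : ∀ g → G i ≡ g → β i j ≡ 0ℚ
        case-G false eq = β-zero i (inj₂ eq) j
        case-G true  eq = β-supp i j (trans (sym (cong (_∧ H j) eq)) e)
      b-hom : Hom (deg (O ⊗ P)) (_≡ᵇ suc q) b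
      b-hom (i , j) e = times-zero (by-height (deg O i ℕ.≟ t))
        where
        by-degree : deg O i ≡ t → ∀ p → (deg P j ≡ᵇ suc q′) ≡ p → β i j ≡ 0ℚ
        by-degree i≡t false eq = β-hom i j eq
        by-degree i≡t true  eq = true≢false (≡ᵇ-refl (suc q)) (trans (cong (_≡ᵇ suc q) (sym total)) e)
          where
          total : deg O i ℕ.+ deg P j ≡ suc q
          total = trans (cong₂ ℕ._+_ i≡t (≡ᵇ-sound (deg P j) (suc q′) eq))
                        (trans (ℕ.+-suc t q′) (cong suc t+q′))
        by-height : Dec (deg O i ≡ t) → β i j ≡ 0ℚ
        by-height (no i≢t)  = β-zero i (inj₁ i≢t) j
        by-height (yes i≡t) = by-degree i≡t (deg P j ≡ᵇ suc q′) refl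
      b-low : Low (suc t) b
      b-low j i e = times-zero (β-zero i (inj₁ λ i≡t →
        true≢false (≤t (deg O i) (ℕ.≤-reflexive i≡t)) e) j)
        where
        ≤t : ∀ m {t} → m ℕ.≤ t → (m <ᵇ suc t) ≡ true
        ≤t zero    _           = refl
        ≤t (suc m) (ℕ.s≤s m≤t) = ≤t m m≤t
      Db : ∀ i j → (deg O i <ᵇ t) ≡ false → D b (i , j) ≡ ∂ P (β i) j
      Db i j e =
        trans (cong₂ _+_ (O-low b-low i j e)
                (trans (cong (sgn (deg O i) *_) (scale (∂-linear lp) (sgn (deg O i)) (β i) j))
                (trans (sym (*-assoc (sgn (deg O i)) _ _))
                (trans (cong (_* ∂ P (β i) j) (sgn-square (deg O i))) (*-identityˡ _)))))
              (+-identityˡ _)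
      remainder-low : Low t (c ⊖ D b)
      remainder-low j i e = by-height (deg O i ℕ.≟ t)
        where
        by-support : deg O i ≡ t → ∀ g → G i ≡ g → ∂ P (β i) j ≡ c (i , j)
        by-support i≡t false eq = trans (null (∂-linear lp) (β-zero i (inj₂ eq)) j)
                                    (sym (s (i , j) (cong (_∧ H j) eq)))
        by-support i≡t true  eq = ∂β i i≡t eq j
        by-height : Dec (deg O i ≡ t) → c (i , j) + - D b (i , j) ≡ 0ℚ
        by-height (no i≢t) = add-zero (low j i (above (deg O i) t e i≢t))
          (neg-zero (trans (Db i j e) (null (∂-linear lp) (β-zero i (inj₁ i≢t)) j)))
        by-height (yes i≡t) =
          trans (cong (λ a → c (i , j) + - a) (trans (Db i j e) (by-support i≡t (G i) refl))) (-‿inverseʳ _)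

  -- Subtracting the boundary of `κ`, applied in the first factor, clears all `O`-degrees above d₁.
  -- In the rest the `P`-degree exceeds d₂, so `fill` removes it by exactness of `P`.
  künneth : ∀ q → d₁ ℕ.+ d₂ ℕ.< q → Exact (O ⊗ P) (both G H) q
  künneth q d<q c s h cyc =
    filled-remainder {b = b} {c} b-supp b-hom
      (fill q (suc d₁) d<q ℕ.≤-refl (c ⊖ D b)
        (λ i e → add-zero (s i e) (neg-zero (D-supp b b-supp i e)))
        (λ i e → add-zero (h i e) (neg-zero (∂-hom lD (_≡ᵇ suc q) b-hom i e)))
        (λ i → trans (sub (∂-linear lD) c (D b) i) (add-zero (cyc i) (neg-zero (∂∂ lD b i))))
        low)
    where
    b : Chain (I × J)
    b = left κ c
    b-supp : Supp (both G H) b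
    b-supp = left-supp {G = G} H κ-linear (λ _ → κ-supp) c s
    b-hom : Hom (deg (O ⊗ P)) (_≡ᵇ suc q) b
    b-hom (i , j) e =
      trans (ext κ-linear (λ i′ → hom-indicator {d = deg (O ⊗ P)} {_≡ᵇ q} h (i′ , j)) i)
     (trans (κ-weight (λ d → indicator (_≡ᵇ suc q) (d ℕ.+ deg P j)) _ i)
            (indicator-hom {_≡ᵇ suc q} (deg O i ℕ.+ deg P j) e))
    -- D c = 0 turns the cross term into κ ∂, completing the homotopy ∂ κ + κ ∂.
    cross : ∀ i j → sgn (deg O i) * right (∂ P) b (i , j) ≡ κ (λ i′ → left (∂ O) c (i′ , j)) i
    cross i j =
      trans (cong (sgn (deg O i) *_) (sym (left-right fin κ-linear (∂-linear lp) c (i , j))))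
     (trans (sym (trans (cong -_ (neg-*ˡ _ _)) (neg-neg _)))
     (trans (cong -_ (sym (κ-weight (λ d → - sgn d) _ i)))
     (trans (sym (neg κ-linear _ i))
            (ext κ-linear (λ i′ → opposite (cyc (i′ , j))) i))))
      where
      opposite : ∀ {a b s} → a + s * b ≡ 0ℚ → - (- (- s) * b) ≡ a
      opposite {a} {b} {s} e =
        trans (cong (λ z → - (z * b)) (neg-neg s))
       (trans (sym (+-identityˡ _)) (trans (cong (_+ - (s * b)) (sym e)) (cancel-boundary a (s * b))))
    low : Low (suc d₁) (c ⊖ D b)
    low j i e =
      trans (cong (λ a → c (i , j) + - a)
              (trans (cong (left (∂ O) b (i , j) +_) (cross i j))
                     (homotopy (λ i′ → c (i′ , j)) column-supp i (<ᵇ-false (deg O i) d₁ e))))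
            (-‿inverseʳ _)
      where
      <ᵇ-false : ∀ m n → (m <ᵇ suc n) ≡ false → n ℕ.< m
      <ᵇ-false (suc m) zero    _ = ℕ.s≤s ℕ.z≤n
      <ᵇ-false (suc m) (suc n) e = ℕ.s≤s (<ᵇ-false m n e)
      column-supp : Supp G (λ i′ → c (i′ , j))
      column-supp i′ e′ = s (i′ , j) (cong (_∧ H j) e′)

-- Cones of products, and the Leray property of fibrewise products

iso-transfer : ∀ {N} {I J : Set} {O : Ops I N} {G} {O′ : Ops J N} {G′}
  (φ : Chain I → Chain J) (ψ : Chain J → Chain I) → Linear φ → Linear ψ →
  (∀ c → ψ (φ c) ≗ c) → (∀ c → φ (ψ c) ≗ c) → Linear (∂ O′) → (∀ j → Linear (ρ O′ j)) →
  (∀ c → φ (∂ O c) ≗ ∂ O′ (φ c)) → (∀ j c → φ (ρ O j c) ≗ ρ O′ j (φ c)) →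
  (∀ τ c → Supp (G τ) c → Supp (G′ τ) (φ c)) → (∀ τ c → Supp (G′ τ) c → Supp (G τ) (ψ c)) →
  (∀ p c → Hom (deg O) p c → Hom (deg O′) p (φ c)) →
  (∀ p c → Hom (deg O′) p c → Hom (deg O) p (ψ c)) → Transfer O G O′ G′
iso-transfer {O = O} {O′ = O′} φ ψ lφ lψ ψφ φψ l∂ lρ φ∂ φρ φ-supp ψ-supp φ-hom ψ-hom = record
  { φ = φ ; ψ = ψ ; φ-linear = lφ ; ψ-linear = lψ
  ; φ-∂ = λ _ c _ → φ∂ c
  ; ψ-∂ = λ _ c _ i → trans (ext lψ (λ j → trans (ext l∂ (λ k → sym (φψ c k)) j) (sym (φ∂ (ψ c) j))) i)
                            (ψφ (∂ O (ψ c)) i)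
  ; φ-ρ = φρ
  ; ψ-ρ = λ k c i → trans (ext lψ (λ j → trans (ext (lρ k) (λ m → sym (φψ c m)) j) (sym (φρ k (ψ c) j))) i)
                          (ψφ (ρ O k (ψ c)) i)
  ; φ-supp = φ-supp ; ψ-supp = ψ-supp ; φ-hom = φ-hom ; ψ-hom = ψ-hom
  ; φψ = λ _ c _ → φψ c
  }

module _ {I J : Set} {N} (fin : Finite I) {O : Ops I N} {P : Ops J N}
         (lo : Lawful O) (lp : Lawful P) where

  private
    ρ-linear : ∀ j → Linear (ρ (O ⊗ P) j)
    ρ-linear j = linear (ρ-compat (⊗-lawful fin lo lp) j)

  module _ {f : Chain I → Chain I} {G₀ G₁ : Colouring N I} {H : Colouring N J}
           (cf : Compatible O f) where

    cone-⊗ : Transfer (cone f O ⊗ P) (coneG G₀ G₁ ⊗ᴳ H)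
                      (cone (left f) (O ⊗ P)) (coneG (G₀ ⊗ᴳ H) (G₁ ⊗ᴳ H))
    cone-⊗ = iso-transfer {G = coneG G₀ G₁ ⊗ᴳ H} {G′ = coneG (G₀ ⊗ᴳ H) (G₁ ⊗ᴳ H)}
      (_∘ λ (b , i , j) → (b , i) , j) (_∘ λ ((b , i) , j) → b , i , j)
      (reindex-linear _) (reindex-linear _) (λ _ _ → refl) (λ _ _ → refl)
      (∂-linear (cone-lawful (⊗-lawful fin lo lp) (left-compatible fin lo lp cf)))
      (λ j → diag-linear (ρ-linear j))
      (λ { c (false , i , j) → +-swap _ _ _
         ; c (true , i , j) → trans (cong (- ∂ O (λ i′ → c ((true , i′) , j)) i +_) (neg-*ˡ _ _)) (sym (neg-+ _ _)) })
      (λ _ _ _ → refl)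
      (λ { τ c s (false , i , j) → s _ ; τ c s (true , i , j) → s _ })
      (λ { τ c s ((false , i) , j) → s _ ; τ c s ((true , i) , j) → s _ })
      (λ { p c h (false , i , j) → h _ ; p c h (true , i , j) → h _ })
      (λ { p c h ((false , i) , j) → h _ ; p c h ((true , i) , j) → h _ })

  module _ {g : Chain J → Chain J} {G : Colouring N I} {H₀ H₁ : Colouring N J}
           (cg : Compatible P g) where

    private
      φ : Chain (I × (Bool × J)) → Chain (Bool × (I × J))
      φ c (false , i , j) = c (i , false , j)
      φ c (true  , i , j) = sgn (deg O i) * c (i , true , j)
      ψ : Chain (Bool × (I × J)) → Chain (I × (Bool × J))
      ψ c (i , false , j) = c (false , i , j)
      ψ c (i , true  , j) = sgn (deg O i) * c (true , i , j)

      unsign-twice : ∀ n a → sgn n * (sgn n * a) ≡ a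
      unsign-twice n a = trans (sym (*-assoc (sgn n) (sgn n) a))
                               (trans (cong (_* a) (sgn-square n)) (*-identityˡ a))

      times-zero : ∀ {a z} → z ≡ 0ℚ → a * z ≡ 0ℚ
      times-zero {a} e = trans (cong (a *_) e) (zeroʳ a)

      distribute-sign : ∀ s u v → s * (u + s * - v) ≡ - (- s * u + s * (s * v))
      distribute-sign s u v =
        trans (distribˡ s _ _)
        (trans (cong₂ _+_ (trans (sym (neg-neg _)) (cong -_ (sym (neg-*ˡ s u))))
                          (trans (cong (s *_) (sym (neg-*ʳ s v))) (sym (neg-*ʳ s (s * v)))))
               (sym (neg-+ _ _)))

    -- The cone direction has degree one and stands behind the factor `O`; moving it to the front
    -- costs the sign `sgn (deg O i)`.
    ⊗-cone : Transfer (O ⊗ cone g P) (G ⊗ᴳ coneG H₀ H₁)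
                      (cone (right g) (O ⊗ P)) (coneG (G ⊗ᴳ H₀) (G ⊗ᴳ H₁))
    ⊗-cone = iso-transfer {G = G ⊗ᴳ coneG H₀ H₁} {G′ = coneG (G ⊗ᴳ H₀) (G ⊗ᴳ H₁)} φ ψ
      (record { ext = λ { e (false , i , j) → e _ ; e (true , i , j) → cong (_ *_) (e _) }
              ; add = λ { x y (false , i , j) → refl ; x y (true , i , j) → distribˡ _ _ _ }
              ; scale = λ { q x (false , i , j) → refl ; q x (true , i , j) → scale-swap _ _ _ } })
      (record { ext = λ { e (i , false , j) → e _ ; e (i , true , j) → cong (_ *_) (e _) }
              ; add = λ { x y (i , false , j) → refl ; x y (i , true , j) → distribˡ _ _ _ }
              ; scale = λ { q x (i , false , j) → refl ; q x (i , true , j) → scale-swap _ _ _ } })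
      (λ { c (i , false , j) → refl ; c (i , true , j) → unsign-twice (deg O i) _ })
      (λ { c (false , i , j) → refl ; c (true , i , j) → unsign-twice (deg O i) _ })
      (∂-linear (cone-lawful (⊗-lawful fin lo lp) (right-compatible fin lo lp cg)))
      (λ j → diag-linear (ρ-linear j))
      (λ { c (false , i , j) →
             trans (cong (left (∂ O) (φ′ c) (i , j) +_)
                     (trans (distribˡ _ _ _) (cong (_ +_) (sym (scale (linear cg) (sgn (deg O i)) _ j)))))
                   (sym (+-assoc _ _ _))
         ; c (true , i , j) →
             trans (distribute-sign _ _ _)
                   (cong -_ (cong₂ _+_ (sym (∂-weight lo sgn _ i))
                                       (cong (sgn (deg O i) *_) (sym (scale (∂-linear lp) (sgn (deg O i)) _ j))))) })
      (λ { k c (false , i , j) → refl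
         ; k c (true , i , j) →
             trans (sym (weight (ρ-compat lo k) sgn _ i))
                   (ext (linear (ρ-compat lo k)) (λ i′ → sym (scale (linear (ρ-compat lp k)) (sgn (deg O i′)) _ j)) i) })
      (λ { τ c s (false , i , j) e → s _ e ; τ c s (true , i , j) e → times-zero (s _ e) })
      (λ { τ c s (i , false , j) e → s _ e ; τ c s (i , true , j) e → times-zero (s _ e) })
      (λ { p c h (false , i , j) e → h _ e
         ; p c h (true , i , j) e → times-zero (h _ (trans (cong p (ℕ.+-suc (deg O i) (deg P j))) e)) })
      (λ { p c h (i , false , j) e → h _ e
         ; p c h (i , true , j) e → times-zero (h _ (trans (cong p (sym (ℕ.+-suc (deg O i) (deg P j)))) e)) })
      where
      φ′ : Chain (I × (Bool × J)) → Chain (I × J)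
      φ′ c (i , j) = c (i , false , j)

-- The head colour is first given separate copies in the two factors. The cones over one copy, over
-- the other and over both are themselves products of cones, known by induction on the number of
-- colours; `collapse` then identifies the copies.
leray-⊗ : ∀ {d₁ d₂} N {I J} {O : Ops I N} {P : Ops J N} {G H} → Finite I →
          Lawful O → Lawful P → Respectful O G → Respectful P H →
          Leray d₁ N O G → Leray d₂ N P H → Leray (d₁ ℕ.+ d₂) N (O ⊗ P) (G ⊗ᴳ H)
leray-⊗ zero {O = O} {G = G} fin lo lp ro rp l₁ l₂ q d<q =
  künneth {G = G []} fin lo lp (∂-supp ro []) (∂-supp rp [])
    (contraction fin O (G []) _ lo (∂-supp ro []) l₁) l₂ q d<q
leray-⊗ (suc N) {O = O} {P} {G} {H} fin lo lp ro rp (l₁ , l₁′) (l₂ , l₂′) =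
  leray-⊗ N fin lo′ lp′ ro₀ rp₀ l₁ l₂ ,
  collapse N (O′ ⊗ P′) (left (ρ O zero)) (right (ρ P zero))
    (G₀ ⊗ᴳ H₀) (G₁ ⊗ᴳ H₀) (G₀ ⊗ᴳ H₁) (G₁ ⊗ᴳ H₁) (⊗-lawful fin lo′ lp′)
    (left-compatible fin lo′ lp′ co) (right-compatible fin lo′ lp′ cp)
    (left-right fin (linear co) (linear cp))
    (λ τ → left-supp {G = G₁ τ} {G₀ τ} (H₁ τ) (linear co) (ρ-supp ro zero (true ∷ τ)))
    (λ τ → left-supp {G = G₁ τ} {G₀ τ} (H₀ τ) (linear co) (ρ-supp ro zero (true ∷ τ)))
    (λ τ → right-supp (G₁ τ) {H₁ τ} {H₀ τ} (linear cp) (ρ-supp rp zero (true ∷ τ)))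
    (leray-transfer N (cone-⊗ fin lo′ lp′ {G₀ = G₀} {G₁} {H₀} co)
      (leray-⊗ N fin² lo² lp′ ro² rp₀ l₁′ l₂))
    (leray-transfer N (⊗-cone fin lo′ lp′ {G = G₀} {H₀} {H₁} cp)
      (leray-⊗ N fin lo′ lp² ro₀ rp² l₁ l₂′))
    (leray-transfer N
      (cone-transfer (cone-⊗ fin lo′ lp′ {G₀ = G₀} {G₁} {H₀} co) (cone-⊗ fin lo′ lp′ {G₀ = G₀} {G₁} {H₁} co)
        refl refl (λ _ _ → refl) (λ _ _ → refl))
      (leray-transfer N (⊗-cone fin² lo² lp′ {G = coneG G₀ G₁} {H₀} {H₁} cp)
        (leray-⊗ N fin² lo² lp² ro² rp² l₁′ l₂′)))
  where
  O′ = tailOps O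
  P′ = tailOps P
  G₀ = G ∘ (false ∷_)
  G₁ = G ∘ (true ∷_)
  H₀ = H ∘ (false ∷_)
  H₁ = H ∘ (true ∷_)
  fin² = finite-× fin
  lo′ = tail-lawful lo
  lp′ = tail-lawful lp
  co : Compatible O′ (ρ O zero)
  co = tail-compatible (ρ-compat lo zero)
  cp : Compatible P′ (ρ P zero)
  cp = tail-compatible (ρ-compat lp zero)
  lo² = cone-lawful lo′ co
  lp² = cone-lawful lp′ cp
  ro₀ : Respectful O′ G₀
  ro₀ = tail-respectful false ro
  rp₀ : Respectful P′ H₀
  rp₀ = tail-respectful false rp
  ro² : Respectful (cone (ρ O zero) O′) (coneG G₀ G₁)
  ro² = cone-respectful ro
  rp² : Respectful (cone (ρ P zero) P′) (coneG H₀ H₁)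
  rp² = cone-respectful rp

-- Total complexes

-- Defined by iterated cones, so that passing from `N` to `suc N` is the reindexing `peel`; the
-- usual formula for the differential is `Tot-∂`.
Tot : ∀ N {I} → Ops I N → Ops (Vec Bool N × I) 0
Tot N O = record { deg = λ (τ , i) → ∣ τ ∣ ℕ.+ deg O i ; ∂ = D N O ; ρ = λ () }
  where
  D : ∀ N {I} → Ops I N → Chain (Vec Bool N × I) → Chain (Vec Bool N × I)
  D zero    O c ([] , i) = ∂ O (λ i → c ([] , i)) i
  D (suc N) O c (b ∷ τ , i) =
    D N (cone (ρ O zero) (tailOps O)) (λ (τ , b , i) → c (b ∷ τ , i)) (τ , b , i)

spread : ∀ {N} {I : Set} → Colouring N I → Vec Bool N × I → Bool
spread G (τ , i) = G τ i

peel : ∀ {N} {I : Set} → Chain (Vec Bool (suc N) × I) → Chain (Vec Bool N × (Bool × I))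
peel c (τ , b , i) = c (b ∷ τ , i)

unpeel : ∀ {N} {I : Set} → Chain (Vec Bool N × (Bool × I)) → Chain (Vec Bool (suc N) × I)
unpeel c (b ∷ τ , i) = c (τ , b , i)

peel-linear : ∀ {N} {I : Set} → Linear (peel {N} {I})
peel-linear = reindex-linear _

unpeel-linear : ∀ {N} {I : Set} → Linear (unpeel {N} {I})
unpeel-linear = record
  { ext = λ { e (b ∷ τ , i) → e _ } ; add = λ { x y (b ∷ τ , i) → refl }
  ; scale = λ { q x (b ∷ τ , i) → refl } }

unpeel-peel : ∀ {N} {I : Set} (c : Chain (Vec Bool (suc N) × I)) → unpeel (peel c) ≗ c
unpeel-peel c (b ∷ τ , i) = refl

headCone : ∀ {I N} → Ops I (suc N) → Ops (Bool × I) N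
headCone O = cone (ρ O zero) (tailOps O)

headConeG : ∀ {I : Set} {N} → Colouring (suc N) I → Colouring N (Bool × I)
headConeG G = coneG (G ∘ (false ∷_)) (G ∘ (true ∷_))

headCone-lawful : ∀ {I N} {O : Ops I (suc N)} → Lawful O → Lawful (headCone O)
headCone-lawful lo = cone-lawful (tail-lawful lo) (tail-compatible (ρ-compat lo zero))

Tot-∂-linear : ∀ N {I} {O : Ops I N} → Lawful O → Linear (∂ (Tot N O))
Tot-∂-linear zero lo = record
  { ext = λ { e ([] , i) → ext (∂-linear lo) (λ _ → e _) i }
  ; add = λ { x y ([] , i) → add (∂-linear lo) _ _ i }
  ; scale = λ { q x ([] , i) → scale (∂-linear lo) q _ i } }
Tot-∂-linear (suc N) lo = record
  { ext = λ { e (b ∷ τ , i) → ext l (λ _ → e _) (τ , b , i) }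
  ; add = λ { x y (b ∷ τ , i) → add l (peel x) (peel y) (τ , b , i) }
  ; scale = λ { q x (b ∷ τ , i) → scale l q (peel x) (τ , b , i) } }
  where l = Tot-∂-linear N (headCone-lawful lo)

cone-degree : ∀ {N} {I : Set} (d : I → ℕ) (τ : Vec Bool N) b i →
              ∣ b ∷ τ ∣ ℕ.+ d i ≡ ∣ τ ∣ ℕ.+ coneDeg d (b , i)
cone-degree d τ false i = refl
cone-degree d τ true  i = sym (ℕ.+-suc ∣ τ ∣ (d i))

Tot-weight : ∀ N {I} {O : Ops I N} → Lawful O → ∀ (w : ℕ → ℚ) c →
  ∂ (Tot N O) (λ i → w (deg (Tot N O) i) * c i) ≗ λ i → w (suc (deg (Tot N O) i)) * ∂ (Tot N O) c i
Tot-weight zero lo w c ([] , i) = ∂-weight lo w _ i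
Tot-weight (suc N) {O = O} lo w c (b ∷ τ , i) =
  trans (ext (Tot-∂-linear N (headCone-lawful lo))
          (λ (τ′ , b′ , i′) → cong (λ n → w n * c (b′ ∷ τ′ , i′)) (cone-degree (deg O) τ′ b′ i′)) (τ , b , i))
 (trans (Tot-weight N (headCone-lawful lo) w (peel c) (τ , b , i))
        (cong (λ n → w (suc n) * ∂ (Tot (suc N) O) c (b ∷ τ , i)) (sym (cone-degree (deg O) τ b i))))

Tot-∂∂ : ∀ N {I} {O : Ops I N} → Lawful O → ∀ c → ∂ (Tot N O) (∂ (Tot N O) c) ≗ 𝟘
Tot-∂∂ zero    lo c ([] , i)    = ∂∂ lo _ i
Tot-∂∂ (suc N) lo c (b ∷ τ , i) = Tot-∂∂ N (headCone-lawful lo) (peel c) (τ , b , i)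

Tot-lawful : ∀ N {I} {O : Ops I N} → Lawful O → Lawful (Tot N O)
Tot-lawful N lo = record
  { ∂-linear = Tot-∂-linear N lo ; ∂-weight = Tot-weight N lo ; ∂∂ = Tot-∂∂ N lo ; ρ-compat = λ () }

Tot-natural : ∀ N {I J} {O : Ops I N} {O′ : Ops J N} {L : Chain I → Chain J} →
  Lawful O′ → Linear L → (∀ c → L (∂ O c) ≗ ∂ O′ (L c)) → (∀ j c → L (ρ O j c) ≗ ρ O′ j (L c)) →
  ∀ c → right L (∂ (Tot N O) c) ≗ ∂ (Tot N O′) (right L c)
Tot-natural zero    lo′ lL L∂ Lρ c ([] , j) = L∂ _ j
Tot-natural (suc N) lo′ lL L∂ Lρ c (b ∷ τ , j) =
  Tot-natural N (headCone-lawful lo′) (diag-linear lL)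
    (λ { x (false , j) → trans (add lL _ _ j) (cong₂ _+_ (L∂ _ j) (Lρ zero _ j))
       ; x (true , j) → trans (neg lL _ j) (cong -_ (L∂ _ j)) })
    (λ { k x (b , j) → Lρ (suc k) _ j })
    (peel c) (τ , b , j)

Tot-supp : ∀ N {I} {O : Ops I N} {G} → Respectful O G → ∀ c →
           Supp (spread G) c → Supp (spread G) (∂ (Tot N O) c)
Tot-supp zero    ro c s ([] , i) = ∂-supp ro [] _ (λ i → s ([] , i)) i
Tot-supp (suc N) {G = G} ro c s (b ∷ τ , i) e =
  Tot-supp N (cone-respectful ro) (peel c)
    (λ { (τ , false , i) → s (false ∷ τ , i) ; (τ , true , i) → s (true ∷ τ , i) })
    (τ , b , i) (trans (select-∷ b) e)
  where
  select-∷ : ∀ b → headConeG G τ (b , i) ≡ G (b ∷ τ) i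
  select-∷ false = refl
  select-∷ true  = refl

infixl 6 _∣ᴳ_

within : ∀ {N} → Vec Bool N → Vec Bool N → Bool
within []      []      = true
within (s ∷ S) (b ∷ τ) = (not b ∨ s) ∧ within S τ

_∣ᴳ_ : ∀ {N} {I : Set} → Colouring N I → Vec Bool N → Colouring N I
(G ∣ᴳ S) τ i = within S τ ∧ G τ i

total-peel : ∀ {N I} {O : Ops I (suc N)} {G : Colouring (suc N) I} {H} → Lawful O →
             (∀ τ b i → G (b ∷ τ) i ≡ H τ (b , i)) → ∀ {q} →
             Exact (Tot (suc N) O) (spread G) q → Exact (Tot N (headCone O)) (spread H) q
total-peel {N} {O = O} {G} {H} lo GH {q} = exact-transfer {O = Tot (suc N) O} {O′ = Tot N (headCone O)}
  (iso-transfer {G = λ _ → spread G} {G′ = λ _ → spread H} peel unpeel peel-linear unpeel-linear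
    unpeel-peel (λ _ _ → refl) (Tot-∂-linear N (headCone-lawful lo)) (λ ()) (λ _ _ → refl) (λ ())
    (λ { _ c s (τ , b , i) e → s _ (trans (GH τ b i) e) })
    (λ { _ c s (b ∷ τ , i) e → s _ (trans (sym (GH τ b i)) e) })
    (λ { p c h (τ , b , i) e → h _ (trans (cong p (cone-degree (deg O) τ b i)) e) })
    (λ { p c h (b ∷ τ , i) e → h _ (trans (cong p (sym (cone-degree (deg O) τ b i))) e) }))

total-unpeel : ∀ {N I} {O : Ops I (suc N)} {G : Colouring (suc N) I} → Lawful O → ∀ {q} →
  Exact (Tot N (headCone O)) (spread (headConeG G)) q → Exact (Tot (suc N) O) (spread G) q
total-unpeel {N} {O = O} {G} lo {q} = exact-transfer {O = Tot N (headCone O)} {O′ = Tot (suc N) O}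
  (iso-transfer {G = λ _ → spread (headConeG G)} {G′ = λ _ → spread G} unpeel peel unpeel-linear peel-linear
    (λ _ _ → refl) unpeel-peel (Tot-∂-linear (suc N) lo) (λ ()) (λ { c (b ∷ τ , i) → refl }) (λ ())
    (λ { _ c s (false ∷ τ , i) → s _ ; _ c s (true ∷ τ , i) → s _ })
    (λ { _ c s (τ , false , i) → s _ ; _ c s (τ , true , i) → s _ })
    (λ { p c h (b ∷ τ , i) e → h _ (trans (cong p (sym (cone-degree (deg O) τ b i))) e) })
    (λ { p c h (τ , b , i) e → h _ (trans (cong p (cone-degree (deg O) τ b i)) e) }))

leray⇒total : ∀ {d} N {I} {O : Ops I N} {G} → Lawful O → Leray d N O G →
              ∀ q → d ℕ.< q → Exact (Tot N O) (spread G) q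
leray⇒total zero {O = O} {G} lo l q d<q = exact-transfer {O = O} {O′ = Tot zero O}
  (iso-transfer {G = G} {G′ = λ _ → spread G} (λ c (_ , i) → c i) (λ c i → c ([] , i))
    (reindex-linear _) (reindex-linear _) (λ _ _ → refl) (λ { c ([] , i) → refl })
    (Tot-∂-linear zero lo) (λ ()) (λ { c ([] , i) → refl }) (λ ())
    (λ { [] c s ([] , i) → s i }) (λ { [] c s i → s _ })
    (λ { p c h ([] , i) → h i }) (λ { p c h i → h _ }))
  (l q d<q)
leray⇒total (suc N) lo (_ , l) q d<q = total-unpeel lo (leray⇒total N (headCone-lawful lo) l q d<q)

-- The bits of S choose between the two halves of `Leray`: `false` discards the colour, `true` cones
-- over it.
total⇒leray : ∀ {d} N {I} {O : Ops I N} {G} → Lawful O →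
  (∀ S q → d ℕ.< q → Exact (Tot N O) (spread (G ∣ᴳ S)) q) → Leray d N O G
total⇒leray zero {O = O} {G} lo ex q d<q = exact-transfer {O = Tot zero O} {O′ = O}
  (iso-transfer {G = λ _ → spread (G ∣ᴳ [])} {G′ = G} (λ c i → c ([] , i)) (λ c (_ , i) → c i)
    (reindex-linear _) (reindex-linear _) (λ { c ([] , i) → refl }) (λ _ _ → refl)
    (∂-linear lo) (λ ()) (λ _ _ → refl) (λ ())
    (λ { [] c s i → s ([] , i) }) (λ { [] c s ([] , i) → s i })
    (λ { p c h i → h ([] , i) }) (λ { p c h ([] , i) → h i }))
  (ex [] q d<q)
total⇒leray (suc N) {I} {O} {G} lo ex =
  total⇒leray N (tail-lawful lo) (λ S q d<q → drop S q (ex (false ∷ S) q d<q)) ,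
  total⇒leray N (headCone-lawful lo)
    (λ S q d<q → total-peel {G = G ∣ᴳ (true ∷ S)} {H = headConeG G ∣ᴳ S} lo
      (λ { τ false i → refl ; τ true i → refl }) (ex (true ∷ S) q d<q))
  where
  inject : Chain I → Chain (Bool × I)
  inject x = pair x 𝟘
  inject-∂ : ∀ c → inject (∂ O c) ≗ ∂ (headCone O) (inject c)
  inject-∂ c (false , i) =
    sym (trans (cong (∂ O c i +_) (null (linear (ρ-compat lo zero)) (λ _ → refl) i)) (+-identityʳ _))
  inject-∂ c (true  , i) = sym (neg-zero (null (∂-linear lo) (λ _ → refl) i))
  inject-ρ : ∀ j c → inject (ρ O (suc j) c) ≗ ρ (headCone O) j (inject c)
  inject-ρ j c (false , i) = refl
  inject-ρ j c (true  , i) = sym (null (linear (ρ-compat lo (suc j))) (λ _ → refl) i)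
  drop : ∀ S q → Exact (Tot (suc N) O) (spread (G ∣ᴳ (false ∷ S))) q →
         Exact (Tot N (tailOps O)) (spread ((G ∘ (false ∷_)) ∣ᴳ S)) q
  drop S q ex c s h cyc =
    -- The cycle is extended by zero to sets containing the head colour. As S omits that colour, the
    -- filling vanishes there too, and its remaining half `b₀` fills the cycle.
    let b , sb , hb , ∂b = ex (unpeel (right inject c))
          (λ { (false ∷ τ , i) → s (τ , i) ; (true ∷ τ , i) _ → refl })
          (λ { (false ∷ τ , i) → h (τ , i) ; (true ∷ τ , i) _ → refl })
          (λ { (b ∷ τ , i) → trans (sym (natural c (τ , b , i))) (pair-zero b (cyc (τ , i))) })
        b₀ : Chain (Vec Bool N × I)
        b₀ = λ (τ , i) → b (false ∷ τ , i)
        b≗ : peel b ≗ right inject b₀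
        b≗ = λ { (τ , false , i) → refl ; (τ , true , i) → sb (true ∷ τ , i) refl }
    in b₀ , (λ (τ , i) → sb (false ∷ τ , i)) , (λ (τ , i) → hb (false ∷ τ , i)) ,
       λ (τ , i) → trans (natural b₀ (τ , false , i))
                  (trans (ext (Tot-∂-linear N (headCone-lawful lo)) (λ k → sym (b≗ k)) (τ , false , i))
                         (∂b (false ∷ τ , i)))
    where
    natural = Tot-natural N (headCone-lawful lo) pair-left-linear inject-∂ inject-ρ
    pair-zero : ∀ b {x i} → x i ≡ 0ℚ → pair x 𝟘 (b , i) ≡ 0ℚ
    pair-zero false e = e
    pair-zero true  e = refl

-- The differential of a total complex in coordinates

open CommutativeMonoidSum (CommutativeRing.+-commutativeMonoid ℚ-commutativeRing)
  using (sum; ∑-distrib-+; ∑-comm; sum-cong-≗; sum-replicate-zero)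

-- The sign counts the colours above j, whereas ∂ on simplicial chains counts the vertices below.
faceSign : ∀ {N} → Fin N → Vec Bool N → ℚ
faceSign zero    (b ∷ τ) = sgn ∣ τ ∣
faceSign (suc j) (b ∷ τ) = faceSign j τ

face : ∀ {N} {I : Set} → Ops I N → Chain (Vec Bool N × I) → Vec Bool N → I → Vector ℚ N
face O c τ i j =
  if lookup τ j then 0ℚ else faceSign j τ * ρ O j (λ i → c (τ [ j ]≔ true , i)) i

Tot-∂ : ∀ N {I} {O : Ops I N} → Lawful O → ∀ c τ i →
        ∂ (Tot N O) c (τ , i) ≡ sgn ∣ τ ∣ * ∂ O (λ i → c (τ , i)) i + sum (face O c τ i)
Tot-∂ zero    lo c [] i = sym (trans (+-identityʳ _) (*-identityˡ _))
Tot-∂ (suc N) {O = O} lo c (false ∷ τ) i =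
  trans (Tot-∂ N (headCone-lawful lo) (peel c) τ (false , i))
        (trans (cong (_+ sum (face (headCone O) (peel c) τ (false , i))) (distribˡ (sgn ∣ τ ∣) _ _)) (+-assoc _ _ _))
Tot-∂ (suc N) {O = O} lo c (true ∷ τ) i =
  trans (Tot-∂ N (headCone-lawful lo) (peel c) τ (true , i))
        (cong₂ _+_ (trans (sym (neg-*ʳ (sgn ∣ τ ∣) _)) (sym (neg-*ˡ (sgn ∣ τ ∣) _)))
                   (sym (+-identityˡ (sum (face (headCone O) (peel c) τ (true , i))))))

-- Sums over the subsets of a finite set, and pushforwards

sumV : ∀ n → Chain (Vec Bool n) → ℚ
sumV zero    c = c []
sumV (suc n) c = sumV n (c ∘ (false ∷_)) + sumV n (c ∘ (true ∷_))

sumV-linear : ∀ n → Linear {Vec Bool n} {⊤} (λ c _ → sumV n c)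
sumV-linear zero = record
  { ext = λ e _ → e [] ; add = λ _ _ _ → refl ; scale = λ _ _ _ → refl }
sumV-linear (suc n) = ⊕-linear (∘-linear (sumV-linear n) (reindex-linear (false ∷_)))
                               (∘-linear (sumV-linear n) (reindex-linear (true ∷_)))

sumV-ext : ∀ {n} {c c′ : Chain (Vec Bool n)} → c ≗ c′ → sumV n c ≡ sumV n c′
sumV-ext e = ext (sumV-linear _) e tt

sumV-zero : ∀ {n} {c : Chain (Vec Bool n)} → c ≗ 𝟘 → sumV n c ≡ 0ℚ
sumV-zero e = null (sumV-linear _) e tt

sumV-linear-comm : ∀ {n I J} {g : Chain I → Chain J} → Linear g → ∀ (c : Vec Bool n → Chain I) j →
                   sumV n (λ u → g (c u) j) ≡ g (λ i → sumV n (λ u → c u i)) j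
sumV-linear-comm {n} lg c j = linear-comm (finite-Vec n) (sumV-linear n) lg c tt j

sumV-comm : ∀ {m n} (c : Vec Bool m → Vec Bool n → ℚ) →
            sumV m (λ u → sumV n (c u)) ≡ sumV n (λ v → sumV m (λ u → c u v))
sumV-comm {m} {n} c = sumV-linear-comm {m} (sumV-linear n) c tt

kronecker : ∀ {n} → Vec Bool n → Vec Bool n → ℚ
kronecker []          []          = 1ℚ
kronecker (false ∷ u) (false ∷ v) = kronecker u v
kronecker (true  ∷ u) (true  ∷ v) = kronecker u v
kronecker (false ∷ u) (true  ∷ v) = 0ℚ
kronecker (true  ∷ u) (false ∷ v) = 0ℚ

kronecker-refl : ∀ {n} (u : Vec Bool n) → kronecker u u ≡ 1ℚ
kronecker-refl []          = refl
kronecker-refl (false ∷ u) = kronecker-refl u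
kronecker-refl (true  ∷ u) = kronecker-refl u

kronecker-≢ : ∀ {n} (u v : Vec Bool n) → u ≢ v → kronecker u v ≡ 0ℚ
kronecker-≢ []          []          u≢v = ⊥-elim (u≢v refl)
kronecker-≢ (false ∷ u) (false ∷ v) u≢v = kronecker-≢ u v (u≢v ∘ cong (false ∷_))
kronecker-≢ (true  ∷ u) (true  ∷ v) u≢v = kronecker-≢ u v (u≢v ∘ cong (true ∷_))
kronecker-≢ (false ∷ u) (true  ∷ v) u≢v = refl
kronecker-≢ (true  ∷ u) (false ∷ v) u≢v = refl

sumV-kronecker : ∀ {n} (u : Vec Bool n) (c : Chain (Vec Bool n)) → sumV n (λ v → kronecker u v * c v) ≡ c u
sumV-kronecker []          c = *-identityˡ _
sumV-kronecker {suc n} (false ∷ u) c =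
  trans (cong₂ _+_ (sumV-kronecker u (c ∘ (false ∷_))) (sumV-zero {n} (λ v → zeroˡ (c (true ∷ v))))) (+-identityʳ _)
sumV-kronecker {suc n} (true ∷ u) c =
  trans (cong₂ _+_ (sumV-zero {n} (λ v → zeroˡ (c (false ∷ v)))) (sumV-kronecker u (c ∘ (true ∷_)))) (+-identityˡ _)

push : ∀ {m n} → (Vec Bool m → Vec Bool n) → Chain (Vec Bool m) → Chain (Vec Bool n)
push {m} f c v = sumV m (λ u → kronecker (f u) v * c u)

push-linear : ∀ {m n} (f : Vec Bool m → Vec Bool n) → Linear (push f)
push-linear {m} f = record
  { ext = λ e v → sumV-ext (λ u → cong (kronecker (f u) v *_) (e u))
  ; add = λ x y v → trans (sumV-ext (λ u → distribˡ (kronecker (f u) v) _ _)) (add (sumV-linear m) _ _ tt)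
  ; scale = λ q x v → trans (sumV-ext (λ u → scale-swap (kronecker (f u) v) q (x u))) (scale (sumV-linear m) q _ tt) }

push-cong : ∀ {m n} {f g : Vec Bool m → Vec Bool n} → f ≗ g → ∀ c → push f c ≗ push g c
push-cong f≗g c v = sumV-ext (λ u → cong (λ w → kronecker w v * c u) (f≗g u))

push-∘ : ∀ {l m n} (f : Vec Bool m → Vec Bool n) (g : Vec Bool l → Vec Bool m) c →
         push f (push g c) ≗ push (f ∘ g) c
push-∘ {l} {m} f g c w =
  trans (sumV-ext (λ v → sym (scale (sumV-linear l) (kronecker (f v) w) _ tt)))
 (trans (sumV-comm (λ v u → kronecker (f v) w * (kronecker (g u) v * c u)))
        (sumV-ext (λ u → trans (sumV-ext (λ v → scale-swap (kronecker (f v) w) (kronecker (g u) v) (c u)))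
                               (sumV-kronecker (g u) (λ v → kronecker (f v) w * c u)))))

sumV-push : ∀ {m n} (f : Vec Bool m → Vec Bool n) c → sumV n (push f c) ≡ sumV m c
sumV-push f c =
  trans (sumV-comm (λ v u → kronecker (f u) v * c u))
        (sumV-ext (λ u → sumV-kronecker (f u) (λ _ → c u)))

-- Cubes of vector spaces

-- Every cell has degree 0, so in the total complex the degree of a cell is the size of its colour
-- set: for simplices of a join, the number of vertices.
flat : ∀ {I N} → (Fin N → Chain I → Chain I) → Ops I N
flat r = record { deg = λ _ → 0 ; ∂ = λ _ → 𝟘 ; ρ = r }

flat-lawful : ∀ {I N} {r : Fin N → Chain I → Chain I} → (∀ j → Linear (r j)) →
              (∀ i j c → r i (r j c) ≗ r j (r i c)) → Lawful (flat r)
flat-lawful lr rr = record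
  { ∂-linear = record { ext = λ _ _ → refl ; add = λ _ _ _ → sym (+-identityˡ 0ℚ)
                      ; scale = λ q _ _ → sym (zeroʳ q) }
  ; ∂-weight = λ w c i → sym (zeroʳ _)
  ; ∂∂ = λ _ _ → refl
  ; ρ-compat = λ j → record
    { linear = lr j ; weight = λ w → scale (lr j) (w 0)
    ; comm-∂ = λ c → null (lr j) (λ _ → refl) ; comm-ρ = rr j }
  }

-- The cone of an identity map is contractible, so as soon as one colour is coned over there is
-- nothing to check; the single condition left is the one without colours.
constant-leray : ∀ {d} N {I} {O : Ops I N} {G : I → Bool} → Lawful O → (∀ j c → ρ O j c ≗ c) →
                 (∀ q → d ℕ.< q → Exact (forget O) G q) → Leray d N O (λ _ → G)
constant-leray zero lo ρ≗id ex = ex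
constant-leray (suc N) {O = O} lo ρ≗id ex =
  constant-leray N (tail-lawful lo) (λ j → ρ≗id (suc j)) ex ,
  constant-leray N (headCone-lawful lo) (λ { j c (b , i) → ρ≗id (suc j) _ i })
    (λ q _ c s h cyc → pair 𝟘 (slice false c) ,
      (λ { (false , i) _ → refl ; (true , i) → s (false , i) }) ,
      (λ { (false , i) _ → refl ; (true , i) → h (false , i) }) ,
      λ { (false , i) → trans (cong₂ _+_ (null (∂-linear lo) (λ _ → refl) i) (ρ≗id zero _ i)) (+-identityˡ _)
        ; (true , i) → opposite (trans (cong (∂ O (slice false c) i +_) (sym (ρ≗id zero _ i))) (cyc (false , i))) })
  where
  opposite : ∀ {a b} → a + b ≡ 0ℚ → - a ≡ b
  opposite {a} {b} e = trans (sym (+-identityʳ _)) (trans (cong (- a +_) (sym e))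
    (trans (sym (+-assoc _ _ _)) (trans (cong (_+ b) (-‿inverseˡ a)) (+-identityˡ b))))

⊗-respectful : ∀ {I J N} {O : Ops I N} {P : Ops J N} {G H} → Lawful O → Lawful P →
               Respectful O G → Respectful P H → Respectful (O ⊗ P) (G ⊗ᴳ H)
⊗-respectful {O = O} {P} {G} {H} lo lp ro rp = record
  { ∂-supp = λ { τ c s (i , j) e → add-zero
      (left-supp {G = G τ} (H τ) (∂-linear lo) (∂-supp ro τ) c s (i , j) e)
      (trans (cong (sgn (deg O i) *_) (right-supp (G τ) {H τ} (∂-linear lp) (∂-supp rp τ) c s (i , j) e)) (zeroʳ _)) }
  ; ρ-supp = λ k τ c s →
      left-supp {G = G τ} (H (τ [ k ]≔ false)) (linear (ρ-compat lo k)) (ρ-supp ro k τ) (right (ρ P k) c)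
        (right-supp (G τ) {H τ} (linear (ρ-compat lp k)) (ρ-supp rp k τ) c s)
  }

-- Fibrewise powers of a cube of vector spaces

Tup : ℕ → ℕ → Set
Tup n zero    = ⊤
Tup n (suc k) = Vec Bool n × Tup n k

module Powers {n m : ℕ} (rem : Fin m → Vec Bool n → Vec Bool n)
  (rem-comm : ∀ i j σ → rem i (rem j σ) ≡ rem j (rem i σ))
  (F : Colouring m (Vec Bool n))
  (F-rem : ∀ j τ σ → F τ σ ≡ true → F (τ [ j ]≔ false) (rem j σ) ≡ true)
  where

  base : Ops (Vec Bool n) m
  base = flat (λ j → push (rem j))

  base-lawful : Lawful base
  base-lawful = flat-lawful (λ j → push-linear (rem j)) λ i j c σ →
    trans (push-∘ (rem i) (rem j) c σ)
   (trans (push-cong (rem-comm i j) c σ) (sym (push-∘ (rem j) (rem i) c σ)))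

  base-respectful : Respectful base F
  base-respectful = record
    { ∂-supp = λ _ _ _ _ _ → refl
    ; ρ-supp = λ j τ c s σ e → sumV-zero (λ υ → term j τ c s σ e υ (F τ υ) refl) }
    where
    term : ∀ j τ c → Supp (F τ) c → ∀ σ → F (τ [ j ]≔ false) σ ≡ false → ∀ υ b → F τ υ ≡ b →
           kronecker (rem j υ) σ * c υ ≡ 0ℚ
    term j τ c s σ e υ false eq = trans (cong (_ *_) (s υ eq)) (zeroʳ _)
    term j τ c s σ e υ true  eq =
      trans (cong (_* c υ) (kronecker-≢ (rem j υ) σ λ eq′ →
              true≢false (F-rem j τ υ eq) (trans (cong (F (τ [ j ]≔ false)) eq′) e)))
            (zeroˡ _)

  T : ∀ k → Ops (Tup n k) m
  T zero    = flat (λ _ → id)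
  T (suc k) = base ⊗ T k

  TG : ∀ k → Colouring m (Tup n k)
  TG zero    _ _ = true
  TG (suc k)     = F ⊗ᴳ TG k

  T-lawful : ∀ k → Lawful (T k)
  T-lawful zero    = flat-lawful (λ _ → id-linear) (λ _ _ _ _ → refl)
  T-lawful (suc k) = ⊗-lawful (finite-Vec n) base-lawful (T-lawful k)

  T-respectful : ∀ k → Respectful (T k) (TG k)
  T-respectful zero    = record { ∂-supp = λ _ _ _ _ _ → refl ; ρ-supp = λ _ _ _ _ _ () }
  T-respectful (suc k) = ⊗-respectful base-lawful (T-lawful k) base-respectful (T-respectful k)

  T-leray : ∀ {d} → Leray d m base F → ∀ k → Leray (k ℕ.* d) m (T k) (TG k)
  -- The 0-fold power is the constant cube ℚ in degree 0; it has no cycles in positive degrees.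
  T-leray l zero = constant-leray m (T-lawful zero) (λ _ _ _ → refl)
    λ { (suc q) _ c s h _ → 𝟘 , (λ _ _ → refl) , (λ _ _ → refl) , λ i → sym (h i refl) }
  T-leray l (suc k) =
    leray-⊗ m (finite-Vec n) base-lawful (T-lawful k) base-respectful (T-respectful k) l (T-leray l k)

  T-deg : ∀ k l → deg (T k) l ≡ 0
  T-deg zero    l       = refl
  T-deg (suc k) (_ , l) = T-deg k l

  T-∂ : ∀ k c → ∂ (T k) c ≗ 𝟘
  T-∂ zero    c l       = refl
  T-∂ (suc k) c (σ , l) = add-zero refl (trans (cong (_ *_) (T-∂ k _ l)) (zeroʳ _))

-- Alternating chains on tuples

sumHead : ∀ {n} {J : Set} → Chain (Vec Bool n × J) → Chain J
sumHead {n} c l = sumV n (λ σ → c (σ , l))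

sumHead-linear : ∀ {n} {J : Set} → Linear (sumHead {n} {J})
sumHead-linear {n} = record
  { ext = λ e l → sumV-ext (λ σ → e (σ , l)) ; add = λ x y l → add (sumV-linear n) _ _ tt
  ; scale = λ q x l → scale (sumV-linear n) q _ tt }

-- The alternating sum over i of the maps that sum out the i-th entry: the augmented boundary on
-- ordered tuples.
slip : ∀ {n k} → Chain (Tup n (suc k)) → Chain (Tup n k)
slip {k = zero}  c = sumHead c
slip {k = suc k} c = sumHead c ⊖ right slip c

slip-linear : ∀ {n} k → Linear (slip {n} {k})
slip-linear zero    = sumHead-linear
slip-linear (suc k) = ⊖-linear sumHead-linear (right-linear (slip-linear k))

opaque
  unfolding _+_ _*_ -_

  count-step : ∀ s k → s + - (k * - s) ≡ (1ℚ + k) * s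
  count-step = solve-∀ ℚ-ring

  one-times : ∀ s → (1ℚ + 0ℚ) * s ≡ s
  one-times = solve-∀ ℚ-ring

  double-swap : ∀ a b e → b + - (a + - e) ≡ - (a + - (b + - - e))
  double-swap = solve-∀ ℚ-ring

  double-eq : ∀ a → (1ℚ + (1ℚ + 0ℚ)) * a ≡ a + a
  double-eq = solve-∀ ℚ-ring

  assoc-cancel : ∀ p q r w c → (p * ((q * r) * (w * c))) ≡ (r * p) * ((q * w) * c)
  assoc-cancel = solve-∀ ℚ-ring

slip-slip : ∀ {n} k (c : Chain (Tup n (suc (suc k)))) → slip (slip c) ≗ 𝟘
slip-slip {n} zero c tt =
  trans (add (sumV-linear n) _ _ tt)
 (trans (cong₂ _+_ (sumV-comm (λ σ υ → c (υ , σ , tt))) (neg (sumV-linear n) _ tt)) (-‿inverseʳ _))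
slip-slip {n} (suc k) c (σ , l) =
  trans (cong₂ (λ a b → a + - b) head-part tail-part) (collapse-sums _ _ _ (sumV-comm (λ υ ω → c (ω , υ , σ , l))))
  where
  head-part : sumHead (slip c) (σ , l) ≡
    sumV n (λ υ → sumV n (λ ω → c (ω , υ , σ , l))) +
    (- sumV n (λ υ → sumV n (λ ω → c (υ , ω , σ , l))) + slip (λ l → sumHead c (σ , l)) l)
  head-part =
    trans (add (sumV-linear n) _ _ tt)
          (cong (_ +_) (trans (neg (sumV-linear n) _ tt)
            (trans (cong -_ (trans (add (sumV-linear n) _ _ tt) (cong (_ +_) (neg (sumV-linear n) _ tt))))
            (trans (neg-+ _ _)
                   (cong (_ +_) (trans (neg-neg _) (sumV-linear-comm {n} (slip-linear k) (λ υ l → c (υ , σ , l)) l)))))))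
  tail-part : right slip (slip c) (σ , l) ≡ slip (λ l → sumHead c (σ , l)) l
  tail-part = trans (sub (slip-linear k) _ _ l)
                    (trans (cong (λ a → slip (λ l → sumHead c (σ , l)) l + - a) (slip-slip k (λ l → c (σ , l)) l))
                           (trans (cong (slip (λ l → sumHead c (σ , l)) l +_) neg-0) (+-identityʳ _)))
  collapse-sums : ∀ a b e → a ≡ b → (a + (- b + e)) + - e ≡ 0ℚ
  collapse-sums a _ e refl =
    trans (cong (_+ - e) (trans (sym (+-assoc a (- a) e)) (trans (cong (_+ e) (-‿inverseʳ a)) (+-identityˡ e))))
          (-‿inverseʳ e)

-- Adjacent transpositions generate the symmetric group, so testing them is enough for
-- `Alternating`.
data Swap : ℕ → Set where
  here  : ∀ {k} → Swap (suc (suc k))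
  there : ∀ {k} → Swap k → Swap (suc k)

act : ∀ {n k} → Swap k → Tup n k → Tup n k
act here      (σ , υ , l) = υ , σ , l
act (there p) (σ , l)     = σ , act p l

Alternating : ∀ {n k} → Chain (Tup n k) → Set
Alternating c = ∀ p l → c (act p l) ≡ - c l

alternating-tail : ∀ {n k} {c : Chain (Tup n (suc k))} → Alternating c →
                   ∀ σ → Alternating (λ l → c (σ , l))
alternating-tail alt σ p l = alt (there p) (σ , l)

num : ℕ → ℚ
num zero    = 0ℚ
num (suc k) = 1ℚ + num k

opaque
  unfolding _+_ _*_ -_

  num-nonneg : ∀ k → 0ℚ ℚ.≤ num k
  num-nonneg zero    = ℚ.≤-refl
  num-nonneg (suc k) = ℚ.≤-trans (num-nonneg k)
    (subst (ℚ._≤ num (suc k)) (ℚ.+-identityˡ (num k)) (ℚ.+-monoˡ-≤ (num k) {0ℚ} {1ℚ} (ℚ.nonNegative⁻¹ 1ℚ)))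

  num-suc≢0 : ∀ k → num (suc k) ≢ 0ℚ
  num-suc≢0 k e = ℚ.<⇒≢ (ℚ.<-≤-trans (ℚ.positive⁻¹ 1ℚ)
    (subst (ℚ._≤ num (suc k)) (ℚ.+-identityʳ 1ℚ) (ℚ.+-monoʳ-≤ 1ℚ {0ℚ} {num k} (num-nonneg k)))) (sym e)

num-+ : ∀ j k → num (j ℕ.+ k) ≡ num j + num k
num-+ zero    k = sym (+-identityˡ _)
num-+ (suc j) k = trans (cong (1ℚ +_) (num-+ j k)) (sym (+-assoc _ _ _))

-- Moving the i-th entry to the front of an alternating chain produces the same sign (-1)ⁱ with
-- which `slip` counts it, so all k + 1 terms agree.
slip-alternating : ∀ {n} k (c : Chain (Tup n (suc k))) → Alternating c →
                   slip c ≗ num (suc k) ⊙ sumHead c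
slip-alternating zero c alt l = sym (one-times _)
slip-alternating {n} (suc k) c alt (σ , l) =
  trans (cong (λ a → sumHead c (σ , l) + - a)
          (trans (slip-alternating k (λ l → c (σ , l)) (alternating-tail alt σ) l)
                 (cong (num (suc k) *_) (trans (sumV-ext (λ υ → alt here (υ , σ , l))) (neg (sumV-linear n) _ tt)))))
        (count-step _ _)

Member : ∀ {n k} → Vec Bool n → Tup n k → Set
Member {k = zero}  σ _       = ⊥
Member {k = suc k} σ (υ , l) = σ ≡ υ ⊎ Member σ l

Repeats : ∀ {n k} → Tup n k → Set
Repeats {k = zero}  _       = ⊥
Repeats {k = suc k} (σ , l) = Member σ l ⊎ Repeats l

self-opposite : ∀ {a} → a ≡ - a → a ≡ 0ℚ
self-opposite {a} e with r , r2≡1 ← reciprocal (num 2) (num-suc≢0 1) =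
  trans (sym (*-identityˡ a)) (trans (cong (_* a) (sym r2≡1)) (trans (*-assoc r (num 2) a)
    (trans (cong (r *_) (trans (double-eq a) (trans (cong (a +_) e) (-‿inverseʳ a)))) (zeroʳ r))))

alternating-member : ∀ {n} k (c : Chain (Tup n (suc k))) → Alternating c →
                     ∀ σ l → Member σ l → c (σ , l) ≡ 0ℚ
alternating-member (suc k) c alt σ (_ , l) (inj₁ refl) = self-opposite (alt here (σ , σ , l))
alternating-member (suc k) c alt σ (υ , l) (inj₂ σ∈l) =
  trans (alt here (υ , σ , l))
        (neg-zero (alternating-member k (λ l → c (υ , l)) (alternating-tail alt υ) σ l σ∈l))

alternating-repeats : ∀ {n} k (c : Chain (Tup n k)) → Alternating c → ∀ l → Repeats l → c l ≡ 0ℚ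
alternating-repeats (suc k) c alt (σ , l) (inj₁ σ∈l) = alternating-member k c alt σ l σ∈l
alternating-repeats (suc k) c alt (σ , l) (inj₂ rep) =
  alternating-repeats k (λ l → c (σ , l)) (alternating-tail alt σ) l rep

-- The Čech coboundary, c ↦ Σᵢ (-1)ⁱ c(σ₀, …, σ̂ᵢ, …, σₖ)
cech : ∀ {n} k → Chain (Tup n k) → Chain (Tup n (suc k))
cech zero    c (σ , l) = c l
cech (suc k) c (σ , l) = c l + - cech k (λ l → c (σ , l)) l

cech-linear : ∀ {n} k → Linear (cech {n} k)
cech-linear zero = record
  { ext = λ e (_ , l) → e l ; add = λ _ _ _ → refl ; scale = λ _ _ _ → refl }
cech-linear (suc k) = record
  { ext = λ e (σ , l) → cong₂ (λ a b → a + - b) (e l) (ext l′ (λ l → e (σ , l)) l)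
  ; add = λ x y (σ , l) → trans (cong (λ a → _ + - a) (add l′ (λ l → x (σ , l)) (λ l → y (σ , l)) l))
                         (trans (cong (_ +_) (neg-+ _ _)) (+-interchange _ _ _ _))
  ; scale = λ q x (σ , l) → trans (cong (λ a → _ + - a) (scale l′ q (λ l → x (σ , l)) l))
                           (trans (cong (_ +_) (neg-*ʳ q _)) (sym (distribˡ q _ _)))
  }
  where l′ = cech-linear k

cech-alternating : ∀ {n} k (c : Chain (Tup n k)) → Alternating c → Alternating (cech k c)
cech-alternating zero c alt (there ()) l
cech-alternating (suc zero) c alt here (σ , υ , l) =
  sym (trans (neg-+ _ _) (trans (cong (_ +_) (neg-neg _)) (+-comm _ _)))
cech-alternating (suc (suc k)) c alt here (σ , υ , l) =
  trans (double-swap _ _ _)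
        (cong (λ a → - (c (υ , l) + - (c (σ , l) + - a)))
          (trans (sym (neg (cech-linear k) (λ l → c (υ , σ , l)) l))
                 (ext (cech-linear k) (λ l → sym (alt here (υ , σ , l))) l)))
cech-alternating (suc k) c alt (there p) (σ , l) =
  trans (cong₂ (λ a b → a + - b) (alt p l) (cech-alternating k (λ l → c (σ , l)) (alternating-tail alt σ) p l))
        (sym (neg-+ _ _))

countV : ∀ n → (Vec Bool n → Bool) → ℕ
countV zero    P = if P [] then 1 else 0
countV (suc n) P = countV n (P ∘ (false ∷_)) ℕ.+ countV n (P ∘ (true ∷_))

bit : Bool → ℚ
bit b = if b then 1ℚ else 0ℚ

sumV-bit : ∀ n P → sumV n (bit ∘ P) ≡ num (countV n P)
sumV-bit zero P with P []
... | true  = sym (+-identityʳ 1ℚ)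
... | false = refl
sumV-bit (suc n) P = trans (cong₂ _+_ (sumV-bit n _) (sumV-bit n _)) (sym (num-+ (countV n _) _))

countV-zero : ∀ n P → countV n P ≡ 0 → ∀ σ → P σ ≡ false
countV-zero zero P e [] with P []
... | false = refl
countV-zero (suc n) P e (false ∷ σ) = countV-zero n _ (ℕ.m+n≡0⇒m≡0 _ e) σ
countV-zero (suc n) P e (true  ∷ σ) = countV-zero n _ (ℕ.m+n≡0⇒n≡0 (countV n (P ∘ (false ∷_))) e) σ

inverse-num : ℕ → ℚ
inverse-num zero    = 0ℚ
inverse-num (suc k) = proj₁ (reciprocal (num (suc k)) (num-suc≢0 k))

inverse-num-* : ∀ k → inverse-num (suc k) * num (suc k) ≡ 1ℚ
inverse-num-* k = proj₂ (reciprocal (num (suc k)) (num-suc≢0 k))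

sumV-masked : ∀ {n} {J : Set} (P : Vec Bool n → Bool) (x : Vec Bool n → Chain J) j →
  (∀ σ → P σ ≡ false → x σ j ≡ 0ℚ) → sumV n (λ σ → bit (P σ) * x σ j) ≡ sumV n (λ σ → x σ j)
sumV-masked P x j s = sumV-ext (λ σ → term σ (P σ) refl)
  where
  term : ∀ σ b → P σ ≡ b → bit (P σ) * x σ j ≡ x σ j
  term σ true  eq = trans (cong (λ b → bit b * x σ j) eq) (*-identityˡ _)
  term σ false eq = trans (cong (λ b → bit b * x σ j) eq) (trans (zeroˡ _) (sym (s σ eq)))

-- The double complex of fibrewise powers

module Zigzag {n m : ℕ} (rem : Fin m → Vec Bool n → Vec Bool n)
  (rem-comm : ∀ i j σ → rem i (rem j σ) ≡ rem j (rem i σ))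
  (F : Colouring m (Vec Bool n))
  (F-rem : ∀ j τ σ → F τ σ ≡ true → F (τ [ j ]≔ false) (rem j σ) ≡ true)
  where

  open Powers rem rem-comm F F-rem

  Cells : ℕ → Set
  Cells k = Vec Bool m × Tup n k

  D : ∀ k → Chain (Cells k) → Chain (Cells k)
  D k = ∂ (Tot m (T k))

  D-lawful : ∀ k → Lawful (Tot m (T k))
  D-lawful k = Tot-lawful m (T-lawful k)

  D-linear : ∀ k → Linear (D k)
  D-linear k = ∂-linear (D-lawful k)

  -- A pushforward preserves the sum of the coefficients, so an entry that is summed out does not
  -- notice `rem j`.
  sumHead-ρ : ∀ k j c → sumHead (ρ (T (suc k)) j c) ≗ ρ (T k) j (sumHead c)
  sumHead-ρ k j c l =
    trans (sumV-push (rem j) _) (sumV-linear-comm {n} (linear (ρ-compat (T-lawful k) j)) (λ σ l → c (σ , l)) l)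

  slip-ρ : ∀ k j c → slip (ρ (T (suc k)) j c) ≗ ρ (T k) j (slip c)
  slip-ρ zero    j c = sumHead-ρ zero j c
  slip-ρ (suc k) j c (σ , l) =
    trans (cong₂ (λ a b → a + - b) (sumHead-ρ (suc k) j c (σ , l))
            (trans (sym (left-right (finite-Vec n) (push-linear (rem j)) (slip-linear k) (right (ρ (T (suc k)) j) c) (σ , l)))
                   (ext (push-linear (rem j)) (λ υ → slip-ρ k j (λ l → c (υ , l)) l) σ)))
          (sym (sub (linear (ρ-compat (T-lawful (suc k)) j)) (sumHead c) (right slip c) (σ , l)))

  D-slip : ∀ k c → right slip (D (suc k) c) ≗ D k (right slip c)
  D-slip k = Tot-natural m (T-lawful k) (slip-linear k)
    (λ c l → trans (null (slip-linear k) (T-∂ (suc k) c) l) (sym (T-∂ k (slip c) l)))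
    (slip-ρ k)

  act-ρ : ∀ k (p : Swap k) j c → (λ l → ρ (T k) j c (act p l)) ≗ ρ (T k) j (c ∘ act p)
  act-ρ (suc (suc k)) here j c (σ , υ , l) =
    linear-comm (finite-Vec n) (push-linear (rem j)) (push-linear (rem j))
      (λ α β → ρ (T k) j (λ l → c (α , β , l)) l) υ σ
  act-ρ (suc k) (there p) j c (σ , l) =
    ext (push-linear (rem j)) (λ υ → act-ρ k p j (λ l → c (υ , l)) l) σ

  D-alternating : ∀ k c → (∀ τ → Alternating (λ l → c (τ , l))) → ∀ τ → Alternating (λ l → D k c (τ , l))
  D-alternating k c alt τ p l =
    trans (Tot-natural m (T-lawful k) (reindex-linear (act p))
            (λ c l → trans (T-∂ k c (act p l)) (sym (T-∂ k (c ∘ act p) l))) (act-ρ k p) c (τ , l))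
   (trans (ext (D-linear k) (λ (τ , l) → alt τ p l) (τ , l)) (neg (D-linear k) c (τ , l)))

  HasSize : (ℕ → Bool) → ∀ {k} → Chain (Cells k) → Set
  HasSize p c = ∀ τ l → p ∣ τ ∣ ≡ false → c (τ , l) ≡ 0ℚ

  total-deg : ∀ k τ l → deg (Tot m (T k)) (τ , l) ≡ ∣ τ ∣
  total-deg k τ l = trans (cong (∣ τ ∣ ℕ.+_) (T-deg k l)) (ℕ.+-identityʳ _)

  to-hom : ∀ k {p c} → HasSize p c → Hom (deg (Tot m (T k))) p c
  to-hom k {p} h (τ , l) e = h τ l (trans (cong p (sym (total-deg k τ l))) e)

  from-hom : ∀ k {p c} → Hom (deg (Tot m (T k))) p c → HasSize p c
  from-hom k {p} h τ l e = h (τ , l) (trans (cong p (total-deg k τ l)) e)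

  D-size : ∀ k {p c} → HasSize p c → HasSize (p ∘ suc) (D k c)
  D-size k {p} {c} h = from-hom k {p ∘ suc} {D k c} (∂-hom (D-lawful k) p (to-hom k {p} {c} h))

  D-supp : ∀ k {c} → Supp (spread (TG k)) c → Supp (spread (TG k)) (D k c)
  D-supp k s = Tot-supp m (T-respectful k) _ s

  slip-supp : ∀ k τ c → Supp (TG (suc k) τ) c → Supp (TG k τ) (slip c)
  sumHead-supp : ∀ k τ c → Supp (TG (suc k) τ) c → Supp (TG k τ) (sumHead c)
  sumHead-supp k τ c s l e = sumV-zero (λ σ → s (σ , l) (trans (cong (F τ σ ∧_) e) (Bool.∧-zeroʳ _)))
  slip-supp zero    τ c s = sumHead-supp zero τ c s
  slip-supp (suc k) τ c s i e = add-zero (sumHead-supp (suc k) τ c s i e)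
    (neg-zero (right-supp (F τ) {TG (suc k) τ} (slip-linear k) (slip-supp k τ) c s i e))

  slip-size : ∀ k {p c} → HasSize p c → HasSize p {k} (right slip c)
  slip-size k h τ l e = null (slip-linear k) (λ l → h τ l e) l

  -- `cech` is exterior multiplication by the sum of all simplices, which `TG` cuts down to those
  -- over τ. Dividing by their number turns the sum into an average, and coning off from this
  -- average contracts the resolution; the factor 1/(k + 1) cancels the multiplicity in
  -- `slip-alternating`.
  cone-point : ∀ k → Chain (Cells k) → Chain (Cells (suc k))
  cone-point k c (τ , l) =
    (inverse-num (countV n (F τ)) * inverse-num (suc k)) * (bit (TG (suc k) τ l) * cech k (λ l → c (τ , l)) l)

  cone-point-supp : ∀ k c → Supp (spread (TG (suc k))) (cone-point k c)
  cone-point-supp k c (τ , l) e =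
    trans (cong (_ *_) (trans (cong (λ b → bit b * _) e) (zeroˡ _))) (zeroʳ _)

  cone-point-size : ∀ k {p c} → HasSize p c → HasSize p (cone-point k c)
  cone-point-size k h τ l e =
    trans (cong (_ *_) (trans (cong (_ *_) (null (cech-linear k) (λ l → h τ l e) l)) (zeroʳ _))) (zeroʳ _)

  TG-act : ∀ k τ (p : Swap k) l → TG k τ (act p l) ≡ TG k τ l
  TG-act (suc (suc k)) τ here (σ , υ , l) =
    trans (sym (Bool.∧-assoc (F τ υ) _ _)) (trans (cong (_∧ TG k τ l) (Bool.∧-comm (F τ υ) (F τ σ))) (Bool.∧-assoc (F τ σ) _ _))
  TG-act (suc k) τ (there p) (σ , l) = cong (F τ σ ∧_) (TG-act k τ p l)

  cone-point-alternating : ∀ k c → (∀ τ → Alternating (λ l → c (τ , l))) →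
                           ∀ τ → Alternating (λ l → cone-point k c (τ , l))
  cone-point-alternating k c alt τ p l =
    trans (cong (_ *_) (trans (cong₂ (λ b a → bit b * a) (TG-act (suc k) τ p l)
                                     (cech-alternating k (λ l → c (τ , l)) (alt τ) p l))
                              (sym (neg-*ʳ _ _))))
          (sym (neg-*ʳ _ _))

  -- The resolution ends at 0-tuples, where there is no further map and hence no condition.
  Closed : ∀ k → Chain (Tup n k) → Set
  Closed zero    c = ⊤
  Closed (suc k) c = slip c ≗ 𝟘

  cancel-num : ∀ k {a} → num (suc k) * a ≡ 0ℚ → a ≡ 0ℚ
  cancel-num k {a} e =
    trans (sym (*-identityˡ a)) (trans (cong (_* a) (sym (inverse-num-* k)))
      (trans (*-assoc (inverse-num (suc k)) _ a) (trans (cong (inverse-num (suc k) *_) e) (zeroʳ _))))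

  sum-bits : ∀ τ a → sumV n (λ σ → bit (F τ σ) * a) ≡ num (countV n (F τ)) * a
  sum-bits τ a =
    trans (sumV-ext (λ σ → *-comm (bit (F τ σ)) a))
   (trans (scale (sumV-linear n) a (bit ∘ F τ) tt)
   (trans (cong (a *_) (sumV-bit n (F τ))) (*-comm a _)))

  -- The term of `cech` that omits the new entry contributes x once for each simplex over τ. In the
  -- other terms an entry of x is summed out, which gives 0: for alternating x, `slip x` is a
  -- nonzero multiple of `sumHead x`.
  sum-cech : ∀ k τ x → Supp (TG k τ) x → Alternating x → Closed k x → ∀ l →
             sumV n (λ σ → bit (F τ σ) * cech k x (σ , l)) ≡ num (countV n (F τ)) * x l
  sum-cech zero    τ x s alt closed l = sum-bits τ (x l)
  sum-cech (suc k) τ x s alt closed l =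
    trans (sumV-ext (λ σ → trans (distribˡ (bit (F τ σ)) (x l) _)
            (cong (bit (F τ σ) * x l +_) (sym (neg-*ʳ (bit (F τ σ)) (cech k (λ l → x (σ , l)) l))))))
   (trans (add (sumV-linear n) _ _ tt)
   (trans (cong₂ _+_ (sum-bits τ (x l))
            (trans (neg (sumV-linear n) _ tt) (cong -_ rest)))
          (trans (cong (num (countV n (F τ)) * x l +_) neg-0) (+-identityʳ _))))
    where
    rest : sumV n (λ σ → bit (F τ σ) * cech k (λ l → x (σ , l)) l) ≡ 0ℚ
    rest =
      trans (sumV-masked (F τ) (λ σ → cech k (λ l → x (σ , l))) l
              (λ σ e → null (cech-linear k) (λ l → s (σ , l) (cong (_∧ TG k τ l) e)) l))
     (trans (sumV-linear-comm {n} (cech-linear k) (λ σ l → x (σ , l)) l)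
            (null (cech-linear k)
              (λ l → cancel-num k (trans (sym (slip-alternating k x alt l)) (closed l))) l))

  slip-cone-point : ∀ k c → Supp (spread (TG k)) c → (∀ τ → Alternating (λ l → c (τ , l))) →
    (∀ τ → Closed k (λ l → c (τ , l))) → (∀ τ → countV n (F τ) ≡ 0 → ∀ l → c (τ , l) ≡ 0ℚ) →
    right slip (cone-point k c) ≗ c
  slip-cone-point k c s alt closed void (τ , l) =
    trans (slip-alternating k (λ l → cone-point k c (τ , l)) (cone-point-alternating k c alt τ) l)
   (trans (cong (num (suc k) *_)
            (trans (scale (sumV-linear n) _ _ tt) (cong (_ *_) (by-support (TG k τ l) refl))))
          (normalise (countV n (F τ)) refl))
    where
    x : Chain (Tup n k)
    x l = c (τ , l)
    by-support : ∀ b → TG k τ l ≡ b →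
      sumV n (λ σ → bit (F τ σ ∧ TG k τ l) * cech k x (σ , l)) ≡ num (countV n (F τ)) * x l
    by-support true eq =
      trans (sumV-ext (λ σ → cong (λ b → bit b * cech k x (σ , l))
              (trans (cong (F τ σ ∧_) eq) (Bool.∧-identityʳ _))))
            (sum-cech k τ x (λ l → s (τ , l)) (alt τ) (closed τ) l)
    by-support false eq =
      trans (sumV-zero (λ σ → trans (cong (λ b → bit b * cech k x (σ , l))
              (trans (cong (F τ σ ∧_) eq) (Bool.∧-zeroʳ _))) (zeroˡ _)))
            (sym (trans (cong (_ *_) (s (τ , l) eq)) (zeroʳ _)))
    normalise : ∀ N → countV n (F τ) ≡ N →
      num (suc k) * ((inverse-num (countV n (F τ)) * inverse-num (suc k)) * (num (countV n (F τ)) * x l)) ≡ x l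
    normalise zero eq =
      trans (cong (_ *_) (trans (cong (_ *_) (trans (cong (_ *_) (void τ eq l)) (zeroʳ _))) (zeroʳ _)))
            (trans (zeroʳ _) (sym (void τ eq l)))
    normalise (suc N) eq =
      trans (assoc-cancel _ _ _ _ _)
     (trans (cong₂ (λ a b → a * (b * x l)) (inverse-num-* k)
              (trans (cong (λ M → inverse-num M * num M) eq) (inverse-num-* N)))
            (trans (*-identityˡ _) (*-identityˡ _)))

  TG-void : ∀ k τ → countV n (F τ) ≡ 0 → ∀ l → TG (suc k) τ l ≡ false
  TG-void k τ e (σ , l) = cong (_∧ TG k τ l) (countV-zero n (F τ) e σ)

  -- The rows of the double complex are resolved by cone-point until the tuples run out
  -- of distinct entries, and the columns are exact because T k is Leray.
  module _ (d r : ℕ) (leray : Leray d m base F)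
           (bound : ∀ k → r ℕ.< k → ∀ τ (l : Tup n k) → TG k τ l ≡ true → Repeats l) where

    private
      -- The sum q + k of colours and entries is constant along the zigzag. Since k ≤ r, kd + k ≤ rd
      -- + r < q + k, and k cancels.
      enough : ∀ k t q → k ℕ.+ t ≡ r → r ℕ.* d ℕ.+ r ℕ.< q ℕ.+ k → k ℕ.* d ℕ.< q
      enough k t q refl lt = ℕ.+-cancelʳ-< k (k ℕ.* d) q (ℕ.≤-<-trans
        (ℕ.+-mono-≤ (ℕ.*-monoˡ-≤ d (ℕ.m≤m+n k t)) (ℕ.m≤m+n k t)) lt)

      exact : ∀ k q → k ℕ.* d ℕ.< q → Exact (Tot m (T k)) (spread (TG k)) q
      exact k = leray⇒total m (T-lawful k) (T-leray leray k)

    -- Neither b nor e is asked to alternate: b comes from the Leray property of the full power,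
    -- which knows nothing of symmetry, and e is itself such a filling one step further on, or zero.
    Split : ∀ k → ℕ → Chain (Cells k) → Set
    Split k q a = ∃₂ λ b e → Supp (spread (TG k)) b × HasSize (_≡ᵇ suc q) b × a ≗ D k b ⊕ right slip e

    -- `D a` is alternating and killed by `slip`, so it lifts to some a′ with one more entry and one
    -- colour less. If a′ = D b′ + slip e′, then D a = slip a′ = D (slip b′). Hence a - slip b′ is a
    -- cycle, and the Leray property of the power fills it.
    zig : ∀ t k q → suc k ℕ.+ t ≡ r → r ℕ.* d ℕ.+ r ℕ.< q ℕ.+ suc k → ∀ a →
          Supp (spread (TG (suc k))) a → HasSize (_≡ᵇ q) a →
          (∀ τ → Alternating (λ l → a (τ , l))) → right slip (D (suc k) a) ≗ 𝟘 → Split (suc k) q a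

    lift-boundary : ∀ k q a → Supp (spread (TG (suc k))) a → HasSize (_≡ᵇ suc q) a →
      (∀ τ → Alternating (λ l → a (τ , l))) → right slip (D (suc k) a) ≗ 𝟘 →
      ∃ λ a′ → Supp (spread (TG (suc (suc k)))) a′ × HasSize (_≡ᵇ q) a′ ×
               (∀ τ → Alternating (λ l → a′ (τ , l))) × right slip a′ ≗ D (suc k) a
    lift-boundary k q a s h alt closed =
      cone-point (suc k) (D (suc k) a) , cone-point-supp (suc k) _ ,
      cone-point-size (suc k) {_≡ᵇ q} {D (suc k) a} (D-size (suc k) {_≡ᵇ suc q} {a} h) ,
      cone-point-alternating (suc k) (D (suc k) a) (D-alternating (suc k) a alt) ,
      slip-cone-point (suc k) (D (suc k) a) (D-supp (suc k) s) (D-alternating (suc k) a alt)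
        (λ τ l → closed (τ , l)) (λ τ e l → D-supp (suc k) s (τ , l) (TG-void k τ e l))

    zig t k zero eq lt a s h alt closed with () ← enough (suc k) t zero eq lt
    -- Here the tuples have length r. The lift consists of alternating chains on (r + 1)-tuples,
    -- which all repeat an entry, so it is zero and a itself is a cycle.
    zig zero k (suc q) eq lt a s h alt closed =
      let a′ , s′ , h′ , alt′ , slip-a′ = lift-boundary k q a s h alt closed
          b , sb , hb , Db = exact (suc k) (suc q) (enough (suc k) 0 (suc q) eq lt) a s
            (to-hom (suc k) {_≡ᵇ suc q} {a} h)
            (λ i → trans (sym (slip-a′ i)) (null (right-linear (slip-linear (suc k))) (vanishes a′ s′ alt′) i))
      in b , 𝟘 , sb , from-hom (suc k) {_≡ᵇ suc (suc q)} {b} hb ,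
         λ i → sym (trans (cong₂ _+_ (Db i) (null (right-linear (slip-linear (suc k))) (λ _ → refl) i)) (+-identityʳ _))
      where
      vanishes : ∀ a′ → Supp (spread (TG (suc (suc k)))) a′ → (∀ τ → Alternating (λ l → a′ (τ , l))) → a′ ≗ 𝟘
      vanishes a′ s′ alt′ (τ , l) = by-support (TG (suc (suc k)) τ l) refl
        where
        by-support : ∀ b → TG (suc (suc k)) τ l ≡ b → a′ (τ , l) ≡ 0ℚ
        by-support false e = s′ (τ , l) e
        by-support true  e = alternating-repeats (suc (suc k)) (λ l → a′ (τ , l)) (alt′ τ) l
          (bound (suc (suc k)) (ℕ.s≤s (ℕ.≤-reflexive (trans (sym eq) (ℕ.+-identityʳ _)))) τ l e)
    zig (suc t) k (suc q) eq lt a s h alt closed =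
      let a′ , s′ , h′ , alt′ , slip-a′ = lift-boundary k q a s h alt closed
          b′ , e′ , sb′ , hb′ , a′≗ = zig t (suc k) q (trans (sym (ℕ.+-suc (suc k) t)) eq)
            (subst (r ℕ.* d ℕ.+ r ℕ.<_) (sym (ℕ.+-suc q (suc k))) lt) a′ s′ h′ alt′
            (λ i → trans (D-slip (suc k) a′ i)
              (trans (ext (D-linear (suc k)) slip-a′ i) (∂∂ (D-lawful (suc k)) a i)))
          sb″ : Supp (spread (TG (suc k))) (right slip b′)
          sb″ = λ { (τ , l) → slip-supp (suc k) τ (λ l → b′ (τ , l)) (λ l → sb′ (τ , l)) l }
          hb″ = slip-size (suc k) {_≡ᵇ suc q} {b′} hb′
          b , sb , hb , Db = exact (suc k) (suc q) (enough (suc k) (suc t) (suc q) eq lt)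
            (a ⊖ right slip b′)
            (λ i e → add-zero (s i e) (neg-zero (sb″ i e)))
            (to-hom (suc k) {_≡ᵇ suc q} {a ⊖ right slip b′} (λ τ l e → add-zero (h τ l e) (neg-zero (hb″ τ l e))))
            (λ i → trans (sub (D-linear (suc k)) a (right slip b′) i)
              (trans (cong (λ x → x + - D (suc k) (right slip b′) i)
                       (boundary-agrees a a′ b′ e′ slip-a′ a′≗ i))
                     (-‿inverseʳ _)))
      in b , b′ , sb , from-hom (suc k) {_≡ᵇ suc (suc q)} {b} hb ,
         λ i → sym (trans (cong (_+ right slip b′ i) (Db i)) (subtract-add _ _))
      where
      boundary-agrees : ∀ a a′ b′ e′ → right slip a′ ≗ D (suc k) a → a′ ≗ D (suc (suc k)) b′ ⊕ right slip e′ →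
                        D (suc k) a ≗ D (suc k) (right slip b′)
      boundary-agrees a a′ b′ e′ slip-a′ a′≗ i =
        trans (sym (slip-a′ i))
       (trans (ext (right-linear (slip-linear (suc k))) a′≗ i)
       (trans (add (right-linear (slip-linear (suc k))) (D (suc (suc k)) b′) (right slip e′) i)
       (trans (cong₂ _+_ (D-slip (suc k) b′ i) (slip-slip (suc k) (λ l → e′ (proj₁ i , l)) (proj₂ i)))
              (+-identityʳ _))))

    -- T 0 has a cell for every subset of the colours, of which only the images of cells matter.
    fill-image : 0 ℕ.< r → ∀ q → r ℕ.* d ℕ.+ r ℕ.≤ q → (z : Chain (Cells 0)) →
      (∀ τ → countV n (F τ) ≡ 0 → z (τ , tt) ≡ 0ℚ) → HasSize (_≡ᵇ q) z → D 0 z ≗ 𝟘 →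
      ∃ λ y → (∀ τ → countV n (F τ) ≡ 0 → y (τ , tt) ≡ 0ℚ) × HasSize (_≡ᵇ suc q) y × D 0 y ≗ z
    fill-image (ℕ.s≤s {n = r′} _) q r≤q z void h cyc =
      let a = cone-point 0 z
          slip-a : right slip a ≗ z
          slip-a = slip-cone-point 0 z (λ _ ()) (λ _ ()) (λ _ → tt) (λ τ e _ → void τ e)
          b , e , sb , hb , a≗ = zig r′ 0 q refl
            (subst (r ℕ.* d ℕ.+ r ℕ.<_) (sym (ℕ.+-comm q 1)) (ℕ.s≤s r≤q)) a
            (cone-point-supp 0 z) (cone-point-size 0 {_≡ᵇ q} {z} h) (λ { τ (there ()) })
            (λ i → trans (D-slip 0 a i) (trans (ext (D-linear 0) slip-a i) (cyc i)))
      -- From a = D b + slip e, slip ∘ slip = 0 and slip a = z it follows that z = D (slip b).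
      in right slip b ,
         (λ τ e → sumV-zero (λ σ → sb (τ , σ , tt) (TG-void 0 τ e (σ , tt)))) ,
         slip-size 0 {_≡ᵇ suc q} {b} hb ,
         λ i → trans (sym (D-slip 0 b i))
              (trans (sym (+-identityʳ _))
              (trans (cong (right slip (D 1 b) i +_) (sym (slip-slip 0 (λ l → e (proj₁ i , l)) (proj₂ i))))
              (trans (sym (add (right-linear (slip-linear 0)) (D 1 b) (right slip e) i))
              (trans (ext (right-linear (slip-linear 0)) (λ k → sym (a≗ k)) i) (slip-a i)))))

-- Subsets as bit vectors

does-sound : ∀ {A : Set} (a? : Dec A) → does a? ≡ true → A
does-sound (yes a) _ = a

does-complete : ∀ {A : Set} (a? : Dec A) → A → does a? ≡ true
does-complete (yes _) _ = refl
does-complete (no ¬a) a = ⊥-elim (¬a a)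

does-false : ∀ {A : Set} (a? : Dec A) → (A → ⊥) → does a? ≡ false
does-false (yes a) ¬a = ⊥-elim (¬a a)
does-false (no _)  _  = refl

∈⇒lookup : ∀ {n} {v : Fin n} {σ} → v ∈ σ → lookup σ v ≡ true
∈⇒lookup = Vec.[]=⇒lookup

lookup⇒∈ : ∀ {n} {v : Fin n} {σ} → lookup σ v ≡ true → v ∈ σ
lookup⇒∈ {v = v} {σ} = Vec.lookup⇒[]= v σ

lookup-ext : ∀ {n} {σ τ : Subset n} → lookup σ ≗ lookup τ → σ ≡ τ
lookup-ext e = ⊆-antisym (λ {x} x∈ → lookup⇒∈ (trans (sym (e x)) (∈⇒lookup x∈)))
                         (λ {x} x∈ → lookup⇒∈ (trans (e x) (∈⇒lookup x∈)))

bool-ext : ∀ {a b : Bool} → (a ≡ true → b ≡ true) → (b ≡ true → a ≡ true) → a ≡ b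
bool-ext {true}  {true}  f g = refl
bool-ext {true}  {false} f g = sym (f refl)
bool-ext {false} {true}  f g = g refl
bool-ext {false} {false} f g = refl

insert : ∀ {n} → Fin n → Subset n → Subset n
insert v σ = σ [ v ]≔ true

lookup-insert-≡ : ∀ {n} (v : Fin n) σ → lookup (insert v σ) v ≡ true
lookup-insert-≡ v σ = Vec.lookup∘update v σ true

lookup-insert-≢ : ∀ {n} {v w : Fin n} σ → w ≢ v → lookup (insert v σ) w ≡ lookup σ w
lookup-insert-≢ σ w≢v = Vec.lookup∘update′ w≢v σ true

insert-elim : ∀ {n} {v w : Fin n} σ → lookup (insert v σ) w ≡ true → w ≡ v ⊎ lookup σ w ≡ true
insert-elim {v = v} {w} σ e with w Fin.≟ v
... | yes w≡v = inj₁ w≡v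
... | no  w≢v = inj₂ (trans (sym (lookup-insert-≢ σ w≢v)) e)

lookup-insert-mono : ∀ {n} (v : Fin n) {w} σ → lookup σ w ≡ true → lookup (insert v σ) w ≡ true
lookup-insert-mono v {w} σ e with w Fin.≟ v
... | yes refl = lookup-insert-≡ v σ
... | no  w≢v  = trans (lookup-insert-≢ σ w≢v) e

∪-insert : ∀ {n} (σ : Subset n) v → σ ∪ ⁅ v ⁆ ≡ insert v σ
∪-insert (b ∷ σ) zero    = cong₂ _∷_ (Bool.∨-zeroʳ b) (∪-identityʳ σ)
∪-insert (b ∷ σ) (suc v) = cong₂ _∷_ (Bool.∨-identityʳ b) (∪-insert σ v)

lookup-image⁻ : ∀ {n m} (f : Fin n → Fin m) σ {j} → lookup (image f σ) j ≡ true →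
                ∃ λ v → lookup σ v ≡ true × f v ≡ j
lookup-image⁻ f σ e with v , v∈σ , fv≡j ← ∈-image⁻ f {σ} (lookup⇒∈ e) = v , ∈⇒lookup v∈σ , fv≡j

lookup-image⁺ : ∀ {n m} (f : Fin n → Fin m) σ {v} → lookup σ v ≡ true → lookup (image f σ) (f v) ≡ true
lookup-image⁺ f σ e = ∈⇒lookup (∈-image⁺ f {σ} (lookup⇒∈ e))

lookup-image-false : ∀ {n m} (f : Fin n → Fin m) σ {v j} → lookup (image f σ) j ≡ false →
                     f v ≡ j → lookup σ v ≡ false
lookup-image-false f σ {v} e refl with lookup σ v in eq
... | false = refl
... | true  = true≢false (lookup-image⁺ f σ eq) e

image-insert : ∀ {n m} (f : Fin n → Fin m) σ v → image f (insert v σ) ≡ insert (f v) (image f σ)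
image-insert f σ v = lookup-ext λ j → bool-ext (to j) (from j)
  where
  to : ∀ j → lookup (image f (insert v σ)) j ≡ true → lookup (insert (f v) (image f σ)) j ≡ true
  to j e with w , w∈ , refl ← lookup-image⁻ f (insert v σ) e with insert-elim σ w∈
  ... | inj₁ refl = lookup-insert-≡ (f v) (image f σ)
  ... | inj₂ w∈σ = lookup-insert-mono (f v) (image f σ) (lookup-image⁺ f σ w∈σ)
  from : ∀ j → lookup (insert (f v) (image f σ)) j ≡ true → lookup (image f (insert v σ)) j ≡ true
  from j e with insert-elim (image f σ) e
  ... | inj₁ refl = lookup-image⁺ f (insert v σ) (lookup-insert-≡ v σ)
  ... | inj₂ j∈ with w , w∈σ , refl ← lookup-image⁻ f σ j∈ =
    lookup-image⁺ f (insert v σ) (lookup-insert-mono v σ w∈σ)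

InjectiveOn : ∀ {n m} → (Fin n → Fin m) → Subset n → Set
InjectiveOn f σ = ∀ v w → lookup σ v ≡ true → lookup σ w ≡ true → f v ≡ f w → v ≡ w

image-false-∷ : ∀ {n m} (f : Fin (suc n) → Fin m) σ → image f (false ∷ σ) ≡ image (f ∘ suc) σ
image-false-∷ f σ = lookup-ext λ j → bool-ext (to j) (from j)
  where
  to : ∀ j → lookup (image f (false ∷ σ)) j ≡ true → lookup (image (f ∘ suc) σ) j ≡ true
  to j e with lookup-image⁻ f (false ∷ σ) e
  ... | suc v , v∈ , refl = lookup-image⁺ (f ∘ suc) σ v∈
  from : ∀ j → lookup (image (f ∘ suc) σ) j ≡ true → lookup (image f (false ∷ σ)) j ≡ true
  from j e with v , v∈ , refl ← lookup-image⁻ (f ∘ suc) σ e = lookup-image⁺ f (false ∷ σ) v∈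

-- Weighted sums cover both sizes and the exponents of the signs, so invariance under an injective
-- image is proved once for all of them.
weigh : ∀ {n} → (Fin n → ℕ) → Subset n → ℕ
weigh h []      = 0
weigh h (b ∷ σ) = (if b then h zero else 0) ℕ.+ weigh (h ∘ suc) σ

weigh-cong : ∀ {n} {g h : Fin n → ℕ} → g ≗ h → ∀ σ → weigh g σ ≡ weigh h σ
weigh-cong e []          = refl
weigh-cong e (false ∷ σ) = weigh-cong (e ∘ suc) σ
weigh-cong e (true  ∷ σ) = cong₂ ℕ._+_ (e zero) (weigh-cong (e ∘ suc) σ)

weigh-empty : ∀ {n} (h : Fin n → ℕ) σ → (∀ v → lookup σ v ≡ false) → weigh h σ ≡ 0
weigh-empty h []          e = refl
weigh-empty h (false ∷ σ) e = weigh-empty (h ∘ suc) σ (e ∘ suc)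
weigh-empty h (true  ∷ σ) e = true≢false refl (e zero)

weigh-zero : ∀ {n} (σ : Subset n) → weigh (λ _ → 0) σ ≡ 0
weigh-zero []          = refl
weigh-zero (false ∷ σ) = weigh-zero σ
weigh-zero (true  ∷ σ) = weigh-zero σ

weigh-insert : ∀ {n} (h : Fin n → ℕ) σ v → lookup σ v ≡ false → weigh h (insert v σ) ≡ h v ℕ.+ weigh h σ
weigh-insert h (false ∷ σ) zero    e = refl
weigh-insert h (b ∷ σ)     (suc v) e =
  trans (cong ((if b then h zero else 0) ℕ.+_) (weigh-insert (h ∘ suc) σ v e))
        (swap-+ (if b then h zero else 0) (h (suc v)) _)
  where
  swap-+ : ∀ a b c → a ℕ.+ (b ℕ.+ c) ≡ b ℕ.+ (a ℕ.+ c)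
  swap-+ a b c = trans (sym (ℕ.+-assoc a b c)) (trans (cong (ℕ._+ c) (ℕ.+-comm a b)) (ℕ.+-assoc b a c))

weigh-image : ∀ {n m} (f : Fin n → Fin m) (h : Fin m → ℕ) σ → InjectiveOn f σ →
              weigh h (image f σ) ≡ weigh (h ∘ f) σ
weigh-image f h [] inj = weigh-empty h (image f []) no-element
  where
  no-element : ∀ j → lookup (image f []) j ≡ false
  no-element j with lookup (image f []) j in eq
  ... | false = refl
  ... | true with () , _ ← lookup-image⁻ f [] eq
weigh-image f h (false ∷ σ) inj =
  trans (cong (weigh h) (image-false-∷ f σ))
        (weigh-image (f ∘ suc) h σ λ v w v∈ w∈ e → Fin.suc-injective (inj (suc v) (suc w) v∈ w∈ e))
weigh-image f h (true ∷ σ) inj =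
  trans (cong (weigh h) (trans (image-insert f (false ∷ σ) zero) (cong (insert (f zero)) (image-false-∷ f σ))))
 (trans (weigh-insert h (image (f ∘ suc) σ) (f zero) fresh)
        (cong (h (f zero) ℕ.+_)
          (weigh-image (f ∘ suc) h σ λ v w v∈ w∈ e → Fin.suc-injective (inj (suc v) (suc w) v∈ w∈ e))))
  where
  fresh : lookup (image (f ∘ suc) σ) (f zero) ≡ false
  fresh with lookup (image (f ∘ suc) σ) (f zero) in eq
  ... | false = refl
  ... | true with v , v∈ , e ← lookup-image⁻ (f ∘ suc) σ eq with () ← inj (suc v) zero v∈ refl e

one : Bool → ℕ
one b = if b then 1 else 0

size-weigh : ∀ {n} (σ : Subset n) → ∣ σ ∣ ≡ weigh (λ _ → 1) σ
size-weigh []          = refl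
size-weigh (false ∷ σ) = size-weigh σ
size-weigh (true  ∷ σ) = cong suc (size-weigh σ)

size-image : ∀ {n m} (f : Fin n → Fin m) σ → InjectiveOn f σ → ∣ image f σ ∣ ≡ ∣ σ ∣
size-image f σ inj = trans (size-weigh (image f σ))
                           (trans (weigh-image f (λ _ → 1) σ inj) (sym (size-weigh σ)))

less : ∀ {n} → Fin n → Fin n → Bool
less i j = Fin.toℕ i <ᵇ Fin.toℕ j

size-∩-tabulate : ∀ {n} (P : Fin n → Bool) σ → ∣ σ ∩ tabulate P ∣ ≡ weigh (one ∘ P) σ
size-∩-tabulate P []          = refl
size-∩-tabulate P (false ∷ σ) = size-∩-tabulate (P ∘ suc) σ
size-∩-tabulate P (true  ∷ σ) with P zero
... | true  = cong suc (size-∩-tabulate (P ∘ suc) σ)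
... | false = size-∩-tabulate (P ∘ suc) σ

position-weigh : ∀ {n} (v : Fin n) σ → position v σ ≡ weigh (λ w → one (less w v)) σ
position-weigh v σ =
  trans (size-∩-tabulate (λ w → ⌊ w Fin.<? v ⌋) σ)
        (weigh-cong (λ w → cong one (isYes≗does (w Fin.<? v))) σ)

faceSign-weigh : ∀ {N} (j : Fin N) τ → faceSign j τ ≡ sgn (weigh (λ i → one (less j i)) τ)
faceSign-weigh zero    (false ∷ τ) = cong sgn (size-weigh τ)
faceSign-weigh zero    (true  ∷ τ) = cong sgn (size-weigh τ)
faceSign-weigh (suc j) (false ∷ τ) = faceSign-weigh j τ
faceSign-weigh (suc j) (true  ∷ τ) = faceSign-weigh j τ

below-above : ∀ {n} (j : Fin n) τ → lookup τ j ≡ false →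
              weigh (λ i → one (less i j)) τ ℕ.+ weigh (λ i → one (less j i)) τ ≡ ∣ τ ∣
below-above zero    (false ∷ τ) e = trans (cong (ℕ._+ weigh (λ _ → 1) τ) (weigh-zero τ)) (sym (size-weigh τ))
below-above (suc j) (false ∷ τ) e = below-above j τ e
below-above (suc j) (true  ∷ τ) e = cong suc (below-above j τ e)

sgn-+ : ∀ a b → sgn (a ℕ.+ b) ≡ sgn a * sgn b
sgn-+ zero    b = sym (*-identityˡ _)
sgn-+ (suc a) b = trans (cong -_ (sgn-+ a b)) (sym (neg-*ˡ (sgn a) (sgn b)))

sgn-cancel : ∀ n a → sgn n * (sgn n * a) ≡ a
sgn-cancel n a = trans (sym (*-assoc (sgn n) (sgn n) a))
                       (trans (cong (_* a) (sgn-square n)) (*-identityˡ a))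

-- The elements below j and those above j add up to |τ|, so counting from below and counting from
-- above differ by the sign of |τ|.
position-sign : ∀ {n} (j : Fin n) τ → lookup τ j ≡ false → sgn (position j τ) ≡ sgn ∣ τ ∣ * faceSign j τ
position-sign j τ e =
  trans (cong sgn (position-weigh j τ))
 (trans (sym (sgn-cancel above′ _))
 (trans (cong (sgn above′ *_) (trans (*-comm (sgn above′) _) (trans (sym (sgn-+ below′ above′)) (cong sgn (below-above j τ e)))))
 (trans (*-comm (sgn above′) _) (cong (sgn ∣ τ ∣ *_) (sym (faceSign-weigh j τ))))))
  where
  below′ above′ : ℕ
  below′ = weigh (λ i → one (less i j)) τ
  above′ = weigh (λ i → one (less j i)) τ

-- Pairs of vertices in increasing order of both vertex and colour; their parity compares the
-- orientation of a simplex by its vertices with the reversed one by its colours.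
concordance : ∀ {n m} → (Fin n → Fin m) → Subset n → ℕ
concordance f []      = 0
concordance f (b ∷ σ) =
  (if b then weigh (λ w → one (less (f zero) (f (suc w)))) σ else 0) ℕ.+ concordance (f ∘ suc) σ

less-asym : ∀ {n} (i j : Fin n) → i ≢ j → sgn (one (less i j)) ≡ - sgn (one (less j i))
less-asym zero    zero    i≢j = ⊥-elim (i≢j refl)
less-asym zero    (suc j) i≢j = refl
less-asym (suc i) zero    i≢j = sym (neg-neg 1ℚ)
less-asym (suc i) (suc j) i≢j = less-asym i j (i≢j ∘ cong suc)

opaque
  unfolding _+_ _*_ -_

  regroup-signs : ∀ g x c d → ((g * x) * c) * (x * d) ≡ (x * x) * g * (c * d)
  regroup-signs = solve-∀ ℚ-ring

  move-sign : ∀ s a b → 1ℚ * (- s) * (a * b) ≡ - a * (s * b)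
  move-sign = solve-∀ ℚ-ring

-- The new pairs are the w with w < v and f w < f v, and those with w > v and f w > f v. Modulo 2
-- their number is #(w < v) + #(f w > f v), because the w with w < v and f w > f v are counted twice
-- in this sum; `fresh` excludes ties.
concordance-insert : ∀ {n m} (f : Fin n → Fin m) σ v → lookup σ v ≡ false →
  (∀ w → lookup σ w ≡ true → f w ≢ f v) →
  sgn (concordance f (insert v σ)) * sgn (concordance f σ) ≡
  sgn (weigh (λ w → one (less w v)) σ) * sgn (weigh (λ w → one (less (f v) (f w))) σ)
concordance-insert f (false ∷ σ) zero e fresh =
  trans (cong (_* sgn (concordance (f ∘ suc) σ)) (sgn-+ (weigh (λ w → one (less (f zero) (f (suc w)))) σ) _))
 (trans (*-assoc _ _ _)
 (trans (cong (sgn (weigh (λ w → one (less (f zero) (f (suc w)))) σ) *_) (sgn-square (concordance (f ∘ suc) σ)))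
 (trans (*-comm _ _) (cong (λ a → sgn a * sgn (weigh (λ w → one (less (f zero) (f (suc w)))) σ)) (sym (weigh-zero σ))))))
concordance-insert f (false ∷ σ) (suc v) e fresh = concordance-insert (f ∘ suc) σ v e (fresh ∘ suc)
concordance-insert f (true ∷ σ) (suc v) e fresh =
  trans (cong₂ _*_
          (trans (cong (λ a → sgn (a ℕ.+ concordance (f ∘ suc) (insert v σ))) (weigh-insert g σ v e))
                 (trans (sgn-+ (g v ℕ.+ weigh g σ) _) (cong (_* sgn (concordance (f ∘ suc) (insert v σ))) (sgn-+ (g v) (weigh g σ)))))
          (sgn-+ (weigh g σ) _))
 (trans (regroup-signs (sgn (g v)) (sgn (weigh g σ)) _ _)
 (trans (cong₂ (λ s t → s * sgn (g v) * t) (sgn-square (weigh g σ)) (concordance-insert (f ∘ suc) σ v e (fresh ∘ suc)))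
 (trans (cong (λ s → 1ℚ * s * (lower * upper)) (less-asym (f zero) (f (suc v)) (fresh zero refl)))
 (trans (move-sign (sgn (one (less (f (suc v)) (f zero)))) _ _)
        (cong (- sgn (weigh (λ w → one (less w v)) σ) *_)
          (sym (sgn-+ (one (less (f (suc v)) (f zero))) _)))))))
  where
  g : Fin _ → ℕ
  g w = one (less (f zero) (f (suc w)))
  lower upper : ℚ
  lower = sgn (weigh (λ w → one (less w v)) σ)
  upper = sgn (weigh (λ w → one (less (f (suc v)) (f (suc w)))) σ)

-- The cube of a complex with coloured vertices

open RawMonoidDefs ℚ.+-0-rawMonoid using () renaming (sum to sumℚ)

sum-zero : ∀ {n} {x : Fin n → ℚ} → (∀ v → x v ≡ 0ℚ) → sum x ≡ 0ℚ
sum-zero {n} e = trans (sum-cong-≗ e) (sum-replicate-zero n)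

sum-single : ∀ {n} (x : Fin n → ℚ) v → (∀ w → w ≢ v → x w ≡ 0ℚ) → sum x ≡ x v
sum-single x zero    e = trans (cong (x zero +_) (sum-zero (λ w → e (suc w) λ ()))) (+-identityʳ _)
sum-single x (suc v) e =
  trans (cong₂ _+_ (e zero λ ()) (sum-single (x ∘ suc) v (λ w w≢v → e (suc w) (w≢v ∘ Fin.suc-injective))))
        (+-identityˡ _)

sum-scale : ∀ {n} a (x : Fin n → ℚ) → sum (λ v → a * x v) ≡ a * sum x
sum-scale {zero}  a x = sym (zeroʳ a)
sum-scale {suc n} a x = trans (cong (a * x zero +_) (sum-scale a (x ∘ suc))) (sym (distribˡ a _ _))

sumV-sum : ∀ {n k} (x : Vec Bool n → Fin k → ℚ) →
           sumV n (λ σ → sum (x σ)) ≡ sum (λ v → sumV n (λ σ → x σ v))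
sumV-sum {n} {zero}  x = sumV-zero {n} (λ _ → refl)
sumV-sum {n} {suc k} x =
  trans (add (sumV-linear n) _ _ tt) (cong (sumV n (λ σ → x σ zero) +_) (sumV-sum (λ σ → x σ ∘ suc)))

∈?-lookup : ∀ {n} (v : Fin n) σ → ⌊ v ∈? σ ⌋ ≡ lookup σ v
∈?-lookup v σ = trans (isYes≗does (v ∈? σ))
  (bool-ext (λ e → ∈⇒lookup (does-sound (v ∈? σ) e)) (λ e → does-complete (v ∈? σ) (lookup⇒∈ e)))

opaque
  unfolding _+_ _*_ -_

  sumℚ≡sum : ∀ {n} (x : Fin n → ℚ) → sumℚ x ≡ sum x
  sumℚ≡sum {zero}  x = refl
  sumℚ≡sum {suc n} x = cong (x zero +_) (sumℚ≡sum (x ∘ suc))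

  sign≡sgn : ∀ k → sign k ≡ sgn k
  sign≡sgn zero    = refl
  sign≡sgn (suc k) = cong -_ (sign≡sgn k)

  ∂-sum : ∀ {n} (c : Chains n) τ →
          Defs.∂ c τ ≡ sum (λ v → if lookup τ v then 0ℚ else sgn (position v τ) * c (insert v τ))
  ∂-sum {n} c τ = trans (sumℚ≡sum summand) (sum-cong-≗ {x = summand} {y = summand′} term)
    where
    summand summand′ : Fin n → ℚ
    summand v = if ⌊ v ∈? τ ⌋ then 0ℚ else sign (position v τ) ℚ.* c (τ ∪ ⁅ v ⁆)
    summand′ v = if lookup τ v then 0ℚ else sgn (position v τ) * c (insert v τ)
    term : summand ≗ summand′
    term v rewrite ∈?-lookup v τ | sign≡sgn (position v τ) | ∪-insert τ v = refl

if-scale : ∀ b {x y : ℚ} a → (b ≡ false → x ≡ a * y) → (if b then 0ℚ else x) ≡ a * (if b then 0ℚ else y)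
if-scale true  a e = sym (zeroʳ a)
if-scale false a e = e refl

module Coloured {n m : ℕ} (π : Fin n → Fin m) (X : Complex n)
                (inj : ∀ {σ} → Simplex X σ → InjectiveOn π σ) where

  _≟ⱽ_ : ∀ {k} (σ τ : Subset k) → Dec (σ ≡ τ)
  _≟ⱽ_ = Vec.≡-dec Bool._≟_

  rem : Fin m → Subset n → Subset n
  rem j σ = tabulate (λ v → lookup σ v ∧ not (does (π v Fin.≟ j)))

  lookup-rem : ∀ j σ v → lookup (rem j σ) v ≡ lookup σ v ∧ not (does (π v Fin.≟ j))
  lookup-rem j σ v = Vec.lookup∘tabulate _ v

  rem-comm : ∀ i j σ → rem i (rem j σ) ≡ rem j (rem i σ)
  rem-comm i j σ = Vec.tabulate-cong λ v →
    trans (cong (_∧ not (does (π v Fin.≟ i))) (lookup-rem j σ v))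
   (trans (Bool.∧-assoc (lookup σ v) _ _)
   (trans (cong (lookup σ v ∧_) (Bool.∧-comm (not (does (π v Fin.≟ j))) _))
   (trans (sym (Bool.∧-assoc (lookup σ v) _ _))
          (cong (_∧ not (does (π v Fin.≟ j))) (sym (lookup-rem i σ v))))))

  lookup-rem⁻ : ∀ j σ v → lookup (rem j σ) v ≡ true → lookup σ v ≡ true × π v ≢ j
  lookup-rem⁻ j σ v e with lookup σ v | π v Fin.≟ j | trans (sym (lookup-rem j σ v)) e
  ... | true | no πv≢j | _ = refl , πv≢j

  lookup-rem⁺ : ∀ j σ v → lookup σ v ≡ true → π v ≢ j → lookup (rem j σ) v ≡ true
  lookup-rem⁺ j σ v e πv≢j =
    trans (lookup-rem j σ v) (cong₂ (λ a b → a ∧ not b) e (does-false (π v Fin.≟ j) πv≢j))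

  image-rem : ∀ j σ → image π (rem j σ) ≡ image π σ [ j ]≔ false
  image-rem j σ = lookup-ext λ i → bool-ext (to i) (from i)
    where
    to : ∀ i → lookup (image π (rem j σ)) i ≡ true → lookup (image π σ [ j ]≔ false) i ≡ true
    to i e with v , v∈ , refl ← lookup-image⁻ π (rem j σ) e with v∈σ , πv≢j ← lookup-rem⁻ j σ v v∈ =
      trans (Vec.lookup∘update′ πv≢j (image π σ) false) (lookup-image⁺ π σ v∈σ)
    from : ∀ i → lookup (image π σ [ j ]≔ false) i ≡ true → lookup (image π (rem j σ)) i ≡ true
    from i e with i Fin.≟ j
    ... | yes refl = true≢false e (Vec.lookup∘update j (image π σ) false)
    ... | no i≢j with v , v∈σ , refl ← lookup-image⁻ π σ (trans (sym (Vec.lookup∘update′ i≢j (image π σ) false)) e) =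
      lookup-image⁺ π (rem j σ) (lookup-rem⁺ j σ v v∈σ i≢j)

  F : Colouring m (Subset n)
  F τ σ = does (simplex? X σ ×-dec (image π σ ≟ⱽ τ))

  F-sound : ∀ τ σ → F τ σ ≡ true → Simplex X σ × image π σ ≡ τ
  F-sound τ σ = does-sound (simplex? X σ ×-dec (image π σ ≟ⱽ τ))

  F-complete : ∀ τ σ → Simplex X σ → image π σ ≡ τ → F τ σ ≡ true
  F-complete τ σ s e = does-complete (simplex? X σ ×-dec (image π σ ≟ⱽ τ)) (s , e)

  F-rem : ∀ j τ σ → F τ σ ≡ true → F (τ [ j ]≔ false) (rem j σ) ≡ true
  F-rem j τ σ e with s , refl ← F-sound τ σ e =
    F-complete _ (rem j σ)
      (down X (λ {v} v∈ → lookup⇒∈ (proj₁ (lookup-rem⁻ j σ v (∈⇒lookup v∈)))) s) (image-rem j σ)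

  open Powers rem rem-comm F F-rem using (base; base-lawful; base-respectful)

  orient : Subset n → ℚ
  orient σ = sgn (concordance π σ)

  -- Places each simplex over its own colour set. `orient` passes from the orientation by vertices
  -- to the one by colours that the total complex uses.
  hat : Chains n → Chain (Vec Bool m × Subset n)
  hat b (τ , σ) = bit (does (image π σ ≟ⱽ τ)) * (orient σ * b σ)

  orient-insert : ∀ σ v → lookup σ v ≡ false → Simplex X (insert v σ) →
    sgn (position v σ) ≡ orient σ * (faceSign (π v) (image π σ) * orient (insert v σ))
  orient-insert σ v e s =
    trans (sym (sgn-cancel (concordance π σ) _))
          (cong (orient σ *_)
            (trans (sym (sgn-cancel (weigh (λ i → one (less (π v) i)) (image π σ)) _))
                   (cong₂ _*_ (sym (faceSign-weigh (π v) (image π σ)))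
                     (trans (rotate _ _ _)
                     (trans (cong₂ (λ a b → (sgn a * sgn b) * orient σ) (position-weigh v σ)
                              (weigh-image π (λ i → one (less (π v) i)) σ (inj (down X below s))))
                     (trans (cong (_* orient σ) (sym (concordance-insert π σ v e fresh)))
                     (trans (*-assoc (orient (insert v σ)) _ _)
                     (trans (cong (orient (insert v σ) *_) (sgn-square (concordance π σ))) (*-identityʳ _)))))))))
    where
    rotate : ∀ a b c → a * (b * c) ≡ (c * a) * b
    rotate a b c = trans (cong (a *_) (*-comm b c)) (trans (sym (*-assoc a c b)) (cong (_* b) (*-comm a c)))
    below : σ ⊆ insert v σ
    below x∈ = lookup⇒∈ (lookup-insert-mono v σ (∈⇒lookup x∈))
    fresh : ∀ w → lookup σ w ≡ true → π w ≢ π v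
    fresh w w∈ πw≡πv with inj s w v (lookup-insert-mono v σ w∈) (lookup-insert-≡ v σ) πw≡πv
    ... | refl = true≢false w∈ e

  module _ (b : Chains n) (b-supp : ∀ σ → ¬ Simplex X σ → b σ ≡ 0ℚ) (σ : Subset n) where

    private
      τ : Subset m
      τ = image π σ

      g : Subset n → ℚ
      g υ = orient υ * b υ

      g-supp : ∀ υ → ¬ Simplex X υ → g υ ≡ 0ℚ
      g-supp υ ∉X = trans (cong (orient υ *_) (b-supp υ ∉X)) (zeroʳ _)

      term : Fin n → ℚ
      term v = if lookup σ v then 0ℚ else faceSign (π v) τ * g (insert v σ)

      over : Fin m → Fin n → ℚ
      over j v = bit (does (π v Fin.≟ j)) * term v

      lifts : Subset n → Fin m → Fin n → ℚ
      lifts υ j v = bit (does (π v Fin.≟ j)) * kronecker (insert v σ) υ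

      -- υ restricts to σ and has the colour j besides iff it is σ with one vertex added.
      count-lifts : ∀ j → lookup τ j ≡ false → ∀ υ → Simplex X υ →
        kronecker (rem j υ) σ * bit (does (image π υ ≟ⱽ insert j τ)) ≡ sum (lifts υ j)
      count-lifts j j∉τ υ υ∈X with Fin.any? (λ v → (π v Fin.≟ j) ×-dec (insert v σ ≟ⱽ υ))
      ... | yes (v , refl , refl) =
        trans (cong₂ _*_ (trans (cong (λ ρ → kronecker ρ σ) removed) (kronecker-refl σ))
                         (cong bit (does-complete (image π (insert v σ) ≟ⱽ insert (π v) τ) (image-insert π σ v))))
       (trans (cong₂ _*_ (cong bit (sym (does-complete (π v Fin.≟ π v) refl))) (sym (kronecker-refl (insert v σ))))
              (sym (sum-single (lifts (insert v σ) (π v)) v others)))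
        where
        removed : rem (π v) (insert v σ) ≡ σ
        removed = lookup-ext λ w → bool-ext (to w) (from w)
          where
          to : ∀ w → lookup (rem (π v) (insert v σ)) w ≡ true → lookup σ w ≡ true
          to w e with w∈ , πw≢ ← lookup-rem⁻ (π v) (insert v σ) w e with insert-elim σ w∈
          ... | inj₁ refl = ⊥-elim (πw≢ refl)
          ... | inj₂ w∈σ = w∈σ
          from : ∀ w → lookup σ w ≡ true → lookup (rem (π v) (insert v σ)) w ≡ true
          from w e = lookup-rem⁺ (π v) (insert v σ) w (lookup-insert-mono v σ e)
            λ πw≡πv → true≢false e (lookup-image-false π σ j∉τ πw≡πv)
        others : ∀ w → w ≢ v → lifts (insert v σ) (π v) w ≡ 0ℚ
        others w w≢v with π w Fin.≟ π v
        ... | no _ = zeroˡ _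
        ... | yes πw≡πv = trans (*-identityˡ _) (kronecker-≢ (insert w σ) (insert v σ) λ eq →
          w≢v (inj υ∈X w v (trans (cong (λ ρ → lookup ρ w) (sym eq)) (lookup-insert-≡ w σ))
                           (lookup-insert-≡ v σ) πw≡πv))
      ... | no none = trans left-zero (sym (sum-zero all-zero))
        where
        all-zero : ∀ v → lifts υ j v ≡ 0ℚ
        all-zero v with π v Fin.≟ j
        ... | no _ = zeroˡ _
        ... | yes πv≡j = trans (*-identityˡ _) (kronecker-≢ (insert v σ) υ λ eq → none (v , πv≡j , eq))
        left-zero : kronecker (rem j υ) σ * bit (does (image π υ ≟ⱽ insert j τ)) ≡ 0ℚ
        left-zero with rem j υ ≟ⱽ σ
        ... | no rem≢ = trans (cong (_* bit (does (image π υ ≟ⱽ insert j τ))) (kronecker-≢ (rem j υ) σ rem≢)) (zeroˡ _)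
        ... | yes rem≡ with image π υ ≟ⱽ insert j τ
        ... | no _ = zeroʳ _
        ... | yes image≡ with v , v∈υ , πv≡j ← lookup-image⁻ π υ
                (trans (cong (λ ρ → lookup ρ j) image≡) (lookup-insert-≡ j τ)) =
          ⊥-elim (none (v , πv≡j , lookup-ext λ w → bool-ext (to w) (from w)))
          where
          to : ∀ w → lookup (insert v σ) w ≡ true → lookup υ w ≡ true
          to w e with insert-elim σ e
          ... | inj₁ refl = v∈υ
          ... | inj₂ w∈σ = proj₁ (lookup-rem⁻ j υ w (trans (cong (λ ρ → lookup ρ w) rem≡) w∈σ))
          from : ∀ w → lookup υ w ≡ true → lookup (insert v σ) w ≡ true
          from w e with π w Fin.≟ j
          ... | yes πw≡j with refl ← inj υ∈X w v e v∈υ (trans πw≡j (sym πv≡j)) = lookup-insert-≡ v σ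
          ... | no πw≢j = lookup-insert-mono v σ
            (trans (cong (λ ρ → lookup ρ w) (sym rem≡)) (lookup-rem⁺ j υ w e πw≢j))

      push-lifts : ∀ j → lookup τ j ≡ false →
        push (rem j) (λ υ → hat b (insert j τ , υ)) σ ≡ sum (λ v → bit (does (π v Fin.≟ j)) * g (insert v σ))
      push-lifts j j∉τ =
        trans (sumV-ext summand)
       (trans (sumV-sum (λ υ v → lifts υ j v * g υ))
              (sum-cong-≗ λ v → trans (sumV-ext {n} (λ υ → *-assoc (bit (does (π v Fin.≟ j))) (kronecker (insert v σ) υ) (g υ)))
                (trans (scale (sumV-linear n) (bit (does (π v Fin.≟ j))) (λ υ → kronecker (insert v σ) υ * g υ) tt)
                       (cong (bit (does (π v Fin.≟ j)) *_) (sumV-kronecker (insert v σ) g)))))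
        where
        summand : ∀ υ → kronecker (rem j υ) σ * hat b (insert j τ , υ) ≡ sum (λ v → lifts υ j v * g υ)
        summand υ with simplex? X υ
        ... | yes υ∈X = trans (sym (*-assoc _ _ _)) (trans (cong (_* g υ) (count-lifts j j∉τ υ υ∈X))
              (trans (*-comm _ (g υ)) (trans (sym (sum-scale (g υ) (lifts υ j))) (sum-cong-≗ {n} λ v → *-comm (g υ) (lifts υ j v)))))
        ... | no υ∉X =
          trans (cong (kronecker (rem j υ) σ *_) (trans (cong (bit (does (image π υ ≟ⱽ insert j τ)) *_) (g-supp υ υ∉X)) (zeroʳ _)))
         (trans (zeroʳ _) (sym (sum-zero λ v → trans (cong (lifts υ j v *_) (g-supp υ υ∉X)) (zeroʳ _))))

      face-over : ∀ j → face base (hat b) τ σ j ≡ sum (over j)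
      face-over j = by-colour (lookup τ j) refl
        where
        by-colour : ∀ c → lookup τ j ≡ c →
          (if c then 0ℚ else faceSign j τ * push (rem j) (λ υ → hat b (insert j τ , υ)) σ) ≡ sum (over j)
        -- If j already occurs in σ, a further vertex of colour j cannot give a simplex, so the
        -- right-hand side vanishes as well.
        by-colour true j∈τ = sym (sum-zero vanish)
          where
          vanish : ∀ v → over j v ≡ 0ℚ
          vanish v with π v Fin.≟ j | lookup σ v in v∉σ
          ... | no _     | _     = zeroˡ _
          ... | yes _    | true  = zeroʳ _
          ... | yes refl | false with w , w∈σ , πw≡πv ← lookup-image⁻ π σ j∈τ =
            trans (*-identityˡ _) (trans (cong (faceSign (π v) τ *_) (g-supp (insert v σ) clash)) (zeroʳ _))
            where
            clash : ¬ Simplex X (insert v σ)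
            clash s with refl ← inj s w v (lookup-insert-mono v σ w∈σ) (lookup-insert-≡ v σ) πw≡πv =
              true≢false w∈σ v∉σ
        by-colour false j∉τ =
          trans (cong (faceSign j τ *_) (push-lifts j j∉τ))
         (trans (sym (sum-scale (faceSign j τ) (λ v → bit (does (π v Fin.≟ j)) * g (insert v σ)))) (sum-cong-≗ each))
          where
          each : ∀ v → faceSign j τ * (bit (does (π v Fin.≟ j)) * g (insert v σ)) ≡ over j v
          each v with π v Fin.≟ j
          ... | no _ = trans (cong (faceSign j τ *_) (zeroˡ _)) (trans (zeroʳ _) (sym (zeroˡ _)))
          ... | yes refl = trans (scale-swap (faceSign j τ) 1ℚ _)
            (cong (λ c → 1ℚ * (if c then 0ℚ else faceSign (π v) τ * g (insert v σ)))
                  (sym (lookup-image-false π σ j∉τ refl)))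

    -- Both sides run over the vertices that can be added to σ: the face of colour j collects those
    -- of colour j, and `orient-insert` matches the signs.
    ∂-hat : Defs.∂ b σ ≡ orient σ * ∂ (Tot m base) (hat b) (τ , σ)
    ∂-hat =
      trans (∂-sum b σ)
     (trans (sum-cong-≗ signs)
     (trans (sum-scale (orient σ) term)
            (cong (orient σ *_) (sym total))))
      where
      signs : ∀ v → (if lookup σ v then 0ℚ else sgn (position v σ) * b (insert v σ)) ≡ orient σ * term v
      signs v = if-scale (lookup σ v) (orient σ) sign-of
        where
        sign-of : lookup σ v ≡ false →
          sgn (position v σ) * b (insert v σ) ≡ orient σ * (faceSign (π v) τ * g (insert v σ))
        sign-of e with simplex? X (insert v σ)
        ... | yes s = trans (cong (_* b (insert v σ)) (orient-insert σ v e s))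
                     (trans (*-assoc (orient σ) _ _) (cong (orient σ *_) (*-assoc (faceSign (π v) τ) _ _)))
        ... | no ∉X = trans (trans (cong (sgn (position v σ) *_) (b-supp _ ∉X)) (zeroʳ _))
                     (sym (trans (cong (orient σ *_) (trans (cong (faceSign (π v) τ *_) (g-supp _ ∉X)) (zeroʳ _))) (zeroʳ _)))
      total : ∂ (Tot m base) (hat b) (τ , σ) ≡ sum term
      total =
        trans (Tot-∂ m base-lawful (hat b) τ σ)
       (trans (cong₂ _+_ (zeroʳ (sgn ∣ τ ∣)) (sum-cong-≗ face-over))
       (trans (+-identityˡ _)
       (trans (∑-comm over)
              (sum-cong-≗ λ v → trans (sum-single (λ j → over j v) (π v)
                  (λ j j≢ → trans (cong (λ c → bit c * term v) (does-false (π v Fin.≟ j) (j≢ ∘ sym))) (zeroˡ _)))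
                (trans (cong (λ c → bit c * term v) (does-complete (π v Fin.≟ π v) refl)) (*-identityˡ _))))))

-- From simplicial complexes to cubes and back

within-sound : ∀ {N} (S τ : Vec Bool N) → within S τ ≡ true → ∀ j → lookup τ j ≡ true → lookup S j ≡ true
within-sound (true  ∷ S) (b     ∷ τ) e zero    j∈ = refl
within-sound (false ∷ S) (true  ∷ τ) () zero   j∈
within-sound (s     ∷ S) (false ∷ τ) e (suc j) j∈ = within-sound S τ e j j∈
within-sound (true  ∷ S) (true  ∷ τ) e (suc j) j∈ = within-sound S τ e j j∈

within-complete : ∀ {N} (S τ : Vec Bool N) → (∀ j → lookup τ j ≡ true → lookup S j ≡ true) → within S τ ≡ true
within-complete []      []          h = refl
within-complete (s ∷ S) (false ∷ τ) h = within-complete S τ (h ∘ suc)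
within-complete (s ∷ S) (true  ∷ τ) h = cong₂ _∧_ (h zero refl) (within-complete S τ (h ∘ suc))

dim-suc : ∀ s {k} → (ℤ.+ s) ℤ.- (ℤ.+ 1) ≡ ℤ.+ k → s ≡ suc k
dim-suc zero    ()
dim-suc (suc s) e = cong suc (ℤ.+-injective e)

suc-dim : ∀ {s k} → s ≡ suc k → (ℤ.+ s) ℤ.- (ℤ.+ 1) ≡ ℤ.+ k
suc-dim refl = refl

countV-empty : ∀ n (P : Vec Bool n → Bool) → (∀ σ → P σ ≡ false) → countV n P ≡ 0
countV-empty zero    P e = cong one (e [])
countV-empty (suc n) P e = cong₂ ℕ._+_ (countV-empty n _ (λ σ → e (false ∷ σ))) (countV-empty n _ (λ σ → e (true ∷ σ)))

by-nonzero : ∀ {a : ℚ} → (a ≢ 0ℚ → ⊥) → a ≡ 0ℚ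
by-nonzero {a} = decidable-stable (a ℚ.≟ 0ℚ)

-- `countV` serves the averaging; the pigeonhole principle and the cardinality of fibres need an
-- explicit bijection with `Fin k`.
Enumeration : ∀ {n} → (Vec Bool n → Bool) → Set
Enumeration {n} P = ∃ λ k → ∃ λ (e : Fin k → Vec Bool n) →
  (∀ a b → e a ≡ e b → a ≡ b) × (∀ a → P (e a) ≡ true) × (∀ σ → P σ ≡ true → ∃ λ a → e a ≡ σ)

enumerate : ∀ n (P : Vec Bool n → Bool) → Enumeration P
enumerate zero P with P [] in eq
... | true  = 1 , (λ _ → []) , (λ { zero zero _ → refl }) , (λ _ → eq) , λ { [] _ → zero , refl }
... | false = 0 , (λ ()) , (λ ()) , (λ ()) , λ { [] e → true≢false e eq }
enumerate (suc n) P
  with k₀ , e₀ , inj₀ , in₀ , all₀ ← enumerate n (P ∘ (false ∷_))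
     | k₁ , e₁ , inj₁′ , in₁ , all₁ ← enumerate n (P ∘ (true ∷_)) =
  k₀ ℕ.+ k₁ , e ∘ Fin.splitAt k₀ , injective ,
  (λ a → member (Fin.splitAt k₀ a)) , λ { (false ∷ σ) → covers-false σ ; (true ∷ σ) → covers-true σ }
  where
  e : Fin k₀ ⊎ Fin k₁ → Vec Bool (suc n)
  e (inj₁ a) = false ∷ e₀ a
  e (inj₂ b) = true ∷ e₁ b
  e-injective : ∀ x y → e x ≡ e y → x ≡ y
  e-injective (inj₁ a) (inj₁ b) eq = cong inj₁ (inj₀ a b (Vec.∷-injectiveʳ eq))
  e-injective (inj₂ a) (inj₂ b) eq = cong inj₂ (inj₁′ a b (Vec.∷-injectiveʳ eq))
  injective : ∀ a b → e (Fin.splitAt k₀ a) ≡ e (Fin.splitAt k₀ b) → a ≡ b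
  injective a b eq = trans (sym (Fin.join-splitAt k₀ k₁ a))
    (trans (cong (Fin.join k₀ k₁) (e-injective (Fin.splitAt k₀ a) (Fin.splitAt k₀ b) eq)) (Fin.join-splitAt k₀ k₁ b))
  member : ∀ x → P (e x) ≡ true
  member (inj₁ a) = in₀ a
  member (inj₂ b) = in₁ b
  covers-false : ∀ σ → P (false ∷ σ) ≡ true → ∃ λ a → e (Fin.splitAt k₀ a) ≡ false ∷ σ
  covers-false σ p with a , refl ← all₀ σ p = a Fin.↑ˡ k₁ , cong e (Fin.splitAt-↑ˡ k₀ a k₁)
  covers-true : ∀ σ → P (true ∷ σ) ≡ true → ∃ λ a → e (Fin.splitAt k₀ a) ≡ true ∷ σ
  covers-true σ p with b , refl ← all₁ σ p = k₀ Fin.↑ʳ b , cong e (Fin.splitAt-↑ʳ k₀ k₁ b)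

entry : ∀ {n} k → Tup n k → Fin k → Vec Bool n
entry (suc k) (σ , l) zero    = σ
entry (suc k) (σ , l) (suc i) = entry k l i

entry-member : ∀ {n} k {σ} (l : Tup n k) i → σ ≡ entry k l i → Member σ l
entry-member (suc k) (υ , l) zero    e = inj₁ e
entry-member (suc k) (υ , l) (suc i) e = inj₂ (entry-member k l i e)

entry-repeats : ∀ {n} k (l : Tup n k) i j → i Fin.< j → entry k l i ≡ entry k l j → Repeats l
entry-repeats (suc k) (σ , l) zero    (suc j) i<j       e = inj₁ (entry-member k l j e)
entry-repeats (suc k) (σ , l) (suc i) (suc j) (ℕ.s≤s i<j) e = inj₂ (entry-repeats k l i j i<j e)

module Projection {n m : ℕ} (π : Fin n → Fin m) (X : Complex n)
                  (inj : ∀ {σ} → Simplex X σ → InjectiveOn π σ) where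

  open Coloured π X inj
  open Powers rem rem-comm F F-rem
  open Zigzag rem rem-comm F F-rem

  hat-off : ∀ b τ σ → image π σ ≢ τ → hat b (τ , σ) ≡ 0ℚ
  hat-off b τ σ ≢τ = trans (cong (λ c → bit c * (orient σ * b σ)) (does-false (image π σ ≟ⱽ τ) ≢τ)) (zeroˡ _)

  hat-on : ∀ b σ → hat b (image π σ , σ) ≡ orient σ * b σ
  hat-on b σ = trans (cong (λ c → bit c * (orient σ * b σ)) (does-complete (image π σ ≟ⱽ image π σ) refl))
                     (*-identityˡ _)

  hat-zero : ∀ b τ σ → (image π σ ≡ τ → b σ ≡ 0ℚ) → hat b (τ , σ) ≡ 0ℚ
  hat-zero b τ σ e with image π σ ≟ⱽ τ
  ... | yes p = trans (*-identityˡ _) (trans (cong (orient σ *_) (e p)) (zeroʳ _))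
  ... | no _  = zeroˡ _

  -- Restricting the colours to S corresponds to the induced subcomplex on A, the vertices with
  -- colour in S, and `hat` identifies its chains with those of the total complex. Cells of degree q
  -- + 1 have dimension q.
  base-leray : ∀ d → (∀ S i → ℤ.+ d ℤ.≤ i → H̃-Vanishes i (X [ S ])) → Leray d m base F
  base-leray d vanish = total⇒leray m base-lawful exact
    where
    exact : ∀ S q → d ℕ.< q → Exact (Tot m base) (spread (F ∣ᴳ S)) q
    exact S (suc q) (ℕ.s≤s d≤q) c s h cyc =
      hat b , b-supp , b-hom , λ (τ , σ) → boundary τ σ (image π σ ≟ⱽ τ)
      where
      A : Subset n
      A = tabulate (λ v → lookup S (π v))
      inA : ∀ v → lookup A v ≡ lookup S (π v)
      inA v = Vec.lookup∘tabulate _ v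
      c̃ : Chains n
      c̃ σ = orient σ * c (image π σ , σ)
      c-off : ∀ τ σ → F τ σ ≡ false → c (τ , σ) ≡ 0ℚ
      c-off τ σ e = s (τ , σ) (trans (cong (within S τ ∧_) e) (Bool.∧-zeroʳ _))
      c̃-supp : ∀ σ → ¬ Simplex X σ → c̃ σ ≡ 0ℚ
      c̃-supp σ ∉X = trans (cong (orient σ *_) (c-off (image π σ) σ
        (does-false (simplex? X σ ×-dec (image π σ ≟ⱽ image π σ)) (∉X ∘ proj₁)))) (zeroʳ _)
      hat-c̃ : hat c̃ ≗ c
      hat-c̃ (τ , σ) = by-image (image π σ ≟ⱽ τ)
        where
        by-image : Dec (image π σ ≡ τ) → hat c̃ (τ , σ) ≡ c (τ , σ)
        by-image (yes refl) = trans (hat-on c̃ σ) (sgn-cancel (concordance π σ) _)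
        by-image (no ≢τ) = trans (hat-off c̃ τ σ ≢τ) (sym (c-off τ σ
          (does-false (simplex? X σ ×-dec (image π σ ≟ⱽ τ)) (≢τ ∘ proj₂))))
      chain : IsChain (X [ A ]) (ℤ.+ q) c̃
      chain σ c̃≢0 with (within S (image π σ) ∧ F (image π σ) σ) in in-supp
                      | (∣ image π σ ∣ ℕ.+ 0 ≡ᵇ suc q) in in-degree
      ... | false | _ = ⊥-elim (c̃≢0 (trans (cong (orient σ *_) (s (image π σ , σ) in-supp)) (zeroʳ _)))
      ... | true | false = ⊥-elim (c̃≢0 (trans (cong (orient σ *_) (h (image π σ , σ) in-degree)) (zeroʳ _)))
      ... | true | true =
        (σ∈X , λ {v} v∈ → lookup⇒∈ (trans (inA v) (within-sound S (image π σ) (∧-left in-supp) (π v)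
                   (lookup-image⁺ π σ (∈⇒lookup v∈))))) ,
        suc-dim (trans (sym (size-image π σ (inj σ∈X)))
                (trans (sym (ℕ.+-identityʳ _)) (≡ᵇ-sound _ (suc q) in-degree)))
        where
        ∧-left : ∀ {a b} → a ∧ b ≡ true → a ≡ true
        ∧-left {true} _ = refl
        ∧-right : ∀ {a b} → a ∧ b ≡ true → b ≡ true
        ∧-right {true} e = e
        σ∈X : Simplex X σ
        σ∈X = proj₁ (F-sound (image π σ) σ (∧-right {within S (image π σ)} in-supp))
      filling = vanish A (ℤ.+ q) (+≤+ d≤q) c̃ chain λ σ →
        trans (∂-hat c̃ c̃-supp σ)
       (trans (cong (orient σ *_) (trans (ext (Tot-∂-linear m base-lawful) hat-c̃ (image π σ , σ)) (cyc _))) (zeroʳ _))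
      b : Chains n
      b = proj₁ filling
      b-chain : IsChain (X [ A ]) (ℤ.+ suc q) b
      b-chain = proj₁ (proj₂ filling)
      b-off : ∀ σ → ¬ Simplex X σ → b σ ≡ 0ℚ
      b-off σ ∉X = by-nonzero λ b≢0 → ∉X (proj₁ (proj₁ (b-chain σ b≢0)))
      b-supp : Supp (spread (F ∣ᴳ S)) (hat b)
      b-supp (τ , σ) e = hat-zero b τ σ λ { refl → by-nonzero λ b≢0 →
        let (σ∈X , σ⊆A) , _ = b-chain σ b≢0 in
        true≢false (cong₂ _∧_ (within-complete S (image π σ) λ j j∈ → image-within σ⊆A j j∈)
                              (F-complete _ σ σ∈X refl)) e }
        where
        image-within : σ ⊆ A → ∀ j → lookup (image π σ) j ≡ true → lookup S j ≡ true
        image-within σ⊆A j j∈ with v , v∈ , refl ← lookup-image⁻ π σ j∈ =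
          trans (sym (inA v)) (∈⇒lookup (σ⊆A (lookup⇒∈ v∈)))
      b-hom : Hom (deg (Tot m base)) (_≡ᵇ suc (suc q)) (hat b)
      b-hom (τ , σ) e = hat-zero b τ σ λ { refl → by-nonzero λ b≢0 →
        let (σ∈X , _) , dimσ = b-chain σ b≢0 in
        true≢false (≡ᵇ-refl (suc (suc q)))
          (trans (cong (_≡ᵇ suc (suc q)) (sym (trans (ℕ.+-identityʳ _)
            (trans (size-image π σ (inj σ∈X)) (dim-suc ∣ σ ∣ dimσ))))) e) }
      boundary : ∀ τ σ → Dec (image π σ ≡ τ) → ∂ (Tot m base) (hat b) (τ , σ) ≡ c (τ , σ)
      boundary τ σ (yes refl) =
        trans (sym (sgn-cancel (concordance π σ) _))
       (trans (cong (orient σ *_) (trans (sym (∂-hat b b-off σ)) (proj₂ (proj₂ filling) σ)))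
              (sgn-cancel (concordance π σ) _))
      boundary τ σ (no ≢τ) =
        trans (Tot-supp m base-respectful (hat b) hat-F (τ , σ) F-false) (sym (c-off τ σ F-false))
        where
        F-false : F τ σ ≡ false
        F-false = does-false (simplex? X σ ×-dec (image π σ ≟ⱽ τ)) (≢τ ∘ proj₂)
        hat-F : Supp (spread F) (hat b)
        hat-F (τ , σ) e = b-supp (τ , σ) (trans (cong (within S τ ∧_) e) (Bool.∧-zeroʳ _))

  module _ (d r : ℕ) (vanish : ∀ S i → ℤ.+ d ℤ.≤ i → H̃-Vanishes i (X [ S ])) (0<r : 0 ℕ.< r)
           (fibres : ∀ τ → proj₁ (enumerate n (F τ)) ℕ.≤ r) where

    private
      bound : ∀ k → r ℕ.< k → ∀ τ (l : Tup n k) → TG k τ l ≡ true → Repeats l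
      bound k r<k τ l l∈ =
        let k₀ , e , _ , _ , covers = enumerate n (F τ)
            at = λ i → covers (entry k l i) (entry-in k l l∈ i)
            i , j , i<j , same = Fin.pigeonhole (ℕ.≤-<-trans (fibres τ) r<k) (λ i → proj₁ (at i))
        in entry-repeats k l i j i<j (trans (sym (proj₂ (at i))) (trans (cong e same) (proj₂ (at j))))
        where
        entry-in : ∀ k (l : Tup n k) → TG k τ l ≡ true → ∀ i → F τ (entry k l i) ≡ true
        entry-in (suc k) (σ , l) e i with F τ σ in eq | i
        ... | true | zero  = eq
        ... | true | suc i = entry-in k l e i

      D₀ : Chains m → Chains m
      D₀ z τ = D 0 (λ (τ , _) → z τ) (τ , tt)

      ∂-D₀ : ∀ z τ → Defs.∂ z τ ≡ sgn ∣ τ ∣ * D₀ z τ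
      ∂-D₀ z τ =
        trans (∂-sum z τ)
       (trans (sum-cong-≗ λ j → if-scale (lookup τ j) (sgn ∣ τ ∣) λ e →
                 trans (cong (_* z (insert j τ)) (position-sign j τ e)) (*-assoc (sgn ∣ τ ∣) _ _))
       (trans (sum-scale (sgn ∣ τ ∣) (face (T 0) (λ (τ , _) → z τ) τ tt))
              (cong (sgn ∣ τ ∣ *_)
                (trans (sym (trans (cong (_+ sum (face (T 0) (λ (τ , _) → z τ) τ tt)) (zeroʳ (sgn ∣ τ ∣))) (+-identityˡ _)))
                       (sym (Tot-∂ m (T-lawful 0) (λ (τ , _) → z τ) τ tt))))))

      void-off : ∀ τ → ¬ Simplex (imageComplex π X) τ → countV n (F τ) ≡ 0
      void-off τ ∉Y = countV-empty n (F τ) λ σ →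
        does-false (simplex? X σ ×-dec (image π σ ≟ⱽ τ)) λ (σ∈X , e) → ∉Y (σ , σ∈X , e)

    image-vanishes : ∀ q → r ℕ.* d ℕ.+ r ℕ.≤ suc q → H̃-Vanishes (ℤ.+ q) (imageComplex π X)
    image-vanishes q r≤q z z-chain cyc =
      let y , y-void , y-size , Dy = fill-image d r (base-leray d vanish) bound 0<r (suc q) r≤q
            (λ (τ , _) → z τ)
            (λ τ void → by-nonzero λ z≢0 → let (σ , σ∈X , e) , _ = z-chain τ z≢0 in
              true≢false (F-complete τ σ σ∈X e) (countV-zero n (F τ) void σ))
            (λ τ _ e → by-nonzero λ z≢0 →
              true≢false (trans (cong (_≡ᵇ suc q) (size-z τ z≢0)) (≡ᵇ-refl (suc q))) e)
            (λ (τ , _) → trans (sym (sgn-cancel ∣ τ ∣ _))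
              (trans (cong (sgn ∣ τ ∣ *_) (trans (sym (∂-D₀ z τ)) (cyc τ))) (zeroʳ _)))
          b : Chains m
          -- ∂ and `D₀` differ by the sign of |τ|. The cycle z lives on sets of size q + 1, so one
          -- constant sign repairs the filling.
          b τ = sgn (suc q) * y (τ , tt)
          y≢0 : ∀ τ → b τ ≢ 0ℚ → y (τ , tt) ≢ 0ℚ
          y≢0 τ b≢0 y≡0 = b≢0 (trans (cong (sgn (suc q) *_) y≡0) (zeroʳ _))
      in b ,
         (λ τ b≢0 →
           decidable-stable (simplex? (imageComplex π X) τ)
             (λ ∉Y → y≢0 τ b≢0 (y-void τ (void-off τ ∉Y))) ,
           suc-dim (sized τ y y-size (y≢0 τ b≢0))) ,
         λ τ → trans (∂-D₀ b τ)
              (trans (cong (sgn ∣ τ ∣ *_) (trans (scale (D-linear 0) (sgn (suc q)) y (τ , tt)) (cong (sgn (suc q) *_) (Dy (τ , tt)))))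
                     (same-sign τ))
      where
      size-z : ∀ τ → z τ ≢ 0ℚ → ∣ τ ∣ ≡ suc q
      size-z τ z≢0 = dim-suc ∣ τ ∣ (proj₂ (z-chain τ z≢0))
      sized : ∀ τ (y : Chain (Cells 0)) → HasSize (_≡ᵇ suc (suc q)) y → y (τ , tt) ≢ 0ℚ → ∣ τ ∣ ≡ suc (suc q)
      sized τ y h y≢0 with (∣ τ ∣ ≡ᵇ suc (suc q)) in eq
      ... | true  = ≡ᵇ-sound ∣ τ ∣ (suc (suc q)) eq
      ... | false = ⊥-elim (y≢0 (h τ tt eq))
      same-sign : ∀ τ → sgn ∣ τ ∣ * (sgn (suc q) * z τ) ≡ z τ
      same-sign τ with z τ ℚ.≟ 0ℚ
      ... | yes z≡0 = trans (cong (λ a → sgn ∣ τ ∣ * (sgn (suc q) * a)) z≡0)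
                     (trans (cong (sgn ∣ τ ∣ *_) (zeroʳ _)) (trans (zeroʳ _) (sym z≡0)))
      ... | no z≢0 rewrite size-z τ z≢0 = sgn-cancel (suc q) (z τ)

-- Fibres of the geometric realisation

open RawMonoidDefs ℝ-rawMonoid using () renaming (sum to sumℝ)

small-set : ∀ {n} {τ : Subset n} → ∣ τ ∣ ℕ.≤ 1 → ∀ {v w} → v ∈ τ → w ∈ τ → v ≡ w
small-set {τ = τ} ≤1 {v} {w} v∈ w∈ with v Fin.≟ w
... | yes v≡w = v≡w
... | no  v≢w = ⊥-elim (ℕ.<⇒≱ (ℕ.≤-trans (ℕ.s≤s (ℕ.≤-<-trans ℕ.z≤n (x∈p⇒∣p-x∣<∣p∣ (x∈p∧x≢y⇒x∈p-y v∈ v≢w))))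
                                           (x∈p⇒∣p-x∣<∣p∣ w∈)) ≤1)

same-seq : ∀ {x y : ℝ} → (∀ k → seq x k ≡ seq y k) → x ≈ℝ y
same-seq {x} {y} e ε 0<ε = 0 , λ k _ →
  subst (ℚ._< ε) (sym (cong ℚ.∣_∣ (trans (cong (ℚ._- seq y k) (e k)) (ℚ.+-inverseʳ (seq y k))))) 0<ε

≈ℝ-trans : ∀ {x y z} → x ≈ℝ y → y ≈ℝ z → x ≈ℝ z
≈ℝ-trans {x} {y} {z} = ≈-trans {x} {y} {z}

≈ℝ-sym : ∀ {x y} → x ≈ℝ y → y ≈ℝ x
≈ℝ-sym {x} {y} = ≈-sym {x} {y}

+ℝ-cong : ∀ {x x′ y y′} → x ≈ℝ x′ → y ≈ℝ y′ → x +ℝ y ≈ℝ x′ +ℝ y′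
+ℝ-cong {x} {x′} {y} {y′} p q ε 0<ε =
  let M , p< = p (½ ℚ.* ε) half
      N , q< = q (½ ℚ.* ε) half
  in M ℕ.⊔ N , λ k ≤k →
    ℚ.≤-<-trans
      (subst (λ a → ℚ.∣ a ∣ ℚ.≤ ℚ.∣ seq x k ℚ.- seq x′ k ∣ ℚ.+ ℚ.∣ seq y k ℚ.- seq y′ k ∣)
             (regroup (seq x k) (seq x′ k) (seq y k) (seq y′ k))
             (ℚ.∣p+q∣≤∣p∣+∣q∣ (seq x k ℚ.- seq x′ k) (seq y k ℚ.- seq y′ k)))
      (subst (ℚ.∣ seq x k ℚ.- seq x′ k ∣ ℚ.+ ℚ.∣ seq y k ℚ.- seq y′ k ∣ ℚ.<_) halves
             (ℚ.+-mono-< (p< k (ℕ.m⊔n≤o⇒m≤o M N ≤k)) (q< k (ℕ.m⊔n≤o⇒n≤o M N ≤k))))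
  where
  half : 0ℚ ℚ.< ½ ℚ.* ε
  half = subst (ℚ._< ½ ℚ.* ε) (ℚ.*-zeroʳ ½) (ℚ.*-monoʳ-<-pos ½ 0<ε)
  halves : ½ ℚ.* ε ℚ.+ ½ ℚ.* ε ≡ ε
  halves = trans (sym (ℚ.*-distribʳ-+ ε ½ ½)) (ℚ.*-identityˡ ε)
  regroup : ∀ a a′ b b′ → (a ℚ.- a′) ℚ.+ (b ℚ.- b′) ≡ (a ℚ.+ b) ℚ.- (a′ ℚ.+ b′)
  regroup a a′ b b′ = ring-regroup a a′ b b′
    where
    opaque
      unfolding _+_ -_
      ring-regroup : ∀ a a′ b b′ → (a ℚ.- a′) ℚ.+ (b ℚ.- b′) ≡ (a ℚ.+ b) ℚ.- (a′ ℚ.+ b′)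
      ring-regroup a a′ b b′ = trans (+-interchange a (- a′) b (- b′)) (cong (λ c → (a + b) + c) (sym (neg-+ a′ b′)))

sumℝ-zero : ∀ {n} {x : Fin n → ℝ} → (∀ v → x v ≈ℝ 0ℝ) → sumℝ x ≈ℝ 0ℝ
sumℝ-zero {zero}      e = ≈-refl {0ℝ}
sumℝ-zero {suc n} {x} e =
  ≈ℝ-trans {sumℝ x} {0ℝ +ℝ 0ℝ} {0ℝ}
    (+ℝ-cong {x zero} {0ℝ} {sumℝ (x ∘ suc)} {0ℝ} (e zero) (sumℝ-zero {x = x ∘ suc} (e ∘ suc)))
    (same-seq {0ℝ +ℝ 0ℝ} {0ℝ} λ _ → refl)

sumℝ-single : ∀ {n} (x : Fin n → ℝ) v → (∀ w → w ≢ v → x w ≈ℝ 0ℝ) → sumℝ x ≈ℝ x v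
sumℝ-single x zero e =
  ≈ℝ-trans {sumℝ x} {x zero +ℝ 0ℝ} {x zero}
    (+ℝ-cong {x zero} {x zero} {sumℝ (x ∘ suc)} {0ℝ} (≈-refl {x zero})
      (sumℝ-zero {x = x ∘ suc} λ w → e (suc w) λ ()))
    (same-seq {x zero +ℝ 0ℝ} {x zero} λ k → ℚ.+-identityʳ _)
sumℝ-single x (suc v) e =
  ≈ℝ-trans {sumℝ x} {0ℝ +ℝ x (suc v)} {x (suc v)}
    (+ℝ-cong {x zero} {0ℝ} {sumℝ (x ∘ suc)} {x (suc v)} (e zero λ ())
      (sumℝ-single (x ∘ suc) v (λ w w≢v → e (suc w) (w≢v ∘ Fin.suc-injective))))
    (same-seq {0ℝ +ℝ x (suc v)} {x (suc v)} λ k → ℚ.+-identityˡ _)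

seq-sumℝ : ∀ {n} (x : Fin n → ℝ) k → seq (sumℝ x) k ≡ sum (λ v → seq (x v) k)
seq-sumℝ x k = trans (raw x) (sumℚ≡sum (λ v → seq (x v) k))
  where
  raw : ∀ {n} (x : Fin n → ℝ) → seq (sumℝ x) k ≡ sumℚ (λ v → seq (x v) k)
  raw {zero}  x = refl
  raw {suc n} x = cong (seq (x zero) k ℚ.+_) (raw (x ∘ suc))

nonneg-≢⇒< : ∀ {q} → 0ℚ ℚ.≤ q → q ≢ 0ℚ → 0ℚ ℚ.< q
nonneg-≢⇒< 0≤q q≢0 = ℚ.≰⇒> λ q≤0 → q≢0 (ℚ.≤-antisym q≤0 0≤q)

fromℚ-apart : ∀ q → q ≢ 0ℚ → ¬ (fromℚ q ≈ℝ 0ℝ)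
fromℚ-apart q q≢0 e with N , close ← e ℚ.∣ q ∣ (nonneg-≢⇒< (ℚ.0≤∣p∣ q) (q≢0 ∘ ℚ.∣p∣≡0⇒p≡0 q)) =
  ℚ.<-irrefl (cong ℚ.∣_∣ (ℚ.+-identityʳ q)) (close N ℕ.≤-refl)

opaque
  unfolding _+_ _*_ -_

  unit-fraction : ∀ k → ∃ λ q → 0ℚ ℚ.≤ q × q ≢ 0ℚ × q * num (suc k) ≡ 1ℚ
  unit-fraction k = q , ℚ.<⇒≤ (ℚ.positive⁻¹ q {{ℚ.1/pos⇒pos (num (suc k)) {{pos}}}}) ,
    (λ q≡0 → num-suc≢0 0 (trans (ℚ.+-identityʳ 1ℚ) (trans (sym q*num) (trans (cong (ℚ._* num (suc k)) q≡0) (ℚ.*-zeroˡ (num (suc k))))))) ,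
    q*num
    where
    pos : ℚ.Positive (num (suc k))
    pos = ℚ.positive (nonneg-≢⇒< (num-nonneg (suc k)) (num-suc≢0 k))
    q : ℚ
    q = ℚ.1/_ (num (suc k)) {{ℚ.pos⇒nonZero (num (suc k)) {{pos}}}}
    q*num : q ℚ.* num (suc k) ≡ 1ℚ
    q*num = ℚ.*-inverseˡ (num (suc k)) {{ℚ.pos⇒nonZero (num (suc k)) {{pos}}}}

sum-bits-size : ∀ {n} (σ : Subset n) → sum (λ v → bit (lookup σ v)) ≡ num ∣ σ ∣
sum-bits-size []          = refl
sum-bits-size (false ∷ σ) = trans (+-identityˡ _) (sum-bits-size σ)
sum-bits-size (true  ∷ σ) = cong (1ℚ +_) (sum-bits-size σ)

module Barycentres {n m : ℕ} (π : Fin n → Fin m) (X : Complex n)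
                   (inj : ∀ {σ} → Simplex X σ → InjectiveOn π σ) where

  open Coloured π X inj using (F; F-sound; F-complete)

  private
    over : ∣ X ∣ᴳ → Fin m → Fin n → ℝ
    over y j v = if ⌊ π v Fin.≟ j ⌋ then coord y v else 0ℝ

  -- π is injective on the carrier, so the coordinate of v is the only summand over its colour that
  -- can be nonzero.
  push-on : ∀ (y : ∣ X ∣ᴳ) v → lookup (proj₁ (carrier y)) v ≡ true → Defs.push π y (π v) ≈ℝ coord y v
  push-on y v v∈ = ≈ℝ-trans {sumℝ (over y (π v))} {over y (π v) v} {coord y v}
    (sumℝ-single (over y (π v)) v others) self
    where
    others : ∀ w → w ≢ v → over y (π v) w ≈ℝ 0ℝ
    others w w≢v with π w Fin.≟ π v
    ... | no _ = ≈-refl {0ℝ}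
    ... | yes e = proj₂ (proj₂ (carrier y)) w λ w∈ →
      w≢v (inj (proj₁ (proj₂ (carrier y))) w v (∈⇒lookup w∈) v∈ e)
    self : over y (π v) v ≈ℝ coord y v
    self with π v Fin.≟ π v
    ... | yes _ = ≈-refl {coord y v}
    ... | no ≢  = ⊥-elim (≢ refl)

  push-off : ∀ (y : ∣ X ∣ᴳ) j → (∀ v → lookup (proj₁ (carrier y)) v ≡ true → π v ≢ j) → Defs.push π y j ≈ℝ 0ℝ
  push-off y j none = sumℝ-zero {x = over y j} zeros
    where
    zeros : ∀ v → over y j v ≈ℝ 0ℝ
    zeros v with π v Fin.≟ j
    ... | no _ = ≈-refl {0ℝ}
    ... | yes e = proj₂ (proj₂ (carrier y)) v λ v∈ → none v (∈⇒lookup v∈) e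

  module _ (τ : Subset m) (s : ℕ) (size : ∣ τ ∣ ≡ suc s) where

    private
      q : ℚ
      q = proj₁ (unit-fraction s)
      0≤q = proj₁ (proj₂ (unit-fraction s))
      q≢0 = proj₁ (proj₂ (proj₂ (unit-fraction s)))
      q-inverse = proj₂ (proj₂ (proj₂ (unit-fraction s)))

      level : Bool → ℚ
      level b = bit b * q

      level-nonneg : ∀ b → 0ℚ ℚ.≤ level b
      level-nonneg false = ℚ.≤-reflexive (sym (zeroˡ q))
      level-nonneg true  = subst (0ℚ ℚ.≤_) (sym (*-identityˡ q)) 0≤q

      level-≈ : ∀ {a b} → a ≡ b → fromℚ (level a) ≈ℝ fromℚ (level b)
      level-≈ {a} refl = ≈-refl {fromℚ (level a)}

      level-false : fromℚ (level false) ≈ℝ 0ℝ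
      level-false = same-seq {fromℚ (level false)} {0ℝ} λ _ → zeroˡ q

      level-true-apart : ¬ (fromℚ (level true) ≈ℝ 0ℝ)
      level-true-apart = fromℚ-apart (level true) (q≢0 ∘ trans (sym (*-identityˡ q)))

      level-injective : ∀ a b → fromℚ (level a) ≈ℝ fromℚ (level b) → a ≡ b
      level-injective false false e = refl
      level-injective true  true  e = refl
      level-injective true  false e = ⊥-elim (level-true-apart
        (≈ℝ-trans {fromℚ (level true)} {fromℚ (level false)} {0ℝ} e level-false))
      level-injective false true  e = ⊥-elim (level-true-apart
        (≈ℝ-trans {fromℚ (level true)} {fromℚ (level false)} {0ℝ}
          (≈ℝ-sym {fromℚ (level false)} {fromℚ (level true)} e) level-false))

    barycentre : ∀ σ → F τ σ ≡ true → ∣ X ∣ᴳ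
    barycentre σ e = record
      { coord     = λ v → fromℚ (level (lookup σ v))
      ; coord≥0   = λ v ε 0<ε → 0 , λ _ _ →
          subst (ℚ._< level (lookup σ v) ℚ.+ ε) (ℚ.+-identityʳ 0ℚ) (ℚ.+-mono-≤-< (level-nonneg (lookup σ v)) 0<ε)
      ; coord-sum = same-seq {sumℝ (λ v → fromℚ (level (lookup σ v)))} {1ℝ} λ k →
          trans (seq-sumℝ (λ v → fromℚ (level (lookup σ v))) k)
         (trans (sum-cong-≗ (λ v → *-comm (bit (lookup σ v)) q))
         (trans (sum-scale q (λ v → bit (lookup σ v)))
         (trans (cong (q *_) (trans (sum-bits-size σ) (cong num size-σ))) q-inverse)))
      ; carrier   = σ , σ∈X , λ v v∉ →
          ≈ℝ-trans {fromℚ (level (lookup σ v))} {fromℚ (level false)} {0ℝ}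
            (level-≈ (absent v v∉)) level-false
      }
      where
      σ∈X = proj₁ (F-sound τ σ e)
      size-σ : ∣ σ ∣ ≡ suc s
      size-σ = trans (sym (size-image π σ (inj σ∈X))) (trans (cong ∣_∣ (proj₂ (F-sound τ σ e))) size)
      absent : ∀ v → v ∉ σ → lookup σ v ≡ false
      absent v v∉ with lookup σ v in eq
      ... | false = refl
      ... | true  = ⊥-elim (v∉ (lookup⇒∈ eq))

    push-barycentre : ∀ σ e j → Defs.push π (barycentre σ e) j ≈ℝ fromℚ (level (lookup τ j))
    push-barycentre σ e j with σ∈X , refl ← F-sound τ σ e | lookup (image π σ) j in eq
    ... | true with v , v∈ , refl ← lookup-image⁻ π σ eq =
      ≈ℝ-trans {Defs.push π (barycentre σ e) (π v)} {coord (barycentre σ e) v} {fromℚ (level true)}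
        (push-on (barycentre σ e) v v∈) (level-≈ v∈)
    ... | false =
      ≈ℝ-trans {Defs.push π (barycentre σ e) j} {0ℝ} {fromℚ (level false)}
        (push-off (barycentre σ e) j λ v v∈ πv≡j → true≢false v∈ (lookup-image-false π σ eq πv≡j))
        (≈ℝ-sym {fromℚ (level false)} {0ℝ} level-false)

    -- The carrier may exceed the support, and coordinates cannot be tested for zero; so σ is cut
    -- out of the carrier by the colours in τ. It meets all of them because a colour missed by the
    -- carrier would receive weight 0, and its coordinates are those of the image point.
    over-barycentre : ∀ (y : ∣ X ∣ᴳ) → (∀ j → Defs.push π y j ≈ℝ fromℚ (level (lookup τ j))) →
              ∃ λ σ → F τ σ ≡ true × (∀ v → coord y v ≈ℝ fromℚ (level (lookup σ v)))
    over-barycentre y pushes = σ , F-complete τ σ (down X (λ {v} v∈ → lookup⇒∈ (proj₁ (split v (∈⇒lookup v∈)))) ς∈X) image-σ , coords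
      where
      ς = proj₁ (carrier y)
      ς∈X = proj₁ (proj₂ (carrier y))
      σ : Subset n
      σ = tabulate (λ v → lookup ς v ∧ lookup τ (π v))
      lookup-σ : ∀ v → lookup σ v ≡ lookup ς v ∧ lookup τ (π v)
      lookup-σ v = Vec.lookup∘tabulate _ v
      split : ∀ v → lookup σ v ≡ true → lookup ς v ≡ true × lookup τ (π v) ≡ true
      split v e with lookup ς v | lookup τ (π v) | trans (sym (lookup-σ v)) e
      ... | true | true | _ = refl , refl
      image-σ : image π σ ≡ τ
      image-σ = lookup-ext λ j → bool-ext (to j) (from j)
        where
        to : ∀ j → lookup (image π σ) j ≡ true → lookup τ j ≡ true
        to j e with v , v∈ , refl ← lookup-image⁻ π σ e = proj₂ (split v v∈)
        from : ∀ j → lookup τ j ≡ true → lookup (image π σ) j ≡ true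
        from j j∈τ with Fin.any? (λ v → (lookup ς v Bool.≟ true) ×-dec (π v Fin.≟ j))
        ... | yes (v , v∈ , refl) = lookup-image⁺ π σ (trans (lookup-σ v) (cong₂ _∧_ v∈ j∈τ))
        ... | no none = ⊥-elim (level-true-apart
          (≈ℝ-trans {fromℚ (level true)} {Defs.push π y j} {0ℝ}
            (≈ℝ-sym {Defs.push π y j} {fromℚ (level true)}
              (subst (λ b → Defs.push π y j ≈ℝ fromℚ (level b)) j∈τ (pushes j)))
            (push-off y j λ v v∈ πv≡j → none (v , v∈ , πv≡j))))
      coords : ∀ v → coord y v ≈ℝ fromℚ (level (lookup σ v))
      coords v = by-carrier (lookup ς v) refl
        where
        by-carrier : ∀ b → lookup ς v ≡ b → coord y v ≈ℝ fromℚ (level (lookup σ v))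
        by-carrier true v∈ =
          ≈ℝ-trans {coord y v} {Defs.push π y (π v)} {fromℚ (level (lookup σ v))}
            (≈ℝ-sym {Defs.push π y (π v)} {coord y v} (push-on y v v∈))
            (subst (λ b → Defs.push π y (π v) ≈ℝ fromℚ (level b))
                   (sym (trans (lookup-σ v) (cong (_∧ lookup τ (π v)) v∈))) (pushes (π v)))
        by-carrier false v∉ =
          ≈ℝ-trans {coord y v} {0ℝ} {fromℚ (level (lookup σ v))}
            (proj₂ (proj₂ (carrier y)) v (λ v∈ → true≢false (∈⇒lookup v∈) v∉))
            (≈ℝ-sym {fromℚ (level (lookup σ v))} {0ℝ}
              (subst (λ b → fromℚ (level b) ≈ℝ 0ℝ)
                     (sym (trans (lookup-σ v) (cong (_∧ lookup τ (π v)) v∉))) level-false))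

    -- The maximality of r bounds only numbers known to be the cardinality of some fibre, hence the
    -- explicit bijection between the simplices over τ and the fibre over its barycentre.
    fibre-cardinality : ∀ (E : Enumeration (F τ)) a →
      ∃ λ x → HasCardinality (Fibre {K = X} π x) (proj₁ E)
    fibre-cardinality (k , e , e-inj , e-in , e-all) a₀ = x , record
      { to        = λ a → point a , λ j →
          ≈ℝ-trans {Defs.push π (point a) j} {fromℚ (level (lookup τ j))} {Defs.push π x j}
            (push-barycentre (e a) (e-in a) j)
            (≈ℝ-sym {Defs.push π x j} {fromℚ (level (lookup τ j))} (push-barycentre (e a₀) (e-in a₀) j))
      ; from      = from
      ; to-cong   = λ { {a} refl v → ≈-refl {coord (point a) v} }
      ; from-cong = λ {y} {z} y≈z → same-index (from y) (from z) λ v →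
          ≈ℝ-trans {lev (from y) v} {coord (proj₁ y) v} {lev (from z) v}
            (≈ℝ-sym {coord (proj₁ y) v} {lev (from y) v} (from-spec y v))
            (≈ℝ-trans {coord (proj₁ y) v} {coord (proj₁ z) v} {lev (from z) v} (y≈z v) (from-spec z v))
      ; inverse   =
          (λ { {y} refl v → ≈ℝ-sym {coord (proj₁ y) v} {lev (from y) v} (from-spec y v) }) ,
          (λ {a} {y} y≈a → same-index (from y) a λ v →
            ≈ℝ-trans {lev (from y) v} {coord (proj₁ y) v} {lev a v}
              (≈ℝ-sym {coord (proj₁ y) v} {lev (from y) v} (from-spec y v)) (y≈a v))
      }
      where
      point : Fin k → ∣ X ∣ᴳ
      point a = barycentre (e a) (e-in a)
      x = point a₀
      InFibre : Set
      InFibre = ∃ λ (y : ∣ X ∣ᴳ) → ∀ j → Defs.push π y j ≈ℝ Defs.push π x j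
      lev : Fin k → Fin n → ℝ
      lev a v = fromℚ (level (lookup (e a) v))
      supported : (y : InFibre) → ∃ λ σ → F τ σ ≡ true × (∀ v → coord (proj₁ y) v ≈ℝ fromℚ (level (lookup σ v)))
      supported (y , p) = over-barycentre y λ j →
        ≈ℝ-trans {Defs.push π y j} {Defs.push π x j} {fromℚ (level (lookup τ j))}
          (p j) (push-barycentre (e a₀) (e-in a₀) j)
      found : (y : InFibre) → ∃ λ a → e a ≡ proj₁ (supported y)
      found y = e-all (proj₁ (supported y)) (proj₁ (proj₂ (supported y)))
      from : InFibre → Fin k
      from y = proj₁ (found y)
      from-spec : ∀ y v → coord (proj₁ y) v ≈ℝ lev (from y) v
      from-spec y v = subst (λ σ → coord (proj₁ y) v ≈ℝ fromℚ (level (lookup σ v)))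
        (sym (proj₂ (found y))) (proj₂ (proj₂ (supported y)) v)
      same-index : ∀ a b → (∀ v → lev a v ≈ℝ lev b v) → a ≡ b
      same-index a b h = e-inj a b (lookup-ext λ v → level-injective _ _ (h v))

  module _ (r : ℕ) (max : IsMaxFibreSize X π r) where

    fibre-size-pos : 0 ℕ.< r
    fibre-size-pos with x , card ← proj₁ max =
      ℕ.≤-<-trans ℕ.z≤n (Fin.toℕ<n (Inverse.from card (x , λ j → ≈-refl {Defs.push π x j})))

    fibre-bound : ∀ τ → proj₁ (enumerate n (F τ)) ℕ.≤ r
    fibre-bound τ with enumerate n (F τ)
    ... | zero , _ = ℕ.z≤n
    ... | E@(suc k , e , e-inj , e-in , e-all) with ∣ τ ∣ in size
    ...   | suc s = proj₂ max (suc k) (fibre-cardinality τ s size E zero)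
    -- The empty colour set has no barycentre. Only the empty simplex lies over it, and 1 ≤ r
    -- because a fibre contains its own base point.
    ...   | zero  = at-most-one k e e-inj λ a b →
      lookup-ext λ v → trans (empty-over (e a) (e-in a) v) (sym (empty-over (e b) (e-in b) v))
      where
      empty-over : ∀ σ → F τ σ ≡ true → ∀ v → lookup σ v ≡ false
      empty-over σ p v with σ∈X , refl ← F-sound τ σ p | lookup σ v in eq
      ... | false = refl
      ... | true  = ⊥-elim (ℕ.<⇒≢ (ℕ.≤-<-trans ℕ.z≤n (x∈p⇒∣p-x∣<∣p∣ (lookup⇒∈ {σ = image π σ} (lookup-image⁺ π σ eq)))) (sym size))
      at-most-one : ∀ k (e : Fin (suc k) → Subset n) → (∀ a b → e a ≡ e b → a ≡ b) →
                    (∀ a b → e a ≡ e b) → suc k ℕ.≤ r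
      at-most-one zero    e e-inj same = fibre-size-pos
      at-most-one (suc k) e e-inj same with () ← e-inj zero (suc zero) (same zero (suc zero))

-- Leray numbers

vanishes-cong : ∀ {n i} {K L : Complex n} → (∀ σ → Simplex K σ ⇔ Simplex L σ) →
                H̃-Vanishes i K → H̃-Vanishes i L
vanishes-cong K⇔L vanish c c-chain cyc =
  let b , b-chain , ∂b = vanish c
        (λ σ c≢0 → let s , d = c-chain σ c≢0 in Equivalence.from (K⇔L σ) s , d) cyc
  in b , (λ σ b≢0 → let s , d = b-chain σ b≢0 in Equivalence.to (K⇔L σ) s , d) , ∂b

-- The empty simplex carries reduced homology in degree -1.
leray-nonneg : ∀ {n} (K : Complex n) L → IsLerayNumber K L → ∃ λ d → L ≡ ℤ.+ d
leray-nonneg K (ℤ.+ d) _ = d , refl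
leray-nonneg {n} K -[1+ k ] (vanish , _) =
  ⊥-elim (num-suc≢0 0 (trans (+-identityʳ 1ℚ) (trans (sym (cong bit (does-complete (∅ ≟ ∅) refl)))
    (trans (sym (proj₂ (proj₂ filling) ∅)) (∂-zero b (λ σ size → by-nonzero (no-edge σ size)) ∅)))))
  where
  ∅ : Subset n
  ∅ = Data.Fin.Subset.⊥
  _≟_ : (σ τ : Subset n) → Dec (σ ≡ τ)
  _≟_ = Vec.≡-dec Bool._≟_
  ∂-zero : ∀ c → (∀ σ → ∣ σ ∣ ≢ 0 → c σ ≡ 0ℚ) → ∀ τ → Defs.∂ c τ ≡ 0ℚ
  ∂-zero c e τ = trans (∂-sum c τ) (sum-zero terms)
    where
    nonempty : ∀ v → ∣ insert v τ ∣ ≢ 0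
    nonempty v size = ℕ.<⇒≢ (ℕ.≤-<-trans ℕ.z≤n
      (x∈p⇒∣p-x∣<∣p∣ (lookup⇒∈ {σ = insert v τ} (lookup-insert-≡ v τ)))) (sym size)
    terms : ∀ v → (if lookup τ v then 0ℚ else sgn (position v τ) * c (insert v τ)) ≡ 0ℚ
    terms v with lookup τ v
    ... | true  = refl
    ... | false = trans (cong (sgn (position v τ) *_) (e (insert v τ) (nonempty v))) (zeroʳ _)
  c : Chains n
  c σ = bit (does (σ ≟ ∅))
  c-chain : IsChain (K [ ∅ ]) -[1+ 0 ] c
  c-chain σ c≢0 with σ ≟ ∅
  ... | yes refl = (empty K , λ v∈ → v∈) , cong (λ s → (ℤ.+ s) ℤ.- (ℤ.+ 1)) (∣⊥∣≡0 n)
  ... | no _     = ⊥-elim (c≢0 refl)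
  c-off : ∀ σ → ∣ σ ∣ ≢ 0 → c σ ≡ 0ℚ
  c-off σ size = cong bit (does-false (σ ≟ ∅) λ { refl → size (∣⊥∣≡0 n) })
  filling = vanish ∅ -[1+ 0 ] (-≤- ℕ.z≤n) c c-chain (∂-zero c c-off)
  b : Chains n
  b = proj₁ filling
  no-edge : ∀ σ → ∣ σ ∣ ≢ 0 → b σ ≢ 0ℚ → ⊥
  no-edge σ size b≢0 = size (trans (cong ∣_∣ σ≡∅) (∣⊥∣≡0 n))
    where
    σ≡∅ : σ ≡ ∅
    σ≡∅ = ⊆-antisym (proj₂ (proj₁ (proj₁ (proj₂ filling) σ b≢0))) (λ v∈ → ⊥-elim (∉⊥ v∈))

module _ {n m : ℕ} (𝒱 : DisjointSets n m) where

  open DisjointSets 𝒱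

  join-injective : ∀ {X : Complex n} → X ⊑ join → ∀ {σ} → Simplex X σ → InjectiveOn π σ
  join-injective X⊑ {σ} σ∈X v w v∈ w∈ πv≡πw =
    small-set (X⊑ σ∈X (π v)) (x∈p∩q⁺ (lookup⇒∈ {σ = σ} v∈ , proj₂ (covers v)))
      (x∈p∩q⁺ (lookup⇒∈ {σ = σ} w∈ , subst (λ i → w ∈ V i) (sym πv≡πw) (proj₂ (covers w))))

  -- The induced subcomplex of the image on S is the image of X restricted to A, the vertices with
  -- colour in S. That restriction inherits the vanishing and has at most as many simplices over
  -- each τ. Its own maximal fibre size could be smaller or, if it has no points, undefined; so what
  -- is passed on is the bound on the number of simplices.
  projection-vanishes : (X : Complex n) → X ⊑ join → (r : ℕ) → IsMaxFibreSize X π r →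
    (d : ℕ) → (∀ S i → ℤ.+ d ℤ.≤ i → H̃-Vanishes i (X [ S ])) →
    ∀ S q → r ℕ.* d ℕ.+ r ℕ.≤ suc q → H̃-Vanishes (ℤ.+ q) (imageComplex π X [ S ])
  projection-vanishes X X⊑ r max d vanish S q r≤q =
    vanishes-cong {K = imageComplex π (X [ A ])} {L = imageComplex π X [ S ]} equivalent
      (Projection.image-vanishes π (X [ A ]) inj-A d r vanish-A (Barycentres.fibre-size-pos π X inj r max)
        (λ τ → ℕ.≤-trans (fewer τ) (Barycentres.fibre-bound π X inj r max τ)) q r≤q)
    where
    A : Subset n
    A = tabulate (λ v → lookup S (π v))
    inA : ∀ v → lookup A v ≡ lookup S (π v)
    inA v = Vec.lookup∘tabulate _ v
    inj : ∀ {σ} → Simplex X σ → InjectiveOn π σ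
    inj = join-injective {X} X⊑
    inj-A : ∀ {σ} → Simplex (X [ A ]) σ → InjectiveOn π σ
    inj-A (σ∈X , _) = inj σ∈X
    vanish-A : ∀ B i → ℤ.+ d ℤ.≤ i → H̃-Vanishes i ((X [ A ]) [ B ])
    vanish-A B i d≤i = vanishes-cong {K = X [ A ∩ B ]} {L = (X [ A ]) [ B ]}
      (λ σ → mk⇔ (λ (s , ⊆AB) → (s , λ v∈ → proj₁ (x∈p∩q⁻ A B (⊆AB v∈))) , λ v∈ → proj₂ (x∈p∩q⁻ A B (⊆AB v∈)))
                 (λ ((s , ⊆A) , ⊆B) → s , λ v∈ → x∈p∩q⁺ (⊆A v∈ , ⊆B v∈)))
      (vanish (A ∩ B) i d≤i)
    equivalent : ∀ τ → Simplex (imageComplex π (X [ A ])) τ ⇔ Simplex (imageComplex π X [ S ]) τ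
    equivalent τ = mk⇔ to from
      where
      to : Simplex (imageComplex π (X [ A ])) τ → Simplex (imageComplex π X [ S ]) τ
      to (σ , (σ∈X , σ⊆A) , refl) = (σ , σ∈X , refl) , within-S
        where
        within-S : image π σ ⊆ S
        within-S j∈ with v , v∈ , refl ← lookup-image⁻ π σ (∈⇒lookup j∈) =
          lookup⇒∈ (trans (sym (inA v)) (∈⇒lookup (σ⊆A (lookup⇒∈ v∈))))
      from : Simplex (imageComplex π X [ S ]) τ → Simplex (imageComplex π (X [ A ])) τ
      from ((σ , σ∈X , refl) , ⊆S) = σ , (σ∈X , within-A) , refl
        where
        within-A : σ ⊆ A
        within-A {v} v∈ = lookup⇒∈ (trans (inA v)
          (∈⇒lookup (⊆S (lookup⇒∈ {σ = image π σ} (lookup-image⁺ π σ (∈⇒lookup v∈))))))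
    module C = Coloured π X inj
    module C-A = Coloured π (X [ A ]) inj-A
    fewer : ∀ τ → proj₁ (enumerate n (C-A.F τ)) ℕ.≤ proj₁ (enumerate n (C.F τ))
    fewer τ =
      let k′ , e′ , e′-inj , e′-in , _ = enumerate n (C-A.F τ)
          k , e , _ , _ , e-all = enumerate n (C.F τ)
          index : ∀ a → ∃ λ b → e b ≡ e′ a
          index = λ a → let (σ∈X , _) , σ↦τ = C-A.F-sound τ (e′ a) (e′-in a)
                        in e-all (e′ a) (C.F-complete τ (e′ a) σ∈X σ↦τ)
      in Fin.injective⇒≤ {f = λ a → proj₁ (index a)} λ {a} {b} same →
           e′-inj a b (trans (sym (proj₂ (index a))) (trans (cong e same) (proj₂ (index b))))

theorem1p2 : ∀ {n m : ℕ} (𝒱 : DisjointSets n m) →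
    let open DisjointSets 𝒱 in
    (X : Complex n) → X ⊑ join →
    (r : ℕ) → IsMaxFibreSize X π r →
    (LX LY : ℤ) → IsLerayNumber X LX → IsLerayNumber (imageComplex π X) LY →
    LY ℤ.≤ ℤ.+ r ℤ.* LX ℤ.+ ℤ.+ r ℤ.- ℤ.+ 1
theorem1p2 𝒱 X X⊑ zero max _ _ _ _
  with () ← Barycentres.fibre-size-pos (DisjointSets.π 𝒱) X (join-injective 𝒱 {X} X⊑) zero max
theorem1p2 𝒱 X X⊑ r@(suc r′) max LX LY isLX (_ , least)
  with d , refl ← leray-nonneg X LX isLX =
  least _ λ S i bound≤i → above S i (subst (ℤ._≤ i) (bound d) bound≤i)
  where
  -- Since r = r′ + 1, the subtraction of 1 is exact and the bound is a natural number.
  bound : ∀ d → ℤ.+ r ℤ.* ℤ.+ d ℤ.+ ℤ.+ r ℤ.- ℤ.+ 1 ≡ ℤ.+ (r ℕ.* d ℕ.+ r′)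
  bound d = trans (cong (λ a → a ℤ.+ ℤ.+ r ℤ.- ℤ.+ 1) (sym (ℤ.pos-* r d)))
                  (suc-dim (ℕ.+-suc (r ℕ.* d) r′))
  above : ∀ S i → ℤ.+ (r ℕ.* d ℕ.+ r′) ℤ.≤ i → H̃-Vanishes i (imageComplex (DisjointSets.π 𝒱) X [ S ])
  above S _ (+≤+ {n = q} r≤q) = projection-vanishes 𝒱 X X⊑ r max d (proj₁ isLX) S q
    (subst (ℕ._≤ suc q) (sym (ℕ.+-suc (r ℕ.* d) r′)) (ℕ.s≤s r≤q))
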